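{- Let $W$ be an s-word of type (ii) (so with at least two letters in $\Sigma\setminus\{\epsilon,\sigma\}$). Then $W$ is a sunword if and only if $(D_W,\Lambda_W)$ is an evenly weighted Dyck-path.
   Context: Words: over a finite alphabet $\Sigma$ with a special symbol $\epsilon$, $x^k$ denotes $k$ consecutive copies of $x$. The pattern $\pi(w)$ of a word $w$ is obtained by deleting occurrences of $\epsilon\epsilon$ (each maximal run $\epsilon^k$ becomes $\epsilon$ if $k$ is odd and vanishes if $k$ even). $v\sim w$ if $w$ arises from $v$ by cyclic shift and/or reversal; $u\approx v$ iff $\pi(u)\sim\pi(v)$; the cyclic word $[w]$ is the $\approx$-class of $w$, its elements are representatives. s-words: a cyclic word $W$ is an s-word of type (i) if $\Sigma=\{\epsilon,a\}$ and $W=[a^\lambda]$ with $\lambda$ odd; of type (ii) if $\Sigma=\{\epsilon,\sigma,a,b,\dots\}$ has at least two letters besides $\epsilon,\sigma$ and $W=[\sigma x_{i_1}^{\lambda_1}\epsilon x_{i_2}^{\lambda_2}\epsilon\cdots\epsilon x_{i_s}^{\lambda_s}]$ with $x_{i_h}\in\Sigma\setminus\{\epsilon,\sigma\}$, $x_{i_h}\ne x_{i_{h+1}}$, positive integers $\lambda_h$, every letter of $\Sigma\setminus\{\epsilon,\sigma\}$ occurring, and the sum of the exponents of each letter of $\Sigma\setminus\{\epsilon,\sigma\}$ even. Induced order: for type (ii), take a representative $\sigma u$ with $\pi(\sigma u)=\sigma u$, let $z$ be obtained from $u$ by replacing every interval $xx$ ($x\in\Sigma\setminus\{\epsilon,\sigma\}$)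 by $x\epsilon\epsilon x$, set $v=v_1\cdots v_n=\sigma\epsilon\epsilon z\epsilon\epsilon$ and label vertex $i$ of the cycle $C_n$ by $v_i$. The order $\prec$ on $\Sigma\setminus\{\epsilon\}$: $\sigma$ is least, and for distinct $x,y\ne\sigma$, $x\prec y$ iff the minimum distance in $C_n$ from vertex 1 to a vertex labeled $x$ is less than that for $y$. Write $\sigma\prec a\prec b\prec\cdots$. Sunoids and sunwords: a multisun is a diamond-free graph of odd order whose maximal cliques of size 2 span a Hamiltonian cycle (the rim), all other maximal cliques (inscribed cliques) consisting of pairwise nonconsecutive rim vertices; a sub-multisun deletes the edge sets of some, but not all, inscribed cliques. For inscribed cliques $A,B$, an $AB$-path is a rim subpath with one end in $A$, the other in $B$, no interior vertex in an inscribed clique; $A$-path means $AA$-path; $Av$-path means an $AB$-path ending at $v\in B$. N-conditions: (N1) every $A$-path has an even number $\ge4$ of vertices; (N2) inscribed cliques have odd size; (N3) all inscribed cliques share one vertex $\xi$ and are otherwise disjoint; (N4) every $A\xi$-path has an even number of vertices; (N5) every $AB$-path, $A\ne B$, has an odd number of vertices. A sunoid is a multisun such that it and all its sub-multisuns satisfy the N-conditions. For a multisun satisfying the N-conditions, label each rim vertex $\sigma$ if it is in more than one inscribed clique, $x$ if only in the inscribed clique $X$ (each inscribed clique having its own letter), $\epsilon$ otherwise; reading labels around the rim gives $w_G$ and $[w_G]$ is the s-word of $G$. A sunword is the s-word of a sunoid. Dyck-paths: a Dyck-path of semilength $n$ is a sequence of lattice points $P_0,\dots,P_{2n}$ with nonnegative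 ordinates, $P_0=(0,0)$, $P_{2n}=(2n,0)$ and $P_{i+1}-P_i\in\{(1,1),(1,-1)\}$. For $1\le i\le 2n-1$, $P_i$ is a peak if $P_{i-1}$ and $P_{i+1}$ have the same ordinate. An evenly weighted Dyck-path is a pair $(D,\Lambda)$ with $D$ a Dyck-path of semilength $n$ and $\Lambda:\{0,\dots,2n\}\to\mathbb{Z}_+$ such that $\Lambda(i)$ is even if $P_i$ is a peak and odd otherwise. The pair $(D_W,\Lambda_W)$: choose a representative $\sigma z_{i_1}^{\lambda_1}\epsilon z_{i_2}^{\lambda_2}\epsilon\cdots\epsilon z_{i_s}^{\lambda_s}$ of $W$ (in the type (ii) form) with $z_{i_1}=a$. For a letter $z\ne\sigma$ let $h(z)$ be its rank in the chain $a\prec b\prec c\prec\cdots$ counted from $h(a)=0$, $h(b)=1$, etc. Put $P_j=(j,h(z_{i_{j+1}}))$ for $j=0,\dots,s-1$, $D_W=\{P_0,\dots,P_{s-1}\}$ and $\Lambda_W(j)=\lambda_{j+1}$.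
   Formalization: In (N5), AB-paths are taken with ends in A∖B and B∖A, so not ending at ξ; read literally, (N4) and (N5) contradict each other for two or more inscribed cliques. "(D_W,Λ_W) is an evenly weighted Dyck-path" includes that ≺ is a chain, so that D_W is defined. -}

module Defs where

open import Level using () renaming (suc to lsuc; zero to lzero)
open import Data.Nat using (ℕ; zero; suc; _+_; _*_; _∸_; _≤_; _<_; _<?_; _⊓_; NonZero)
open import Data.Nat.DivMod using (_%_; m%n<n)
open import Data.Nat.Divisibility using (_∣_)
open import Data.Integer as ℤ using (ℤ; +_)
open import Data.Fin as Fin using (Fin; toℕ; fromℕ<)
open import Data.Fin.Subset using (Subset; _∈_; _∉_; _⊆_; ∣_∣; ⁅_⁆; _∪_)
open import Data.Fin.Subset.Properties using (_∈?_)
open import Data.List using (List; []; _∷_; _++_; length; map; reverse; drop; take; filter; replicate; allFin)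
open import Data.Nat.ListAction using (sum)
open import Data.List.Relation.Unary.All using (All)
open import Data.List.Relation.Unary.Linked using (Linked)
open import Data.List.Membership.Propositional using () renaming (_∈_ to _∈ₗ_)
open import Data.Product using (Σ; ∃; ∃-syntax; _×_; _,_; proj₁; proj₂)
open import Data.Sum using (_⊎_)
open import Data.Empty using (⊥)
open import Function using (_∘_; Injective)
open import Relation.Nullary using (¬_; Dec; yes; no; does)
open import Relation.Binary.PropositionalEquality using (_≡_; _≢_; refl; cong)
open import Data.Bool using (Bool; true; false; if_then_else_; _∧_)

Even : ℕ → Set
Even n = 2 ∣ n

Odd : ℕ → Set
Odd n = ¬ Even n

data Letter (m : ℕ) : Set where
  ε  : Letter m
  σ  : Letter m
  lt : Fin m → Letter m

_≟L_ : ∀ {m} (c d : Letter m) → Dec (c ≡ d)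
ε ≟L ε = yes refl
ε ≟L σ = no λ ()
ε ≟L lt _ = no λ ()
σ ≟L ε = no λ ()
σ ≟L σ = yes refl
σ ≟L lt _ = no λ ()
lt _ ≟L ε = no λ ()
lt _ ≟L σ = no λ ()
lt x ≟L lt y with x Fin.≟ y
... | yes refl = yes refl
... | no x≢y = no λ { refl → x≢y refl }

Word : ℕ → Set
Word m = List (Letter m)

π : ∀ {m} → Word m → Word m
π [] = []
π (ε ∷ ε ∷ w) = π w
π (ε ∷ w) = ε ∷ π w
π (c ∷ w) = c ∷ π w

rot : ∀ {m} → ℕ → Word m → Word m
rot k v = drop k v ++ take k v

_∼_ : ∀ {m} → Word m → Word m → Set
v ∼ w = ∃[ k ] (k ≤ length v × (w ≡ rot k v ⊎ w ≡ reverse (rot k v)))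

-- u ≈ v  iff  π(u) ∼ π(v); the cyclic word [w] is the ≈-class of w,
-- so "[u] = [v]" is expressed as u ≈ v.
_≈_ : ∀ {m} → Word m → Word m → Set
u ≈ v = π u ∼ π v

-- s-words of type (ii), given in block form
-- A block list  (x₁,λ₁) … (x_s,λ_s)  stands for  σ x₁^λ₁ ε x₂^λ₂ ε ⋯ ε x_s^λ_s

Blocks : ℕ → Set
Blocks m = List (Fin m × ℕ)

pow : ∀ {m} → Fin m × ℕ → Word m
pow (x , l) = replicate l (lt x)

body : ∀ {m} → Blocks m → Word m
body [] = []
body (b ∷ []) = pow b
body (b ∷ b' ∷ bs) = pow b ++ ε ∷ body (b' ∷ bs)

blockWord : ∀ {m} → Blocks m → Word m
blockWord B = σ ∷ body B

expSum : ∀ {m} → Fin m → Blocks m → ℕ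
expSum x B = sum (map proj₂ (filter (λ p → proj₁ p Fin.≟ x) B))

TypeIIBlocks : ∀ {m} → Blocks m → Set
TypeIIBlocks {m} B =
  All (λ p → 1 ≤ proj₂ p) B ×
  Linked (λ p q → proj₁ p ≢ proj₁ q) B ×
  (∀ (x : Fin m) → x ∈ₗ map proj₁ B) ×
  (∀ (x : Fin m) → Even (expSum x B))

IIForm : ∀ {m} → Blocks m → Word m → Set
IIForm B w = TypeIIBlocks B × (blockWord B ≈ w)

SWordII : ∀ {m} → Word m → Set
SWordII {m} w = 2 ≤ m × ∃[ B ] IIForm B w

-- Induced order, computed from the representative σu = blockWord B
-- (for which π(σu) = σu)

isLetter : ∀ {m} → Letter m → Bool
isLetter (lt _) = true
isLetter _ = false

spread′ : ∀ {m} → Letter m → Word m → Word m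
spread′ c [] = c ∷ []
spread′ c (d ∷ t) =
  (if isLetter c ∧ does (c ≟L d) then c ∷ ε ∷ ε ∷ [] else c ∷ []) ++ spread′ d t

spread : ∀ {m} → Word m → Word m
spread [] = []
spread (c ∷ t) = spread′ c t

vWord : ∀ {m} → Blocks m → Word m
vWord B = σ ∷ ε ∷ ε ∷ (spread (body B) ++ ε ∷ ε ∷ [])

-- positions (0-based; index 0 is vertex 1 of C_n) carrying the label c
positions : ∀ {m} → Letter m → Word m → ℕ → List ℕ
positions c [] i = []
positions c (d ∷ v) i with does (d ≟L c)
... | true  = i ∷ positions c v (suc i)
... | false = positions c v (suc i)

cycDist : ℕ → ℕ → ℕ
cycDist n i = i ⊓ (n ∸ i)

minimum : ℕ → List ℕ → ℕ
minimum d [] = d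
minimum d (x ∷ xs) = x ⊓ minimum d xs

-- minimum distance in C_n from vertex 1 to a vertex labeled x
-- (the default n is never attained, since every letter occurs)
minDist : ∀ {m} → Blocks m → Fin m → ℕ
minDist B x =
  let v = vWord B ; n = length v in
  minimum n (map (cycDist n) (positions (lt x) v 0))

_≺[_]_ : ∀ {m} → Fin m → Blocks m → Fin m → Set
x ≺[ B ] y = minDist B x < minDist B y

IsChain : ∀ {m} → Blocks m → Set
IsChain {m} B = ∀ (x y : Fin m) → x ≢ y → (x ≺[ B ] y) ⊎ (y ≺[ B ] x)

rank : ∀ {m} → Blocks m → Fin m → ℕ
rank {m} B z = length (filter (λ y → minDist B y <? minDist B z) (allFin m))

FirstIsLeast : ∀ {m} → Blocks m → Set
FirstIsLeast [] = ⊥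
FirstIsLeast B@((x , _) ∷ _) = rank B x ≡ 0

-- Dyck paths (a sequence P₀ … P_{2n} given as a function on ℕ,
-- only the values at 0 … 2n matter)

Point : Set
Point = ℤ × ℤ

IsDyckPath : ℕ → (ℕ → Point) → Set
IsDyckPath n P =
  P 0 ≡ (+ 0 , + 0) ×
  P (2 * n) ≡ (+ (2 * n) , + 0) ×
  (∀ i → i ≤ 2 * n → + 0 ℤ.≤ proj₂ (P i)) ×
  (∀ i → i < 2 * n →
     P (suc i) ≡ (proj₁ (P i) ℤ.+ + 1 , proj₂ (P i) ℤ.+ + 1) ⊎
     P (suc i) ≡ (proj₁ (P i) ℤ.+ + 1 , proj₂ (P i) ℤ.- + 1))

IsPeak : ℕ → (ℕ → Point) → ℕ → Set
IsPeak n P i = 1 ≤ i × i ≤ 2 * n ∸ 1 × proj₂ (P (i ∸ 1)) ≡ proj₂ (P (suc i))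

IsEvenlyWeighted : ℕ → (ℕ → Point) → (ℕ → ℕ) → Set
IsEvenlyWeighted n P Λ =
  IsDyckPath n P ×
  (∀ i → i ≤ 2 * n →
     1 ≤ Λ i × (IsPeak n P i → Even (Λ i)) × (¬ IsPeak n P i → Odd (Λ i)))

at : ∀ {A : Set} → A → List A → ℕ → A
at d [] _ = d
at d (x ∷ xs) zero = x
at d (x ∷ xs) (suc j) = at d xs j

D-of : ∀ {m} → Blocks m → ℕ → Point
D-of B j = (+ j , + at 0 (map (rank B ∘ proj₁) B) j)

Λ-of : ∀ {m} → Blocks m → ℕ → ℕ
Λ-of B j = at 0 (map proj₂ B) j

-- (D_W, Λ_W) is an evenly weighted Dyck-path: the order ≺ is a chain,
-- B is a type (ii) representative of W with z_{i₁} = a, and the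
-- resulting pair is an evenly weighted Dyck-path (of some semilength n,
-- i.e. s = 2n+1 points).
DWIsEvenlyWeightedDyck : ∀ {m} → Word m → Set
DWIsEvenlyWeightedDyck w =
  ∃[ B ] (IIForm B w × IsChain B × FirstIsLeast B ×
          ∃[ n ] (length B ≡ suc (2 * n) ×
                  IsEvenlyWeighted n (D-of B) (Λ-of B)))

Rel : ℕ → Set₁
Rel n = Fin n → Fin n → Set

IsSimpleGraph : ∀ {n} → Rel n → Set
IsSimpleGraph Adj = (∀ u v → Adj u v → Adj v u) × (∀ u → ¬ Adj u u)

IsClique : ∀ {n} → Rel n → Subset n → Set
IsClique Adj K = ∀ u v → u ∈ K → v ∈ K → u ≢ v → Adj u v

IsMaxClique : ∀ {n} → Rel n → Subset n → Set
IsMaxClique {n} Adj K =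
  IsClique Adj K × (∀ (K' : Subset n) → IsClique Adj K' → K ⊆ K' → K' ⊆ K)

DiamondFree : ∀ {n} → Rel n → Set
DiamondFree Adj = ∀ u v x y → x ≢ y →
  Adj u v → Adj u x → Adj u y → Adj v x → Adj v y → Adj x y

next : ∀ {n} → Fin n → Fin n
next {suc k} i = fromℕ< (m%n<n (suc (toℕ i)) (suc k))

nextⁿ : ∀ {n} → ℕ → Fin n → Fin n
nextⁿ zero i = i
nextⁿ (suc k) i = next (nextⁿ k i)

-- r lists the vertices along the rim: r(0), r(1), …, r(n-1), r(0)
RimEdge : ∀ {n} → (Fin n → Fin n) → Subset n → Set
RimEdge r K = ∃[ i ] (K ≡ ⁅ r i ⁆ ∪ ⁅ r (next i) ⁆)

IsInscribed : ∀ {n} → Rel n → Subset n → Set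
IsInscribed Adj K = IsMaxClique Adj K × ¬ (∣ K ∣ ≡ 2)

IsMultisun : (n : ℕ) → Rel n → (Fin n → Fin n) → Set
IsMultisun n Adj r =
  IsSimpleGraph Adj × DiamondFree Adj × Odd n ×
  3 ≤ n × Injective _≡_ _≡_ r ×
  (∀ K → (IsMaxClique Adj K × ∣ K ∣ ≡ 2) → RimEdge r K) ×
  (∀ K → RimEdge r K → (IsMaxClique Adj K × ∣ K ∣ ≡ 2)) ×
  (∀ K → IsInscribed Adj K → ∀ i → ¬ (r i ∈ K × r (next i) ∈ K))

deleteCliques : ∀ {n} → Rel n → (Subset n → Set) → Rel n
deleteCliques Adj S u v =
  Adj u v × ¬ (∃[ K ] (S K × IsInscribed Adj K × u ∈ K × v ∈ K))

NotAll : ∀ {n} → Rel n → (Subset n → Set) → Set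
NotAll Adj S = ∃[ K ] (IsInscribed Adj K × ¬ S K)

RimPath : ∀ {n} → Rel n → (Fin n → Fin n) →
          (Fin n → Set) → (Fin n → Set) → ℕ → Set
RimPath {n} Adj r P Q k =
  1 ≤ k × k < n × ∃[ i ] (P (r i) × Q (r (nextⁿ k i)) ×
    (∀ j → 1 ≤ j → j < k → ∀ K → IsInscribed Adj K → r (nextⁿ j i) ∉ K))

-- the N-conditions (a path with k+1 vertices)
N1 : ∀ {n} → Rel n → (Fin n → Fin n) → Set
N1 Adj r = ∀ A → IsInscribed Adj A → ∀ k →
  RimPath Adj r (_∈ A) (_∈ A) k → Even (suc k) × 4 ≤ suc k

N2 : ∀ {n} → Rel n → Set
N2 Adj = ∀ A → IsInscribed Adj A → Odd ∣ A ∣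

-- (N3) and (N4), which refer to the common vertex ξ
N3N4 : ∀ {n} → Rel n → (Fin n → Fin n) → Set
N3N4 Adj r = ∃[ ξ ]
  ((∀ A → IsInscribed Adj A → ξ ∈ A) ×
   (∀ A B → IsInscribed Adj A → IsInscribed Adj B → A ≢ B →
      ∀ v → v ∈ A → v ∈ B → v ≡ ξ) ×
   (∀ A → IsInscribed Adj A → ∀ k →
      (RimPath Adj r (_∈ A) (_≡ ξ) k ⊎ RimPath Adj r (_≡ ξ) (_∈ A) k) →
      Even (suc k)))

N5 : ∀ {n} → Rel n → (Fin n → Fin n) → Set
N5 Adj r = ∀ A B → IsInscribed Adj A → IsInscribed Adj B → A ≢ B → ∀ k →
  RimPath Adj r (λ u → u ∈ A × u ∉ B) (λ v → v ∈ B × v ∉ A) k → Odd (suc k)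

NConditions : ∀ {n} → Rel n → (Fin n → Fin n) → Set
NConditions Adj r = N1 Adj r × N2 Adj × N3N4 Adj r × N5 Adj r

-- sunoid: it and all its sub-multisuns satisfy the N-conditions
-- (a sub-multisun has the same rim r)
IsSunoid : (n : ℕ) → Rel n → (Fin n → Fin n) → Set₁
IsSunoid n Adj r =
  IsMultisun n Adj r × NConditions Adj r ×
  (∀ (S : Subset n → Set) → NotAll Adj S → NConditions (deleteCliques Adj S) r)

-- labelling: K x is the inscribed clique carrying the letter x
label : ∀ {m n} → (Fin m → Subset n) → Fin n → Letter m
label {m} K v with filter (λ x → v ∈? K x) (allFin m)
... | [] = ε
... | x ∷ [] = lt x
... | _ ∷ _ ∷ _ = σ

wG : ∀ {m n} → (Fin m → Subset n) → (Fin n → Fin n) → Word m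
wG {n = n} K r = map (label K ∘ r) (allFin n)

IsCliqueLabelling : ∀ {m n} → Rel n → (Fin m → Subset n) → Set
IsCliqueLabelling {m} Adj K =
  (∀ x → IsInscribed Adj (K x)) × Injective _≡_ _≡_ K ×
  (∀ A → IsInscribed Adj A → ∃[ x ] (K x ≡ A))

IsSunword : ∀ {m} → Word m → Set₁
IsSunword {m} w =
  ∃[ n ] Σ (Rel n) λ Adj → ∃[ r ] Σ (Fin m → Subset n) λ K →
    (IsSunoid n Adj r × IsCliqueLabelling Adj K × wG K r ≈ w)

{-# OPTIONS --safe #-}

-- Erase the ε's from σ u σ, keeping for every other letter the parity of its
-- position (inverted for σ).  For all sub-multisuns together, the N-conditions say
-- that two occurrences of the same letter, with none in between, have opposite bits,
-- while for two different letters x, y, the bits of an x and a y with neither of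
-- them in between agree.  Hence the letters whose last bit was 0 and those whose
-- last bit was 1 form two stacks, and each letter read is moved from the top of one
-- to the top of the other: a cursor travels along a fixed chain of letters, crossing
-- a letter upwards at bit 0 and downwards at bit 1.  So the bits are those of a
-- Dyck path whose up and down steps at level h carry the h-th letter, and the order
-- of the chain is the induced one since a lower letter is met before and after every
-- higher one.  In a block the bits alternate, so the path turns between the
-- neighbours of a block precisely when its exponent is even.
module Submission where

open import Defs
open import Data.Bool as Bool using (Bool; true; false; not; if_then_else_)
open import Data.Bool.Properties using (not-¬; ¬-not; not-involutive; not-injective)
open import Data.Empty using (⊥; ⊥-elim)
open import Data.Fin using (Fin; zero; suc; toℕ; punchOut)
import Data.Fin.Properties as Fin
open import Data.Fin.Subset using (Subset; _∪_; ⁅_⁆; ∣_∣) renaming (_∈_ to _∈ₛ_; _∉_ to _∉ₛ_; _⊆_ to _⊆ₛ_; ⊥ to ∅)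
open import Data.Fin.Subset.Properties using (∉⊥; ∣⊥∣≡0; x∈⁅x⁆; x∈⁅y⁆⇒x≡y; x∈p∪q⁺; x∈p∪q⁻; ∪-comm; ∪-identityˡ; ∪-identityʳ; ∣⁅x⁆∣≡1; ⊆-antisym; _⊆?_; p⊂q⇒∣p∣<∣q∣; ∣p∣≤n; p⊆q⇒∣p∣≤∣q∣) renaming (_∈?_ to _∈ₛ?_)
open import Data.Integer as ℤ using (+_)
import Data.Integer.Properties as ℤ
open import Data.List using (List; []; _∷_; _++_; _∷ʳ_; _ʳ++_; length; map; reverse; take; drop; filter; allFin; tabulate; lookup)
open import Data.List.Properties
open import Data.List.Membership.Propositional using (_∈_; _∉_)
open import Data.List.Membership.Propositional.Properties
import Data.List.Membership.DecPropositional as DecMembership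
open import Data.List.Relation.Unary.All as All using (All; []; _∷_)
import Data.List.Relation.Unary.All.Properties as Allₚ
open import Data.List.Relation.Unary.AllPairs using ([]; _∷_)
open import Data.List.Relation.Unary.Any as Any using (here; there)
import Data.List.Relation.Unary.Any.Properties as Anyₚ
open import Data.List.Relation.Unary.Linked using (Linked; []; [-]; _∷_)
open import Data.List.Relation.Unary.Unique.Propositional using (Unique)
import Data.List.Relation.Unary.Unique.Propositional.Properties as Uniqueₚ
open import Data.Maybe using (Maybe; just; nothing)
import Data.Maybe.Properties as Maybe
open import Data.Nat using (ℕ; zero; suc; _+_; _*_; _∸_; _≤_; _<_; _<?_; z≤n; s≤s; >-nonZero)
open import Data.Nat.DivMod using (_%_; m%n<n; m<n⇒m%n≡m; n%n≡0)
open import Data.Nat.Divisibility using (_∣_; _∣?_; ∣m+n∣m⇒∣n; ∣m∣n⇒∣m+n; ∣-refl; _∣0; ∣1⇒≡1)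
import Data.Nat.Properties as ℕ
open import Data.Product using (_×_; _,_; proj₁; proj₂; ∃₂; ∃-syntax; map₂)
open import Data.Sum as Sum using (_⊎_; inj₁; inj₂)
import Data.Vec as Vec
import Data.Vec.Properties as Vecₚ
open import Function using (_∘_; case_of_; id; Injective)
open import Function.Bundles using (_⇔_; mk⇔)
open import Relation.Binary.Definitions using (DecidableEquality; tri<; tri≈; tri>)
open import Relation.Binary.PropositionalEquality
open import Relation.Nullary
open import Relation.Nullary.Decidable using (dec-true; decidable-stable; _×-dec_; ¬?)
open import Relation.Unary using (Decidable)

-- Alternating codes and cursor paths

-- Sub-multisuns matter because the N-conditions of the graph itself see only rim paths without
-- interior clique vertices. Deleting every inscribed clique except those of x and y turns each
-- stretch between such letters that is free of x, y and σ into a path of this kind. The common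
-- vertex lies in every clique and so acts as a copy of each letter; the condition on the full round
-- from σ to σ comes from the odd order. Pairs of ε change no parity, and reversing a closed round
-- only reverses its code and inverts the bits. Hence alternation can be carried from a rim word to
-- any block form of the same cyclic word. For the converse the rim is `vWord B` rather than the
-- block word: its inserted pairs of ε keep clique vertices nonconsecutive. Both uses of that word,
-- for distances and as a rim, rest on its having the same code as the block word.

reverse-factor : ∀ {B : Set} (s : List B) {x} g {y} t →
  reverse (s ++ x ∷ g ++ y ∷ t) ≡ reverse t ++ y ∷ reverse g ++ x ∷ reverse s
reverse-factor s {x} g {y} t = begin
  reverse (s ++ x ∷ g ++ y ∷ t)              ≡⟨ split s ⟩
  reverse (g ++ y ∷ t) ++ x ∷ reverse s      ≡⟨ cong (_++ x ∷ reverse s) (split g) ⟩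
  (reverse t ++ y ∷ reverse g) ++ x ∷ reverse s  ≡⟨ ++-assoc (reverse t) _ _ ⟩
  reverse t ++ y ∷ reverse g ++ x ∷ reverse s ∎
  where
  open ≡-Reasoning
  split : ∀ s {x t} → reverse (s ++ x ∷ t) ≡ reverse t ++ x ∷ reverse s
  split s {x} {t} = begin
    reverse (s ++ x ∷ t)                  ≡⟨ reverse-++ s (x ∷ t) ⟩
    reverse (x ∷ t) ++ reverse s          ≡⟨ cong (_++ reverse s) (unfold-reverse x t) ⟩
    (reverse t ++ x ∷ []) ++ reverse s    ≡⟨ ++-assoc (reverse t) _ _ ⟩
    reverse t ++ x ∷ reverse s            ∎

module _ {A : Set} where

  Code : Set
  Code = List (A × Bool)

  letters : Code → List A
  letters = map proj₁

  -- The stretch `g` may contain third letters, namely those of cliques deleted in some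
  -- sub-multisun, so this is not a condition on neighbouring entries only. For letters other than
  -- σ, opposite bits mean an even number of rim vertices strictly between the two, equal bits an
  -- odd number.
  Alternating : Code → Set
  Alternating Z = ∀ s p b g q b′ t → Z ≡ s ++ (p , b) ∷ g ++ (q , b′) ∷ t →
    p ∉ letters g → q ∉ letters g → (p ≡ q → b ≢ b′) × (p ≢ q → b ≡ b′)

  -- A cursor moves on ℕ; reading x takes it across the unit interval
  -- [η x , suc (η x)], upwards if the bit is false and downwards if it is true.
  start : (A → ℕ) → Bool → A → ℕ
  start η false x = η x
  start η true  x = suc (η x)

  Crossing : (A → ℕ) → ℕ → Code → ℕ → Set
  Crossing η c [] c′ = c ≡ c′
  Crossing η c ((x , b) ∷ Z) c′ = c ≡ start η b x × Crossing η (start η (not b) x) Z c′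

  crossing-++⁻ : ∀ {η} c Y {Z c′} → Crossing η c (Y ++ Z) c′ →
    ∃[ d ] Crossing η c Y d × Crossing η d Z c′
  crossing-++⁻ c [] r = c , refl , r
  crossing-++⁻ c ((x , b) ∷ Y) (e , r) = let d , p , q = crossing-++⁻ _ Y r in d , (e , p) , q

  ∉-here : ∀ {x y : A} {xs} → x ∉ y ∷ xs → x ≢ y
  ∉-here n e = n (here e)

  module _ {η : A → ℕ} (inj : ∀ {x y} → η x ≡ η y → x ≡ y) where

    -- Distinct letters have disjoint unit intervals, so only reading `y` carries the cursor across
    -- the interval of `y`. On integers, being below it is `c ≤ η y` and being above it is
    -- `η y < c`.
    sameSide : ∀ {y c c′} Z → y ∉ letters Z → Crossing η c Z c′ →
      (c ≤ η y → c′ ≤ η y) × (η y < c → η y < c′)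
    sameSide [] n refl = (λ p → p) , (λ p → p)
    sameSide ((x , false) ∷ Z) n (refl , r) =
      let lo , hi = sameSide Z (n ∘ there) r in
      (λ p → lo (ℕ.≤∧≢⇒< p (∉-here n ∘ sym ∘ inj))) , (λ p → hi (ℕ.m<n⇒m<1+n p))
    sameSide ((x , true) ∷ Z) n (refl , r) =
      let lo , hi = sameSide Z (n ∘ there) r in
      (λ p → lo (ℕ.<⇒≤ p)) , (λ p → hi (ℕ.≤∧≢⇒< (ℕ.≤-pred p) (∉-here n ∘ inj)))

    -- Two successive crossings of one letter start on opposite sides of it. For p and q distinct,
    -- suppose one is crossed upwards and the other downwards. The cursor leaves p on one side of q
    -- and on one side of p, keeps both sides throughout `g`, and then cannot stand where the
    -- crossing of q begins.
    crossing⇒alternating : ∀ {c c′} Z → Crossing η c Z c′ → Alternating Z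
    crossing⇒alternating {c} _ r s p b g q b′ t refl p∉g q∉g =
      let _ , _ , _ , r₁ = crossing-++⁻ c s r
          d , r₂ , e , _ = crossing-++⁻ _ g r₁
      in same b b′ e r₂ , different b b′ e r₂
      where
      side : ∀ {y c c′} → y ∉ letters g → Crossing η c g c′ → _
      side {y} = sameSide {y} g
      same : ∀ b b′ {d} → d ≡ start η b′ q → Crossing η (start η (not b) p) g d → p ≡ q → b ≢ b′
      same false false refl r refl refl = ℕ.<-irrefl refl (proj₂ (side p∉g r) ℕ.≤-refl)
      same true true refl r refl refl = ℕ.<-irrefl refl (proj₁ (side p∉g r) ℕ.≤-refl)
      same true false _ _ _ ()
      same false true _ _ _ ()
      different : ∀ b b′ {d} → d ≡ start η b′ q → Crossing η (start η (not b) p) g d → p ≢ q → b ≡ b′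
      different false false _ _ _ = refl
      different true true _ _ _ = refl
      different false true refl r p≢q with ℕ.<-cmp (η p) (η q)
      ... | tri< p<q _ _ = ⊥-elim (ℕ.<-irrefl refl (proj₁ (side q∉g r) p<q))
      ... | tri≈ _ e _ = ⊥-elim (p≢q (inj e))
      ... | tri> _ _ q<p = ⊥-elim (ℕ.<-asym q<p (ℕ.≤∧≢⇒< (ℕ.≤-pred (proj₂ (side p∉g r) ℕ.≤-refl)) (p≢q ∘ inj)))
      different true false refl r p≢q with ℕ.<-cmp (η p) (η q)
      ... | tri< p<q _ _ = ⊥-elim (ℕ.<⇒≱ p<q (proj₁ (side p∉g r) ℕ.≤-refl))
      ... | tri≈ _ e _ = ⊥-elim (p≢q (inj e))
      ... | tri> _ _ q<p = ⊥-elim (ℕ.<-irrefl refl (proj₂ (side q∉g r) q<p))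

  flip : Code → Code
  flip = map (map₂ not)

  letters-flip : ∀ Z → letters (flip Z) ≡ letters Z
  letters-flip Z = sym (map-∘ Z)

  flip-involutive : ∀ Z → flip (flip Z) ≡ Z
  flip-involutive [] = refl
  flip-involutive ((x , b) ∷ Z) = cong₂ (λ c Y → (x , c) ∷ Y) (not-involutive b) (flip-involutive Z)

  -- Read backwards, an upward crossing becomes a downward one, hence the flip; the relation between
  -- the bits of two ends is symmetric in them.
  alternating-reverse : ∀ Z → Alternating Z → Alternating (reverse (flip Z))
  alternating-reverse Z R s p b g q b′ t e p∉ q∉ =
    let same , different = R (flip (reverse t)) q (not b′) (flip (reverse g)) p (not b) (flip (reverse s))
                             eq (q∉ ∘ back) (p∉ ∘ back)
    in (λ p≡q b≡b′ → same (sym p≡q) (cong not (sym b≡b′))) ,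
       (λ p≢q → sym (not-injective (different (p≢q ∘ sym))))
    where
    back : ∀ {z} → z ∈ letters (flip (reverse g)) → z ∈ letters g
    back i = Anyₚ.reverse⁻ (subst (_ ∈_) (trans (letters-flip (reverse g)) (reverse-map proj₁ g)) i)
    open ≡-Reasoning
    eq : Z ≡ flip (reverse t) ++ (q , not b′) ∷ flip (reverse g) ++ (p , not b) ∷ flip (reverse s)
    eq = begin
      Z                                                                 ≡⟨ flip-involutive Z ⟨
      flip (flip Z)
          ≡⟨ cong flip (reverse-involutive (flip Z)) ⟨
      flip (reverse (reverse (flip Z)))                                 ≡⟨ cong (flip ∘ reverse) e ⟩
      flip (reverse (s ++ (p , b) ∷ g ++ (q , b′) ∷ t))                 ≡⟨ cong flip (reverse-factor s g t) ⟩
      flip (reverse t ++ (q , b′) ∷ reverse g ++ (p , b) ∷ reverse s)   ≡⟨ map-++ _ (reverse t) _ ⟩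
      flip (reverse t) ++ (q , not b′) ∷ flip (reverse g ++ (p , b) ∷ reverse s)
        ≡⟨ cong (λ Y → flip (reverse t) ++ (q , not b′) ∷ Y) (map-++ _ (reverse g) _) ⟩
      flip (reverse t) ++ (q , not b′) ∷ flip (reverse g) ++ (p , not b) ∷ flip (reverse s) ∎

-- The two stacks and the chain of letters

module _ {A : Set} (_≟_ : DecidableEquality A) where
  open DecMembership _≟_ using (_∈?_)

  index : List A → A → ℕ
  index [] x = zero
  index (c ∷ C) x with c ≟ x
  ... | yes _ = zero
  ... | no _ = suc (index C x)

  -- All absent letters share the index `length C`, which no member attains; so membership of one of
  -- the two letters suffices.
  index-injective : ∀ {C x y} → x ∈ C → index C x ≡ index C y → x ≡ y
  index-injective {c ∷ C} {x} {y} x∈ e with c ≟ x | c ≟ y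
  ... | yes refl | yes refl = refl
  index-injective {c ∷ C} (here refl) e | no c≢x | no _ = ⊥-elim (c≢x refl)
  index-injective {c ∷ C} (there x∈) e | no _ | no _ = index-injective x∈ (ℕ.suc-injective e)

  index-++ : ∀ {y} C {D} → y ∉ C → index (C ++ y ∷ D) y ≡ length C
  index-++ {y} [] n with y ≟ y
  ... | yes _ = refl
  ... | no y≢y = ⊥-elim (y≢y refl)
  index-++ {y} (c ∷ C) n with c ≟ y
  ... | yes refl = ⊥-elim (n (here refl))
  ... | no _ = cong suc (index-++ C (n ∘ there))

  index-ʳ++ : ∀ {y} L {D} → y ∉ L → index (L ʳ++ (y ∷ D)) y ≡ length L
  index-ʳ++ {y} L {D} n = begin
    index (L ʳ++ (y ∷ D)) y        ≡⟨ cong (λ C → index C y) (ʳ++-defn L) ⟩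
    index (reverse L ++ y ∷ D) y   ≡⟨ index-++ (reverse L) (n ∘ Anyₚ.reverse⁻) ⟩
    length (reverse L)             ≡⟨ length-reverse L ⟩
    length L                       ∎
    where open ≡-Reasoning

  -- Stack b H L: the letters of L have last bit b in the history H (most recent
  -- entry first), and are listed by recency of that last occurrence.
  data Stack (b : Bool) : Code → List A → Set where
    []  : ∀ {H} → Stack b H []
    top : ∀ {H x xs} g t → H ≡ g ++ (x , b) ∷ t → x ∉ letters g →
          All (λ z → z ∉ letters g × z ≢ x) xs → Stack b t xs → Stack b H (x ∷ xs)

  ∉-++ : ∀ {z : A} (g : Code) {x b h} → z ∉ letters g → z ≢ x → z ∉ letters h → z ∉ letters (g ++ (x , b) ∷ h)
  ∉-++ [] n₁ n₂ n₃ (here e) = n₂ e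
  ∉-++ [] n₁ n₂ n₃ (there i) = n₃ i
  ∉-++ (_ ∷ g) n₁ n₂ n₃ (here e) = n₁ (here e)
  ∉-++ (_ ∷ g) n₁ n₂ n₃ (there i) = ∉-++ g (n₁ ∘ there) n₂ n₃ i

  weaken : ∀ {b H L} y b′ → y ∉ L → Stack b H L → Stack b ((y , b′) ∷ H) L
  weaken y b′ n [] = []
  weaken y b′ n (top g t e x∉g rest st) =
    top ((y , b′) ∷ g) t (cong (_ ∷_) e)
      (λ { (here refl) → n (here refl) ; (there i) → x∉g i })
      (All.tabulate λ i → (λ { (here refl) → n (there i)
                             ; (there j) → proj₁ (All.lookup rest i) j }) ,
                          proj₂ (All.lookup rest i))
      st

  weaken-++ : ∀ {b H L} g → (∀ {z} → z ∈ L → z ∉ letters g) → Stack b H L → Stack b (g ++ H) L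
  weaken-++ [] n st = st
  weaken-++ ((y , b′) ∷ g) n st = weaken y b′ (λ i → n i (here refl)) (weaken-++ g (λ i → n i ∘ there) st)

  pop : ∀ {b H y L} → Stack b H (y ∷ L) → y ∉ L × Stack b H L
  pop {b} {L = L} (top {x = y} g t refl y∉g rest st) =
    (λ i → proj₂ (All.lookup rest i) refl) ,
    subst (λ H → Stack b H L) (++-assoc g _ t)
      (weaken-++ (g ++ (y , b) ∷ []) (λ i → let p , q = All.lookup rest i in ∉-++ g p q (λ ())) st)

  push : ∀ {b H L} y → y ∉ L → Stack b H L → Stack b ((y , b) ∷ H) (y ∷ L)
  push y n st = top [] _ refl (λ ()) (All.tabulate λ i → (λ ()) , (λ { refl → n i })) st

  LastBit : Bool → Code → A → Set
  LastBit b H x = ∃₂ λ g t → H ≡ g ++ (x , b) ∷ t × x ∉ letters g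

  lastBit : ∀ {b H L x} → Stack b H L → x ∈ L → LastBit b H x
  lastBit (top g t e x∉g rest st) (here refl) = g , t , e , x∉g
  lastBit {b} (top {x = y} g t refl x∉g rest st) (there i) with lastBit st i | All.lookup rest i
  ... | g′ , t′ , refl , x∉g′ | x∉ , x≢ =
    g ++ (y , b) ∷ g′ , t′ , sym (++-assoc g _ _) , ∉-++ g x∉ x≢ x∉g′

  module Arrival {H : Code} {y : A} {b : Bool} {Z : Code} (R : Alternating (H ʳ++ ((y , b) ∷ Z))) where

    -- Alternation applied to the last occurrence of `x` in the past and to the letter `y` about to
    -- be read. `H` stores the past with the latest entry first, hence `ʳ++`.
    arrive : ∀ {x s} g t → H ≡ g ++ (x , s) ∷ t → x ∉ letters g → y ∉ letters g →
      (x ≡ y → s ≢ b) × (x ≢ y → s ≡ b)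
    arrive {x} {s} g t refl x∉ y∉ =
      R (reverse t) x s (reverse g) y b Z eq (x∉ ∘ back) (y∉ ∘ back)
      where
      back : ∀ {z} → z ∈ letters (reverse g) → z ∈ letters g
      back i = Anyₚ.reverse⁻ (subst (_ ∈_) (reverse-map proj₁ g) i)
      eq : (g ++ (x , s) ∷ t) ʳ++ ((y , b) ∷ Z) ≡ reverse t ++ (x , s) ∷ reverse g ++ (y , b) ∷ Z
      eq = trans (++-ʳ++ g) (trans (ʳ++-defn t) (cong (λ w → reverse t ++ (x , s) ∷ w) (ʳ++-defn g)))

    absentSame : ∀ {L} → Stack b H L → y ∉ L
    absentSame st i = let g , t , e , n = lastBit st i in proj₁ (arrive g t e n n) refl refl

    -- A different top letter would have occurred last with bit `not b`, after the last occurrence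
    -- of `y`. The stretch from there to the new `y` contains neither of the two, so alternation
    -- would force that bit to be `b`.
    topOther : ∀ {U} → Stack (not b) H U → y ∈ U → ∃[ U′ ] U ≡ y ∷ U′
    topOther (top {x = x} {xs} g t e x∉g rest st) i with x ≟ y
    topOther (top {x = x} {xs} g t e x∉g rest st) i | yes refl = xs , refl
    topOther (top {x = x} {xs} g t e x∉g rest st) (here refl) | no x≢y = ⊥-elim (x≢y refl)
    topOther (top {x = x} {xs} g t e x∉g rest st) (there i) | no x≢y =
      ⊥-elim (not-¬ refl (sym (proj₂ (arrive g t e x∉g (proj₁ (All.lookup rest i))) x≢y)))

    -- A letter without a past occurrence is compared with any top letter of the opposite stack,
    -- whose last bit contradicts alternation. New letters therefore enter only when nothing lies on
    -- the far side of the cursor.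
    newOther : ∀ {U} → Stack (not b) H U → y ∉ letters H → U ≡ []
    newOther [] n = refl
    newOther (top {x = x} g t refl x∉g rest st) n =
      ⊥-elim (not-¬ refl (sym (proj₂ (arrive g t refl x∉g
        (λ i → n (subst (y ∈_) (sym (map-++ proj₁ g _)) (∈-++⁺ˡ i))))
        (λ { refl → n (subst (y ∈_) (sym (map-++ proj₁ g _)) (∈-++⁺ʳ (letters g) (here refl))) }))))

  -- The letters with last bit false lie below the cursor and those with last bit
  -- true above it, nearest first: alternation forces the next letter to be the
  -- nearest one on the far side, so L ʳ++ U is a fixed chain, extended only at its top.
  module _ (o : A) where

    alternating⇒crossing′ : ∀ H L₀ U rest → let L = L₀ ++ o ∷ [] ; Y = rest ++ (o , true) ∷ [] in
      o ∉ letters rest → Alternating (H ʳ++ Y) → Stack false H L → Stack true H U →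
      (∀ {x} → x ∈ letters H → x ∈ L ⊎ x ∈ U) →
      ∃[ X ] (Crossing (index (L ʳ++ (U ++ X))) (length L) Y 0 ×
              All (_∈ L ʳ++ (U ++ X)) (letters rest))
    -- The closing `o` must be the top of the lower stack, but it is also its bottom. Thus the stack
    -- is `o` alone, the cursor stands at 1, and this last crossing takes it to 0.
    alternating⇒crossing′ H L₀ U [] o∉ R below above complete
      with Arrival.topOther R below (∈-++⁺ʳ L₀ (here refl))
    alternating⇒crossing′ H [] U [] o∉ R below above complete | _ , refl =
      [] , (cong suc (sym (index-ʳ++ [] (λ ()))) , index-ʳ++ [] (λ ())) , []
    alternating⇒crossing′ H (_ ∷ L₀) U [] o∉ R below above complete | _ , refl =
      ⊥-elim (proj₁ (pop below) (∈-++⁺ʳ L₀ (here refl)))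
    alternating⇒crossing′ H L₀ U ((y , false) ∷ rest) o∉ R below above complete
      with y ∈? U
    ... | yes y∈U with Arrival.topOther R above y∈U
    ... | U′ , refl =
      let y∉L = Arrival.absentSame R below
          y∉U′ , above′ = pop above
          X , r , a = alternating⇒crossing′ ((y , false) ∷ H) (y ∷ L₀) U′ rest (o∉ ∘ there) R
                        (push y y∉L below) (weaken y false y∉U′ above′)
                        (λ { (here refl) → inj₁ (here refl)
                           ; (there i) → Sum.[ inj₁ ∘ there ,
                               (λ { (here e) → inj₁ (here e) ; (there j) → inj₂ j }) ] (complete i) })
          e = index-ʳ++ (L₀ ++ o ∷ []) y∉L
      in X , (sym e , subst (λ c → Crossing (index ((L₀ ++ o ∷ []) ʳ++ (y ∷ U′ ++ X))) c
             (rest ++ (o , true) ∷ []) 0) (cong suc (sym e)) r) ,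
         Anyₚ.reverseAcc⁺ _ (L₀ ++ o ∷ []) (inj₁ (here refl)) ∷ a
    alternating⇒crossing′ H L₀ U ((y , false) ∷ rest) o∉ R below above complete | no y∉U
      with Arrival.newOther R above (λ i → Sum.[ Arrival.absentSame R below , y∉U ] (complete i))
    -- A first occurrence with empty upper stack: `y` is placed just above the cursor, at the head
    -- of `X`, the part of the chain that is still to be met.
    ... | refl =
      let y∉L = Arrival.absentSame R below
          X , r , a = alternating⇒crossing′ ((y , false) ∷ H) (y ∷ L₀) [] rest (o∉ ∘ there) R
                        (push y y∉L below) []
                        (λ { (here refl) → inj₁ (here refl)
                           ; (there i) → Sum.[ inj₁ ∘ there , (λ ()) ] (complete i) })
          e = index-ʳ++ (L₀ ++ o ∷ []) y∉L
      in y ∷ X , (sym e , subst (λ c → Crossing (index ((L₀ ++ o ∷ []) ʳ++ (y ∷ X))) c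
             (rest ++ (o , true) ∷ []) 0) (cong suc (sym e)) r) ,
         Anyₚ.reverseAcc⁺ _ (L₀ ++ o ∷ []) (inj₁ (here refl)) ∷ a
    alternating⇒crossing′ H L₀ U ((y , true) ∷ rest) o∉ R below above complete
      with y ∈? (L₀ ++ o ∷ [])
    -- A new letter cannot be crossed downwards, since the lower stack always contains `o`.
    ... | no y∉L =
      case Arrival.newOther R below (λ i → Sum.[ y∉L , Arrival.absentSame R above ] (complete i)) of λ e →
      case subst (o ∈_) e (∈-++⁺ʳ L₀ (here refl)) of λ ()
    ... | yes y∈L with Arrival.topOther R below y∈L
    alternating⇒crossing′ H [] U ((y , true) ∷ rest) o∉ R below above complete | yes y∈L | _ , refl =
      ⊥-elim (o∉ (here refl))
    alternating⇒crossing′ H (y ∷ L₀) U ((y , true) ∷ rest) o∉ R below above complete | yes y∈L | _ , refl =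
      let y∉U = Arrival.absentSame R above
          y∉L , below′ = pop below
          X , r , a = alternating⇒crossing′ ((y , true) ∷ H) L₀ (y ∷ U) rest (o∉ ∘ there) R
                        (weaken y true y∉L below′) (push y y∉U above)
                        (λ { (here refl) → inj₂ (here refl)
                           ; (there i) → Sum.[ (λ { (here e) → inj₂ (here e) ; (there j) → inj₁ j }) , inj₂
                               ∘ there ] (complete i) })
          e = index-ʳ++ (L₀ ++ o ∷ []) y∉L
      in X , (cong suc (sym e) , subst (λ c → Crossing (index ((L₀ ++ o ∷ []) ʳ++ (y ∷ U ++ X))) c
             (rest ++ (o , true) ∷ []) 0) (sym e) r) ,
         Anyₚ.reverseAcc⁺ _ (L₀ ++ o ∷ []) (inj₁ (here refl)) ∷ a

    alternating⇒crossing : ∀ rest → o ∉ letters rest → let Z = (o , false) ∷ rest ++ (o , true) ∷ [] in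
      Alternating Z → ∃[ C ] (Crossing (index C) 0 Z 0 × All (_∈ C) (letters Z))
    alternating⇒crossing rest o∉ R =
      let X , r , a = alternating⇒crossing′ ((o , false) ∷ []) [] [] rest o∉ R
                        (push o (λ ()) []) [] (λ { (here refl) → inj₁ (here refl) })
          e = index-++ {y = o} [] {X} (λ ())
      in o ∷ X , (sym e , subst (λ c → Crossing (index (o ∷ X)) c (rest ++ (o , true) ∷ []) 0)
             (cong suc (sym e)) r) ,
         here refl ∷ subst (All (_∈ o ∷ X)) (sym (map-++ proj₁ rest _))
                       (Allₚ.++⁺ a (here refl ∷ []))

-- Codes of words

even-+2 : ∀ {n} → Even n → Even (2 + n)
even-+2 = ∣m∣n⇒∣m+n ∣-refl

even-∸2 : ∀ {n} → Even (2 + n) → Even n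
even-∸2 e = ∣m+n∣m⇒∣n e ∣-refl

odd-1 : Odd 1
odd-1 e = case ∣1⇒≡1 e of λ ()

even⇒odd : ∀ n → Even n → Odd (suc n)
odd⇒even : ∀ n → Odd n → Even (suc n)
even⇒odd zero e = odd-1
even⇒odd (suc n) e o = even⇒odd n (even-∸2 o) e
odd⇒even zero o = ⊥-elim (o (2 ∣0))
odd⇒even (suc n) o with 2 ∣? n
... | yes e = even-+2 e
... | no o′ = ⊥-elim (o (odd⇒even n o′))

suc-even : ∀ n → Even (suc n) → Odd n
suc-even n e o = even⇒odd n o e

suc-odd : ∀ n → Odd (suc n) → Even n
suc-odd n o with 2 ∣? n
... | yes e = e
... | no o′ = ⊥-elim (o (odd⇒even n o′))

alternate : ℕ → Bool → Bool
alternate zero b = b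
alternate (suc n) b = alternate n (not b)

alternate-not : ∀ n b → alternate n (not b) ≡ not (alternate n b)
alternate-not zero b = refl
alternate-not (suc n) b = alternate-not n (not b)

alternate-even : ∀ n b → Even n → alternate n b ≡ b
alternate-odd : ∀ n b → Odd n → alternate n b ≡ not b
alternate-even zero b e = refl
alternate-even (suc n) b e = trans (alternate-odd n (not b) (suc-even n e)) (not-involutive b)
alternate-odd zero b o = ⊥-elim (o (2 ∣0))
alternate-odd (suc n) b o = alternate-even n (not b) (suc-odd n o)

alternate⇒even : ∀ n b → alternate n b ≡ b → Even n
alternate⇒even n b e with 2 ∣? n
... | yes p = p
... | no o = ⊥-elim (not-¬ refl (trans (sym e) (alternate-odd n b o)))

alternate⇒odd : ∀ n b → alternate n b ≡ not b → Odd n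
alternate⇒odd n b e p = not-¬ refl (trans (sym (alternate-even n b p)) e)

module _ {m : ℕ} where

  -- A mark is a letter other than ε; nothing stands for σ.
  Mark : Set
  Mark = Maybe (Fin m)

  _≟M_ : (p q : Mark) → Dec (p ≡ q)
  _≟M_ = Maybe.≡-dec Fin._≟_

  ⌜_⌝ : Mark → Letter m
  ⌜ nothing ⌝ = σ
  ⌜ just x ⌝ = lt x

  ⌜⌝-injective : ∀ {p q} → ⌜ p ⌝ ≡ ⌜ q ⌝ → p ≡ q
  ⌜⌝-injective {nothing} {nothing} e = refl
  ⌜⌝-injective {just x} {just .x} refl = refl

  -- σ borders its neighbouring blocks directly whereas other blocks are separated
  -- by an ε, so its bit is inverted to make all letters obey one parity rule.
  bit : Bool → Mark → Bool
  bit b nothing = not b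
  bit b (just _) = b

  code : Bool → Word m → Code {Mark}
  code b [] = []
  code b (ε ∷ w) = code (not b) w
  code b (σ ∷ w) = (nothing , bit b nothing) ∷ code (not b) w
  code b (lt x ∷ w) = (just x , b) ∷ code (not b) w

  code-mark : ∀ b p w → code b (⌜ p ⌝ ∷ w) ≡ (p , bit b p) ∷ code (not b) w
  code-mark b nothing w = refl
  code-mark b (just x) w = refl

  code-++ : ∀ b u v → code b (u ++ v) ≡ code b u ++ code (alternate (length u) b) v
  code-++ b [] v = refl
  code-++ b (ε ∷ u) v = code-++ (not b) u v
  code-++ b (σ ∷ u) v = cong (_ ∷_) (code-++ (not b) u v)
  code-++ b (lt x ∷ u) v = cong (_ ∷_) (code-++ (not b) u v)

  code-not : ∀ b w → code (not b) w ≡ flip (code b w)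
  code-not b [] = refl
  code-not b (ε ∷ w) = code-not (not b) w
  code-not b (σ ∷ w) = cong (_ ∷_) (code-not (not b) w)
  code-not b (lt x ∷ w) = cong (_ ∷_) (code-not (not b) w)

  code-reverse : ∀ b w → code b (reverse w) ≡ reverse (code (not (alternate (length w) b)) w)
  code-reverse b [] = refl
  code-reverse b (c ∷ w) = begin
    code b (reverse (c ∷ w))                 ≡⟨ cong (code b) (unfold-reverse c w) ⟩
    code b (reverse w ∷ʳ c)                  ≡⟨ code-++ b (reverse w) (c ∷ []) ⟩
    code b (reverse w) ++ code (alternate (length (reverse w)) b) (c ∷ [])
      ≡⟨ cong₂ _++_ (code-reverse b w) (cong (λ n → code (alternate n b) (c ∷ [])) (length-reverse w)) ⟩
    reverse (code (not a) w) ++ code a (c ∷ [])   ≡⟨ snoc c ⟩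
    reverse (code a (c ∷ w))                 ≡⟨ cong (λ b → reverse (code b (c ∷ w))) (sym (not-involutive a)) ⟩
    reverse (code (not (not a)) (c ∷ w))     ≡⟨ cong (λ b → reverse (code (not b) (c ∷ w)))
        (alternate-not (length w) b) ⟨
    reverse (code (not (alternate (length w) (not b))) (c ∷ w)) ∎
    where
    open ≡-Reasoning
    a = alternate (length w) b
    snoc : ∀ c → reverse (code (not a) w) ++ code a (c ∷ []) ≡ reverse (code a (c ∷ w))
    snoc ε = ++-identityʳ _
    snoc σ = sym (unfold-reverse _ (code (not a) w))
    snoc (lt x) = sym (unfold-reverse _ (code (not a) w))

  -- Deleting a pair of ε shifts all later positions by two. The suffix `v` stays outside `π`
  -- because a run of ε may continue across the border of `u` and `v`.
  code-π : ∀ b u v → code b (π u ++ v) ≡ code b (u ++ v)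
  code-π b [] v = refl
  code-π b (ε ∷ []) v = refl
  code-π b (ε ∷ ε ∷ u) v = trans (code-π b u v) (cong (λ b → code b (u ++ v)) (sym (not-involutive b)))
  code-π b (ε ∷ σ ∷ u) v = cong (_ ∷_) (code-π (not (not b)) u v)
  code-π b (ε ∷ lt x ∷ u) v = cong (_ ∷_) (code-π (not (not b)) u v)
  code-π b (σ ∷ u) v = cong (_ ∷_) (code-π (not b) u v)
  code-π b (lt x ∷ u) v = cong (_ ∷_) (code-π (not b) u v)

  -- A mark ends every run of ε, so deletion acts separately on its two sides.
  π-mark : ∀ u p v → π (u ++ ⌜ p ⌝ ∷ v) ≡ π u ++ ⌜ p ⌝ ∷ π v
  π-mark [] nothing v = refl
  π-mark [] (just x) v = refl
  π-mark (ε ∷ []) nothing v = refl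
  π-mark (ε ∷ []) (just x) v = refl
  π-mark (ε ∷ ε ∷ u) p v = π-mark u p v
  π-mark (ε ∷ σ ∷ u) p v = cong (λ w → ε ∷ σ ∷ w) (π-mark u p v)
  π-mark (ε ∷ lt x ∷ u) p v = cong (λ w → ε ∷ lt x ∷ w) (π-mark u p v)
  π-mark (σ ∷ u) p v = cong (σ ∷_) (π-mark u p v)
  π-mark (lt x ∷ u) p v = cong (lt x ∷_) (π-mark u p v)

  ∈-code⁻ : ∀ b {p} w → p ∈ letters (code b w) → ⌜ p ⌝ ∈ w
  ∈-code⁻ b (ε ∷ w) i = there (∈-code⁻ (not b) w i)
  ∈-code⁻ b (σ ∷ w) (here refl) = here refl
  ∈-code⁻ b (σ ∷ w) (there i) = there (∈-code⁻ (not b) w i)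
  ∈-code⁻ b (lt x ∷ w) (here refl) = here refl
  ∈-code⁻ b (lt x ∷ w) (there i) = there (∈-code⁻ (not b) w i)

  ∈-code⁺ : ∀ b {p} w → ⌜ p ⌝ ∈ w → p ∈ letters (code b w)
  ∈-code⁺ b {nothing} (c ∷ w) (here refl) = here refl
  ∈-code⁺ b {just x} (c ∷ w) (here refl) = here refl
  ∈-code⁺ b (ε ∷ w) (there i) = ∈-code⁺ (not b) w i
  ∈-code⁺ b (σ ∷ w) (there i) = there (∈-code⁺ (not b) w i)
  ∈-code⁺ b (lt x ∷ w) (there i) = there (∈-code⁺ (not b) w i)

  π-∈⁻ : ∀ {p} w → ⌜ p ⌝ ∈ π w → ⌜ p ⌝ ∈ w
  π-∈⁻ {p} w i = ∈-code⁻ false w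
    (subst (λ Z → p ∈ letters Z) (trans (cong (code false) (sym (++-identityʳ (π w))))
        (trans (code-π false w []) (cong (code false) (++-identityʳ w))))
      (∈-code⁺ false (π w) i))

  code-factor : ∀ b w S {p β T} → code b w ≡ S ++ (p , β) ∷ T →
    ∃₂ λ s t → w ≡ s ++ ⌜ p ⌝ ∷ t × code b s ≡ S ×
      (let a = alternate (length s) b in β ≡ bit a p × code (not a) t ≡ T)
  code-factor b [] [] ()
  code-factor b [] (_ ∷ _) ()
  code-factor b (ε ∷ w) S e with code-factor (not b) w S e
  ... | s , t , refl , eS , r = ε ∷ s , t , refl , eS , r
  code-factor b (σ ∷ w) [] refl = [] , w , refl , refl , refl , refl
  code-factor b (lt x ∷ w) [] refl = [] , w , refl , refl , refl , refl
  code-factor b (σ ∷ w) (_ ∷ S) e with ∷-injective e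
  ... | refl , e′ with code-factor (not b) w S e′
  ... | s , t , refl , eS , r = σ ∷ s , t , refl , cong (_ ∷_) eS , r
  code-factor b (lt x ∷ w) (_ ∷ S) e with ∷-injective e
  ... | refl , e′ with code-factor (not b) w S e′
  ... | s , t , refl , eS , r = lt x ∷ s , t , refl , cong (_ ∷_) eS , r

  -- Here `k` counts the interior vertices of a rim path, two less than all its vertices. Even is
  -- the demand of N1 and N4, σ belonging to every clique, and odd that of N5; between σ and σ it
  -- says that a full round has odd order.
  GapParity : Mark → Mark → ℕ → Set
  GapParity (just x) (just y) k = (x ≡ y → Even k) × (x ≢ y → Odd k)
  GapParity _ _ k = Even k

  Gap : Word m → Set
  Gap w = ∀ s p g q t → w ≡ s ++ ⌜ p ⌝ ∷ g ++ ⌜ q ⌝ ∷ t → ⌜ p ⌝ ∉ g → ⌜ q ⌝ ∉ g →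
    GapParity p q (length g)

  -- The parities `a` and `a′` of the two ends differ exactly when the gap is even. Inverting the
  -- bit of σ turns the even gap between σ and a letter into equal bits, as alternation asks of two
  -- different marks.
  alternating⇒gap : ∀ b w → Alternating (code b w) → Gap w
  alternating⇒gap b w R s p g q t refl p∉ q∉ =
    parity p q (R (code b s) p (bit a p) (code (not a) g) q (bit a′ q) (code (not a′) t)
                  eq (p∉ ∘ ∈-code⁻ (not a) g) (q∉ ∘ ∈-code⁻ (not a) g))
    where
    a = alternate (length s) b
    a′ = alternate (length g) (not a)
    open ≡-Reasoning
    eq : code b w ≡ code b s ++ (p , bit a p) ∷ code (not a) g ++ (q , bit a′ q) ∷ code (not a′) t
    eq = begin
      code b (s ++ ⌜ p ⌝ ∷ g ++ ⌜ q ⌝ ∷ t)                 ≡⟨ code-++ b s _ ⟩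
      code b s ++ code a (⌜ p ⌝ ∷ g ++ ⌜ q ⌝ ∷ t)          ≡⟨ cong (code b s ++_) (code-mark a p _) ⟩
      code b s ++ (p , bit a p) ∷ code (not a) (g ++ ⌜ q ⌝ ∷ t)
        ≡⟨ cong (λ Z → code b s ++ (p , bit a p) ∷ Z)
            (trans (code-++ (not a) g _) (cong (code (not a) g ++_) (code-mark a′ q t))) ⟩
      code b s ++ (p , bit a p) ∷ code (not a) g ++ (q , bit a′ q) ∷ code (not a′) t ∎
    even : a ≢ a′ → Even (length g)
    even n = alternate⇒even (length g) (not a) (¬-not (n ∘ sym))
    odd : a ≡ a′ → Odd (length g)
    odd e = alternate⇒odd (length g) (not a) (trans (sym e) (sym (not-involutive a)))
    parity : ∀ p q → (p ≡ q → bit a p ≢ bit a′ q) × (p ≢ q → bit a p ≡ bit a′ q) →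
      GapParity p q (length g)
    parity (just x) (just y) (same , different) =
      (λ e → even (same (cong just e))) , (λ n → odd (different (n ∘ Maybe.just-injective)))
    parity nothing nothing (same , _) = even (λ e → same refl (cong not e))
    parity nothing (just x) (_ , different) = alternate⇒even (length g) (not a) (sym (different λ ()))
    parity (just x) nothing (_ , different) = even (λ e → not-¬ e (different λ ()))

  gap⇒alternating : ∀ b w → Gap w → Alternating (code b w)
  gap⇒alternating b w G S p β Γ q β′ T e p∉ q∉ with code-factor b w S e
  ... | s , t , refl , refl , refl , e′ with code-factor (not (alternate (length s) b)) t Γ e′
  ... | g , t′ , refl , refl , refl , refl =
    parity p q (G s p g q t′ refl (p∉ ∘ ∈-code⁺ (not a) g) (q∉ ∘ ∈-code⁺ (not a) g))
    where
    a = alternate (length s) b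
    a′ = alternate (length g) (not a)
    ne : Even (length g) → a ≢ a′
    ne p e = not-¬ refl (trans e (alternate-even (length g) (not a) p))
    eq : Odd (length g) → a ≡ a′
    eq o = trans (sym (not-involutive a)) (sym (alternate-odd (length g) (not a) o))
    parity : ∀ p q → GapParity p q (length g) →
      (p ≡ q → bit a p ≢ bit a′ q) × (p ≢ q → bit a p ≡ bit a′ q)
    parity (just x) (just y) (same , different) =
      (λ e → ne (same (Maybe.just-injective e))) , (λ n → eq (different (n ∘ cong just)))
    parity nothing nothing ev = (λ _ → ne ev ∘ not-injective) , (λ n → ⊥-elim (n refl))
    parity nothing (just x) ev = (λ ()) , (λ _ → sym (¬-not (ne ev ∘ sym)))
    parity (just x) nothing ev = (λ ()) , (λ _ → ¬-not (ne ev))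

  -- One round of the cyclic word σ u, closed up at σ.
  lap : Word m → Word m
  lap u = σ ∷ u ++ σ ∷ []

  Alternates : Word m → Set
  Alternates u = Alternating (code true (lap u))

  -- A rim word is cut at σ into two pieces that `π` reduces separately. Their reductions are joined
  -- in cyclic order, where a pair of ε may remain at the seam.
  alternates-π : ∀ u v → Alternates (u ++ v) → Alternates (π u ++ π v)
  alternates-π u v = subst Alternating (cong (_ ∷_) (sym (begin
    code false ((π u ++ π v) ++ σ ∷ [])   ≡⟨ cong (code false) (++-assoc (π u) _ _) ⟩
    code false (π u ++ π v ++ σ ∷ [])     ≡⟨ code-π false u _ ⟩
    code false (u ++ π v ++ σ ∷ [])       ≡⟨ code-++ false u _ ⟩
    code false u ++ code a (π v ++ σ ∷ [])   ≡⟨ cong (code false u ++_) (code-π a v _) ⟩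
    code false u ++ code a (v ++ σ ∷ [])  ≡⟨ code-++ false u _ ⟨
    code false (u ++ v ++ σ ∷ [])         ≡⟨ cong (code false) (++-assoc u _ _) ⟨
    code false ((u ++ v) ++ σ ∷ [])       ∎)))
    where
    open ≡-Reasoning
    a = alternate (length u) false

  alternates-π⁻ : ∀ u → Alternates (π u) → Alternates u
  alternates-π⁻ u = subst Alternating (cong (_ ∷_) (code-π false u (σ ∷ [])))

  alternates⇒even : ∀ u → σ ∉ u → Alternates u → Even (length u)
  alternates⇒even u σ∉u R = alternating⇒gap true (lap u) R [] nothing u nothing [] refl σ∉u σ∉u

  -- A lap has even length, since the gap from σ round to σ is even. Reading it from the other end
  -- therefore starts at the opposite parity, which is the flip in `alternating-reverse`.
  alternates-reverse : ∀ u → σ ∉ u → Alternates u → Alternates (reverse u)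
  alternates-reverse u σ∉u R = subst Alternating eq (alternating-reverse _ R)
    where
    open ≡-Reasoning
    len : ∀ b → alternate (length (lap u)) b ≡ b
    len b = alternate-even (length (lap u)) b (subst Even
        (cong suc (sym (trans (length-++ u) (ℕ.+-comm (length u) 1)))) (even-+2 (alternates⇒even u σ∉u R)))
    eq : reverse (flip (code true (lap u))) ≡ code true (lap (reverse u))
    eq = begin
      reverse (flip (code true (lap u)))      ≡⟨ cong reverse (code-not true (lap u)) ⟨
      reverse (code false (lap u))            ≡⟨ cong (λ b → reverse (code (not b) (lap u))) (len true) ⟨
      reverse (code (not (alternate (length (lap u)) true)) (lap u))   ≡⟨ code-reverse true (lap u) ⟨
      code true (reverse (lap u))             ≡⟨ cong (code true) (reverse-factor [] u []) ⟩
      code true (lap (reverse u))             ∎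

  -- Unrolls v u: the cyclic word v reads σ u from one of its occurrences of σ.
  Unrolls : Word m → Word m → Set
  Unrolls v u = ∃₂ λ a b → v ≡ a ++ σ ∷ b × u ≡ b ++ a

  unrolls-swap : ∀ x y u → Unrolls (x ++ y) u → Unrolls (y ++ x) u
  unrolls-swap [] y u r = subst (λ w → Unrolls w u) (sym (++-identityʳ y)) r
  unrolls-swap (c ∷ x) y u (a , b , e , refl) =
    subst (λ w → Unrolls w (b ++ a)) (++-assoc y (c ∷ []) x)
      (unrolls-swap x (y ++ c ∷ []) (b ++ a) (step a e))
    where
    step : ∀ a → c ∷ x ++ y ≡ a ++ σ ∷ b → Unrolls (x ++ y ++ c ∷ []) (b ++ a)
    step [] e with ∷-injective e
    ... | refl , e′ = x ++ y , [] , sym (++-assoc x y _) , trans (++-identityʳ b) (sym e′)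
    step (d ∷ a) e with ∷-injective e
    ... | refl , e′ = a , b ++ d ∷ [] ,
      trans (sym (++-assoc x y _)) (trans (cong (_++ d ∷ []) e′) (++-assoc a (σ ∷ b) _)) ,
      sym (++-assoc b (d ∷ []) a)

  unrolls-reverse : ∀ v u → Unrolls v u → Unrolls (reverse v) (reverse u)
  unrolls-reverse _ _ (a , b , refl , refl) =
    reverse b , reverse a ,
    trans (reverse-++ a (σ ∷ b)) (trans (cong (_++ reverse a) (unfold-reverse σ b))
        (++-assoc (reverse b) _ _)) ,
    reverse-++ b a

  unrolls-∼ : ∀ {v w u} → v ∼ w → Unrolls v u → Unrolls w u ⊎ Unrolls w (reverse u)
  unrolls-∼ {v} {w} {u} (k , _ , e) r = Sum.map (λ { refl → r′ }) (λ { refl → unrolls-reverse _ _ r′ }) e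
    where
    r′ : Unrolls (rot k v) u
    r′ = unrolls-swap (take k v) (drop k v) u (subst (λ w → Unrolls w u) (sym (take++drop≡id k v)) r)

  -- As `u` is free of σ, the cyclic word has a single σ at which it can be cut.
  unrolls-unique : ∀ {v u u′} → σ ∉ u → Unrolls v u → Unrolls v u′ → u ≡ u′
  unrolls-unique σ∉ (a , b , refl , refl) (a′ , b′ , e , refl) =
    let p , q = go a a′ (σ∉ ∘ ∈-++⁺ʳ b) (σ∉ ∘ ∈-++⁺ˡ) e in cong₂ _++_ q p
    where
    go : ∀ a a′ {b b′} → σ ∉ a → σ ∉ b → a ++ σ ∷ b ≡ a′ ++ σ ∷ b′ → a ≡ a′ × b ≡ b′
    go [] [] na nb refl = refl , refl
    go [] (_ ∷ a′) na nb refl = ⊥-elim (nb (∈-++⁺ʳ a′ (here refl)))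
    go (c ∷ a) [] na nb refl = ⊥-elim (na (here refl))
    go (c ∷ a) (c′ ∷ a′) na nb e with ∷-injective e
    ... | refl , e′ = let p , q = go a a′ (na ∘ there) nb e′ in cong (c ∷_) p , q

-- Blocks, the induced order and Dyck paths

module _ {A : Set} {P Q : A → Set} (P? : Decidable P) (Q? : Decidable Q) where

  filter-length-≡ : ∀ L → (∀ {w} → w ∈ L → P w → Q w) → (∀ {w} → w ∈ L → Q w → P w) →
    length (filter P? L) ≡ length (filter Q? L)
  filter-length-≡ [] f g = refl
  filter-length-≡ (c ∷ L) f g with P? c | Q? c
  ... | yes p | yes q = cong suc (filter-length-≡ L (f ∘ there) (g ∘ there))
  ... | no ¬p | no ¬q = filter-length-≡ L (f ∘ there) (g ∘ there)
  ... | yes p | no ¬q = ⊥-elim (¬q (f (here refl) p))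
  ... | no ¬p | yes q = ⊥-elim (¬p (g (here refl) q))

  filter-length-suc : ∀ {a L} → Unique L → a ∈ L → P a → ¬ Q a →
    (∀ {w} → Q w → P w) → (∀ {w} → P w → w ≢ a → Q w) →
    length (filter P? L) ≡ suc (length (filter Q? L))
  filter-length-suc {a} {a ∷ L} (fresh ∷ _) (here refl) p ¬q f g with P? a | Q? a
  ... | yes _ | no _ = cong suc (filter-length-≡ L (λ i p → g p (λ e → All.lookup fresh i (sym e))) (λ _ → f))
  ... | no ¬p | _ = ⊥-elim (¬p p)
  ... | yes _ | yes q = ⊥-elim (¬q q)
  filter-length-suc {a} {c ∷ L} (fresh ∷ u) (there i) p ¬q f g with P? c | Q? c
  ... | yes _ | yes _ = cong suc (filter-length-suc u i p ¬q f g)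
  ... | no _ | no _ = filter-length-suc u i p ¬q f g
  ... | no ¬p | yes q = ⊥-elim (¬p (f q))
  ... | yes pc | no ¬qc = ⊥-elim (¬qc (g pc (All.lookup fresh i)))

  filter-length-≤ : ∀ L → (∀ {w} → Q w → P w) → length (filter Q? L) ≤ length (filter P? L)
  filter-length-≤ [] f = z≤n
  filter-length-≤ (c ∷ L) f with P? c | Q? c
  ... | yes p | yes q = s≤s (filter-length-≤ L f)
  ... | no ¬p | no ¬q = filter-length-≤ L f
  ... | yes p | no ¬q = ℕ.m≤n⇒m≤1+n (filter-length-≤ L f)
  ... | no ¬p | yes q = ⊥-elim (¬p (f q))

  filter-length-< : ∀ {a L} → a ∈ L → P a → ¬ Q a → (∀ {w} → Q w → P w) →
    length (filter Q? L) < length (filter P? L)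
  filter-length-< {a} {c ∷ L} i p ¬q f with P? c | Q? c
  filter-length-< (here refl) p ¬q f | yes _ | yes q = ⊥-elim (¬q q)
  filter-length-< (there i) p ¬q f | yes _ | yes _ = s≤s (filter-length-< i p ¬q f)
  filter-length-< {L = _ ∷ L} i p ¬q f | yes _ | no _ = s≤s (filter-length-≤ L f)
  filter-length-< (here refl) p ¬q f | no ¬p | _ = ⊥-elim (¬p p)
  filter-length-< (there i) p ¬q f | no _ | no _ = filter-length-< i p ¬q f
  filter-length-< (there i) p ¬q f | no ¬p | yes q = ⊥-elim (¬p (f q))

minimum-≤ : ∀ {x} d xs → x ∈ xs → minimum d xs ≤ x
minimum-≤ d (x ∷ xs) (here refl) = ℕ.m⊓n≤m x _
minimum-≤ d (x ∷ xs) (there i) = ℕ.≤-trans (ℕ.m⊓n≤n x _) (minimum-≤ d xs i)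

minimum-attained : ∀ d xs → minimum d xs ≡ d ⊎ minimum d xs ∈ xs
minimum-attained d [] = inj₁ refl
minimum-attained d (x ∷ xs) with ℕ.⊓-sel x (minimum d xs)
... | inj₁ e = inj₂ (here e)
... | inj₂ e = Sum.map (trans e) (λ i → there (subst (_∈ xs) (sym e) i)) (minimum-attained d xs)

∈-snoc⁻ : ∀ {A : Set} {c d : A} w → c ≢ d → c ∈ w ++ d ∷ [] → c ∈ w
∈-snoc⁻ w n i with ∈-++⁻ w i
... | inj₁ j = j
... | inj₂ (here e) = ⊥-elim (n e)

∉-∷ : ∀ {A : Set} {c d : A} {w} → c ≢ d → c ∉ w → c ∉ d ∷ w
∉-∷ n n′ (here e) = n e
∉-∷ n n′ (there i) = n′ i

module _ {m : ℕ} where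

  positions⁺ : ∀ (c : Letter m) s t k → k + length s ∈ positions c (s ++ c ∷ t) k
  positions⁺ c [] t k with c ≟L c
  ... | yes _ = here (ℕ.+-identityʳ k)
  ... | no n = ⊥-elim (n refl)
  positions⁺ c (d ∷ s) t k with d ≟L c
  ... | yes _ = there (subst (_∈ positions c (s ++ c ∷ t) (suc k)) (sym (ℕ.+-suc k _))
      (positions⁺ c s t (suc k)))
  ... | no _ = subst (_∈ positions c (s ++ c ∷ t) (suc k)) (sym (ℕ.+-suc k _)) (positions⁺ c s t (suc k))

  positions⁻ : ∀ (c : Letter m) v k {i} → i ∈ positions c v k →
    ∃₂ λ s t → v ≡ s ++ c ∷ t × i ≡ k + length s
  positions⁻ c (d ∷ v) k i with d ≟L c
  positions⁻ c (d ∷ v) k (here refl) | yes refl = [] , v , refl , sym (ℕ.+-identityʳ k)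
  positions⁻ c (d ∷ v) k (there i) | yes _ =
    let s , t , e , f = positions⁻ c v (suc k) i in d ∷ s , t , cong (d ∷_) e , trans f (sym (ℕ.+-suc k _))
  positions⁻ c (d ∷ v) k i | no _ =
    let s , t , e , f = positions⁻ c v (suc k) i in d ∷ s , t , cong (d ∷_) e , trans f (sym (ℕ.+-suc k _))

  code-spread′ : ∀ b c (w v : Word m) → code b (spread′ c w ++ v) ≡ code b (c ∷ w ++ v)
  code-spread : ∀ b (w v : Word m) → code b (spread w ++ v) ≡ code b (w ++ v)
  code-spread b [] v = refl
  code-spread b (c ∷ w) v = code-spread′ b c w v
  code-spread′ b c [] v = refl
  code-spread′ b ε (d ∷ w) v = code-spread′ (not b) d w v
  code-spread′ b σ (d ∷ w) v = cong (_ ∷_) (code-spread′ (not b) d w v)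
  code-spread′ b (lt x) (d ∷ w) v with lt x ≟L d
  ... | yes _ = cong (_ ∷_) (trans (cong (λ b → code b (spread′ d w ++ v)) (cong not (not-involutive b)))
      (code-spread′ (not b) d w v))
  ... | no _ = cong (_ ∷_) (code-spread′ (not b) d w v)

  vTail : Blocks m → Word m
  vTail B = ε ∷ ε ∷ (spread (body B) ++ ε ∷ ε ∷ [])

  -- The word that defines the induced order differs from the block word only by pairs of ε, so the
  -- cursor path of the blocks also governs the distances in it.
  code-vTail : ∀ B → code true (lap (vTail B)) ≡ code true (lap (body B))
  code-vTail B = cong (_ ∷_) (begin
    code false ((spread (body B) ++ ε ∷ ε ∷ []) ++ σ ∷ [])
        ≡⟨ cong (code false) (++-assoc (spread (body B)) _ _) ⟩
    code false (spread (body B) ++ ε ∷ ε ∷ σ ∷ [])   ≡⟨ code-spread false (body B) _ ⟩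
    code false (body B ++ ε ∷ ε ∷ σ ∷ [])            ≡⟨ code-++ false (body B) _ ⟩
    code false (body B) ++ code (not (not a)) (σ ∷ [])
        ≡⟨ cong (λ a → code false (body B) ++ code a (σ ∷ [])) (not-involutive a) ⟩
    code false (body B) ++ code a (σ ∷ [])           ≡⟨ code-++ false (body B) _ ⟨
    code false (body B ++ σ ∷ [])                    ∎)
    where
    open ≡-Reasoning
    a = alternate (length (body B)) false

  -- The marks `p` and `q` are crossed in succession in the same direction `b`, so `q` lies one
  -- level above `p` if `b` is false and one below if it is true.
  Linkage : (Mark {m} → ℕ) → Mark {m} → Bool → Mark {m} → Set
  Linkage η p b q = start η (not b) p ≡ start η b q

  -- p is the mark read before the blocks, b the bit of the first letter to be read.
  Steps : (Mark {m} → ℕ) → Mark {m} → Bool → Blocks m → Set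
  Steps η p b [] = Linkage η p b nothing × start η (not b) nothing ≡ 0
  Steps η p b ((x , l) ∷ B) = Linkage η p b (just x) × Steps η (just x) (not (alternate l b)) B

  module _ {η : Mark {m} → ℕ} where

    pow⁻ : ∀ b x l w {c} → Crossing η (start η b (just x)) (code b (pow (x , l) ++ w)) c →
      Crossing η (start η (alternate l b) (just x)) (code (alternate l b) w) c
    pow⁻ b x zero w r = r
    pow⁻ b x (suc l) w (_ , r) = pow⁻ (not b) x l w r

    pow⁺ : ∀ b x l w {c} → Crossing η (start η (alternate l b) (just x)) (code (alternate l b) w) c →
      Crossing η (start η b (just x)) (code b (pow (x , l) ++ w)) c
    pow⁺ b x zero w r = r
    pow⁺ b x (suc l) w r = refl , pow⁺ (not b) x l w r

    -- A block crosses one interval back and forth, so only the parity of its exponent survives. The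
    -- separating ε inverts the bit once more; at the end the inverted bit of σ does the same, which
    -- makes all blocks uniform.
    crossing⇒steps : ∀ p b x l B → All (λ c → 1 ≤ proj₂ c) ((x , l) ∷ B) →
      Crossing η (start η (not b) p) (code b (body ((x , l) ∷ B) ++ σ ∷ [])) 0 →
      Steps η p b ((x , l) ∷ B)
    crossing⇒steps p b x (suc l) [] (s≤s _ ∷ _) (e , r) =
      let f , g = pow⁻ (not b) x l (σ ∷ []) r
          a = alternate l (not b)
      in e , trans (cong (λ b → start η b (just x)) (not-involutive a)) f , g
    crossing⇒steps p b x (suc l) (c ∷ B) (s≤s _ ∷ pos) (e , r) =
      let a = alternate l (not b) in
      e , crossing⇒steps (just x) (not a) (proj₁ c) (proj₂ c) B pos
        (subst (λ b → Crossing η (start η b (just x)) (code (not a) (body (c ∷ B) ++ σ ∷ [])) 0)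
          (sym (not-involutive a))
          (pow⁻ (not b) x l (ε ∷ body (c ∷ B) ++ σ ∷ [])
            (subst (λ w → Crossing η (start η (not b) (just x)) (code (not b) w) 0)
              (++-assoc (pow (x , l)) (ε ∷ body (c ∷ B)) (σ ∷ [])) r)))

    steps⇒crossing : ∀ p b x l B → Steps η p b ((x , l) ∷ B) →
      Crossing η (start η (not b) p) (code b (body ((x , l) ∷ B) ++ σ ∷ [])) 0
    steps⇒crossing p b x l [] (e , f , g) =
      let a = alternate l b in
      subst (λ c → Crossing η c (code b (pow (x , l) ++ σ ∷ [])) 0) (sym e)
        (pow⁺ b x l (σ ∷ []) (trans (cong (λ b → start η b (just x)) (sym (not-involutive a))) f , g))
    steps⇒crossing p b x l (c ∷ B) (e , r) =
      let a = alternate l b in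
      subst (λ d → Crossing η d (code b (body ((x , l) ∷ c ∷ B) ++ σ ∷ [])) 0) (sym e)
        (subst (λ w → Crossing η (start η b (just x)) (code b w) 0)
          (sym (++-assoc (pow (x , l)) (ε ∷ body (c ∷ B)) (σ ∷ [])))
          (pow⁺ b x l (ε ∷ body (c ∷ B) ++ σ ∷ [])
            (subst (λ b → Crossing η (start η b (just x)) (code (not a) (body (c ∷ B) ++ σ ∷ [])) 0)
              (not-involutive a)
              (steps⇒crossing (just x) (not a) (proj₁ c) (proj₂ c) B r))))

  -- Apart from the final zero, `Steps` speaks of heights only through unit differences. This allows
  -- the index in the chain to be exchanged for the rank in the induced order.
  steps-map : ∀ {η θ : Mark {m} → ℕ} → (∀ p q → η q ≡ suc (η p) → θ q ≡ suc (θ p)) → θ nothing ≡ 0 →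
    ∀ p b B → Steps η p b B → Steps θ p b B
  steps-map {η} {θ} h z = go
    where
    link : ∀ p b q → Linkage η p b q → Linkage θ p b q
    link p false q e = sym (h p q (sym e))
    link p true q e = h q p e
    go : ∀ p b B → Steps η p b B → Steps θ p b B
    go p true [] (e , _) = link p true nothing e , z
    go p b ((x , l) ∷ B) (e , r) = link p b (just x) e , go (just x) _ B r

  TypeII⇒∈body : ∀ (B : Blocks m) → All (λ c → 1 ≤ proj₂ c) B → ∀ {x} → x ∈ map proj₁ B → lt x ∈ body B
  TypeII⇒∈body ((x , suc l) ∷ []) (s≤s _ ∷ _) (here refl) = here refl
  TypeII⇒∈body ((x , suc l) ∷ c ∷ B) (s≤s _ ∷ _) (here refl) = here refl
  TypeII⇒∈body ((x , l) ∷ c ∷ B) (_ ∷ pos) (there i) =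
    ∈-++⁺ʳ (pow (x , l)) (there (TypeII⇒∈body (c ∷ B) pos i))

  σ∉pow-++ : ∀ x l {w} → σ ∉ w → σ ∉ pow {m} (x , l) ++ w
  σ∉pow-++ x zero n = n
  σ∉pow-++ x (suc l) n (there i) = σ∉pow-++ x l n i

  σ∉body : ∀ (B : Blocks m) → σ ∉ body B
  σ∉body [] ()
  σ∉body ((x , l) ∷ []) = subst (σ ∉_) (++-identityʳ _) (σ∉pow-++ x l (λ ()))
  σ∉body ((x , l) ∷ c ∷ B) = σ∉pow-++ x l (∉-∷ (λ ()) (σ∉body (c ∷ B)))

  -- Before and after every occurrence of a higher letter the cursor, which starts
  -- and ends at the bottom, has to cross each lower letter.
  module _ (B : Blocks m) {η : Mark {m} → ℕ} (inj : ∀ {p q} → η p ≡ η q → p ≡ q)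
           (cross : Crossing η 0 (code true (lap (body B))) 0)
           (occurs : ∀ x → lt x ∈ body B) where

    flanked : ∀ {x y} s t → η (just x) < η (just y) → vWord B ≡ s ++ lt y ∷ t → lt x ∈ s × lt x ∈ t
    flanked {x} {y} s t x<y e = before , after
      where
      open DecMembership (_≟M_ {m}) using (_∈?_)
      a = alternate (length s) true
      Z₂ = code (not a) (t ++ σ ∷ [])
      cross′ : Crossing η 0 (code true s ++ (just y , a) ∷ Z₂) 0
      cross′ = subst (λ Z → Crossing η 0 Z 0)
        (trans (sym (code-vTail B)) (trans (cong (code true)
          (trans (cong (_++ σ ∷ []) e) (++-assoc s (lt y ∷ t) (σ ∷ [])))) (code-++ true s _))) cross
      split = crossing-++⁻ 0 (code true s) cross′
      x<start : ∀ b → η (just x) < start η b (just y)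
      x<start false = x<y
      x<start true = ℕ.m<n⇒m<1+n x<y
      before : lt x ∈ s
      before with just x ∈? letters (code true s)
      ... | yes i = ∈-code⁻ true s i
      ... | no n =
        let d , r , d≡ , _ = split in
        ⊥-elim (ℕ.<⇒≱ (x<start a) (subst (_≤ η (just x)) d≡ (proj₁ (sameSide inj (code true s) n r) z≤n)))
      after : lt x ∈ t
      after with just x ∈? letters Z₂
      ... | yes i = ∈-snoc⁻ t (λ ()) (∈-code⁻ (not a) (t ++ σ ∷ []) i)
      ... | no n =
        let d , _ , _ , r = split in
        case proj₂ (sameSide inj Z₂ n r) (x<start (not a)) of λ ()

    private
      v = vWord B
      n = length v

    minDist-≤ : ∀ {x} s t → v ≡ s ++ lt x ∷ t → minDist B x ≤ cycDist n (length s)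
    minDist-≤ {x} s t e =
      minimum-≤ n (map (cycDist n) (positions (lt x) v 0))
        (∈-map⁺ (cycDist n) (subst (λ w → length s ∈ positions (lt x) w 0) (sym e) (positions⁺ (lt x) s t 0)))

    length-< : ∀ {c} s t → v ≡ s ++ c ∷ t → length s < n
    length-< s t e = subst (length s <_) (sym (trans (cong length e) (length-++ s)))
        (ℕ.m<m+n (length s) (s≤s z≤n))

    occurs-v : ∀ x → lt x ∈ v
    occurs-v x = ∈-snoc⁻ v (λ ()) (
      (∈-code⁻ true (lap (vTail B)) (subst (λ Z → just x ∈ letters Z) (sym (code-vTail B))
        (∈-code⁺ true (lap (body B)) (there (∈-++⁺ˡ (occurs x)))))))

    -- A nearest occurrence of `y` has an `x` on each of the two arcs joining it to vertex 1, so
    -- whichever arc is shorter, some `x` is closer.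
    minDist-mono : ∀ {x y} → η (just x) < η (just y) → minDist B x < minDist B y
    minDist-mono {x} {y} x<y with minimum-attained n (map (cycDist n) (positions (lt y) v 0))
    -- The minimum is the default `n`, which still exceeds the position of any occurrence of `x`.
    ... | inj₁ e =
      let s , t , f = ∈-∃++ (occurs-v x) in
      subst (minDist B x <_) (sym e)
        (ℕ.≤-<-trans (minDist-≤ s t f) (ℕ.≤-<-trans (ℕ.m⊓n≤m (length s) (n ∸ length s))
            (length-< {lt x} s t f)))
    ... | inj₂ i with ∈-map⁻ (cycDist n) i
    ... | j , j∈ , e with positions⁻ (lt y) v 0 j∈
    ... | s , t , f , refl = subst (minDist B x <_) (sym e) (ℕ.⊓-pres-m< left right)
      where
      flank = flanked s t x<y f
      left : minDist B x < length s
      left =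
        let s₁ , s₂ , g = ∈-∃++ (proj₁ flank) in
        ℕ.≤-<-trans (minDist-≤ s₁ (s₂ ++ lt y ∷ t) (trans f (trans (cong (_++ lt y ∷ t) g) (++-assoc s₁ _ _))))
          (ℕ.≤-<-trans (ℕ.m⊓n≤m (length s₁) (n ∸ length s₁))
            (subst (length s₁ <_) (sym (trans (cong length g) (length-++ s₁))) (ℕ.m<m+n (length s₁) (s≤s z≤n))))
      right : minDist B x < n ∸ length s
      right =
        let t₁ , t₂ , g = ∈-∃++ (proj₂ flank)
            h = trans f (trans (cong (λ t → s ++ lt y ∷ t) g) (sym (++-assoc s (lt y ∷ t₁) (lt x ∷ t₂))))
        in ℕ.≤-<-trans (minDist-≤ (s ++ lt y ∷ t₁) t₂ h)
             (ℕ.≤-<-trans (ℕ.m⊓n≤n (length (s ++ lt y ∷ t₁)) (n ∸ length (s ++ lt y ∷ t₁)))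
               (ℕ.∸-monoʳ-< (subst (length s <_) (sym (length-++ s)) (ℕ.m<m+n (length s) (s≤s z≤n)))
                 (ℕ.<⇒≤ (length-< {lt x} (s ++ lt y ∷ t₁) t₂ h))))

    minDist-reflects : ∀ {x y} → minDist B x < minDist B y → η (just x) < η (just y)
    minDist-reflects {x} {y} lt′ with ℕ.<-cmp (η (just x)) (η (just y))
    ... | tri< p _ _ = p
    ... | tri≈ _ e _ with inj e
    ... | refl = ⊥-elim (ℕ.<-irrefl refl lt′)
    minDist-reflects {x} {y} lt′ | tri> _ _ p = ⊥-elim (ℕ.<-asym lt′ (minDist-mono p))

    isChain : IsChain B
    isChain x y x≢y with ℕ.<-cmp (η (just x)) (η (just y))
    ... | tri< p _ _ = inj₁ (minDist-mono p)
    ... | tri≈ _ e _ = ⊥-elim (x≢y (Maybe.just-injective (inj e)))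
    ... | tri> _ _ p = inj₂ (minDist-mono p)

    -- No level lies strictly between those of `x` and `y`, and by injectivity `x` is alone on its
    -- level; hence exactly one more letter is nearer than `y` than is nearer than `x`.
    rank-suc : ∀ x y → η (just y) ≡ suc (η (just x)) → rank B y ≡ suc (rank B x)
    rank-suc x y e =
      filter-length-suc (λ w → minDist B w <? minDist B y) (λ w → minDist B w <? minDist B x)
        {L = allFin m} (Uniqueₚ.allFin⁺ m) (∈-allFin x) x<y (ℕ.<-irrefl refl)
        (λ p → ℕ.<-trans p x<y)
        (λ p w≢x → minDist-mono (ℕ.≤∧≢⇒< (ℕ.≤-pred (subst (η (just _) <_) e (minDist-reflects p)))
                                          (w≢x ∘ Maybe.just-injective ∘ inj)))
      where
      x<y : minDist B x < minDist B y
      x<y = minDist-mono (subst (η (just x) <_) (sym e) ℕ.≤-refl)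

    rank-zero : η nothing ≡ 0 → ∀ x → η (just x) ≡ 1 → rank B x ≡ 0
    rank-zero z x e = cong length (filter-none (λ w → minDist B w <? minDist B x) {allFin m}
      (All.tabulate λ {w} _ p → case inj (trans
          (ℕ.n≤0⇒n≡0 (ℕ.≤-pred (subst (η (just w) <_) e (minDist-reflects p)))) (sym z)) of λ ()))

  -- Ranks count only letters other than σ; the shift makes room for σ at the bottom of the chain.
  level : (Fin m → ℕ) → Mark {m} → ℕ
  level r nothing = 0
  level r (just x) = suc (r x)

  -- Exponent parities and turns of the path

  module _ (r : Fin m → ℕ) where

    private
      ρ = level r

    height : Blocks m → ℕ → ℕ
    height B = at 0 (map (r ∘ proj₁) B)

    -- The heights with the preceding mark in front; beyond the end the default 0 of `at` supplies
    -- the closing σ. Block `i` then has its two neighbours at the indices `i` and `2 + i`.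
    levels : Mark {m} → Blocks m → List ℕ
    levels p B = ρ p ∷ map (ρ ∘ just ∘ proj₁) B

    at-levels : ∀ p B i → i < length B → at 0 (levels p B) (suc i) ≡ suc (height B i)
    at-levels p (c ∷ B) zero _ = refl
    at-levels p (c ∷ B) (suc i) (s≤s q) = at-levels p B i q

    at-levels-end : ∀ p B → at 0 (levels p B) (suc (length B)) ≡ 0
    at-levels-end p [] = refl
    at-levels-end p (c ∷ B) = at-levels-end p B

    -- An even number of crossings of `x` returns the cursor to the side of `p`, where the next
    -- level to cross is that of `p`. An odd number leaves it on the far side, two levels on.
    turn-even : ∀ p b x l q → Linkage ρ p b (just x) → Linkage ρ (just x) (not (alternate l b)) q → Even l →
        ρ p ≡ ρ q
    turn-even p b x l q e f ev rewrite alternate-even l b ev | not-involutive b = cancel (not b) (trans e f)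
      where
      cancel : ∀ c → start ρ c p ≡ start ρ c q → ρ p ≡ ρ q
      cancel false = λ e → e
      cancel true = ℕ.suc-injective

    turn-odd : ∀ p b x l q → Linkage ρ p b (just x) → Linkage ρ (just x) (not (alternate l b)) q → Odd l → ρ
        p ≢ ρ q
    turn-odd p b x l q e f od rewrite alternate-odd l b od | not-involutive b = go b e f
      where
      go : ∀ b → Linkage ρ p b (just x) → Linkage ρ (just x) b q → ρ p ≢ ρ q
      go false e f g = ℕ.<⇒≢ (ℕ.m<n⇒m<1+n ℕ.≤-refl) (trans g (trans (sym f) (cong suc (sym e))))
      go true e f g = ℕ.<⇒≢ (ℕ.m<n⇒m<1+n ℕ.≤-refl) (trans (sym g) (trans e (cong suc f)))

    TurnParity : ℕ → ℕ → ℕ → Set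
    TurnParity l h k = (h ≡ k → Even l) × (h ≢ k → Odd l)

    steps⇒turns : ∀ p b B → Steps ρ p b B → ∀ i → i < length B →
      TurnParity (Λ-of B i) (at 0 (levels p B) i) (at 0 (levels p B) (2 + i))
    steps⇒turns p b ((x , l) ∷ B) (e , s) (suc i) (s≤s i<) = steps⇒turns (just x) _ B s i i<
    steps⇒turns p b ((x , l) ∷ B) (e , s) zero _ = conclude B s
      where
      decide : ∀ q → Linkage ρ (just x) (not (alternate l b)) q → TurnParity l (ρ p) (ρ q)
      decide q f with 2 ∣? l
      ... | yes ev = (λ _ → ev) , (λ n → ⊥-elim (n (turn-even p b x l q e f ev)))
      ... | no od = (λ g → ⊥-elim (turn-odd p b x l q e f od g)) , (λ _ → od)
      conclude : ∀ B → Steps ρ (just x) (not (alternate l b)) B →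
        TurnParity l (ρ p) (at 0 (map (ρ ∘ just ∘ proj₁) B) 0)
      conclude [] (f , _) = decide nothing f
      conclude ((y , _) ∷ B) (f , _) = decide (just y) f

    Unit : ℕ → ℕ → Set
    Unit h k = k ≡ suc h ⊎ h ≡ suc k

    steps⇒unit : ∀ p b B → Steps ρ p b B → ∀ i → suc i < length B → Unit (height B i) (height B (suc i))
    steps⇒unit p b ((x , l) ∷ (y , l′) ∷ B) (_ , f , _) zero _ = go (not (alternate l b)) f
      where
      go : ∀ b → Linkage ρ (just x) b (just y) → Unit (r x) (r y)
      go false f = inj₁ (sym (ℕ.suc-injective f))
      go true f = inj₂ (ℕ.suc-injective f)
    steps⇒unit p b ((x , l) ∷ B) (_ , s) (suc i) (s≤s i<) = steps⇒unit (just x) _ B s i i<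

    steps⇒last : ∀ p b c B → Steps ρ p b (c ∷ B) → height (c ∷ B) (length B) ≡ 0
    steps⇒last p b (x , l) [] (_ , s) = go (not (alternate l b)) s
      where
      go : ∀ b → Steps ρ (just x) b [] → r x ≡ 0
      go true (e , _) = ℕ.suc-injective e
    steps⇒last p b (x , l) (c ∷ B) (_ , s) = steps⇒last (just x) _ c B s

    -- Every step changes the level by one and the closing σ is at level 0, so the level and the
    -- number of remaining steps agree in parity. From the opening σ this yields an odd number of
    -- blocks.
    steps⇒parity : ∀ p b B → Steps ρ p b B → Even (ρ p + suc (length B))
    steps⇒parity p true [] (e , _) = subst (λ k → Even (k + 1)) (sym e) ∣-refl
    steps⇒parity p false ((x , l) ∷ B) (e , s) =
      subst Even (trans (cong (_+ suc (length B)) (sym e)) (sym (ℕ.+-suc (ρ p) _)))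
          (steps⇒parity (just x) _ B s)
    steps⇒parity p true ((x , l) ∷ B) (e , s) =
      subst Even (trans (cong suc (sym (ℕ.+-suc (suc (r x)) (suc (length B)))))
          (cong (_+ suc (suc (length B))) (sym e)))
        (even-+2 (steps⇒parity (just x) _ B s))

    -- The heights determine whether the direction reverses at `x`, and the parity of `l` says the
    -- same; so the bit reached after the block is the direction that the heights require.
    forced-bit : ∀ p b x l b′ q → Linkage ρ p b (just x) → Linkage ρ (just x) b′ q →
      TurnParity l (ρ p) (ρ q) → not (alternate l b) ≡ b′
    forced-bit p b x l b′ q e f (ev , od) with ρ p ℕ.≟ ρ q
    ... | yes g = trans (cong not (alternate-even l b (ev g))) (sym (¬-not (differ b b′ e f)))
      where
      differ : ∀ b b′ → Linkage ρ p b (just x) → Linkage ρ (just x) b′ q → b′ ≢ b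
      differ false false e f refl = ℕ.<⇒≢ (ℕ.m<n⇒m<1+n ℕ.≤-refl) (trans g (trans (sym f) (cong suc (sym e))))
      differ true true e f refl = ℕ.<⇒≢ (ℕ.m<n⇒m<1+n ℕ.≤-refl) (trans (sym g) (trans e (cong suc f)))
    ... | no n = trans (cong not (alternate-odd l b (od n))) (trans (not-involutive b) (same b b′ e f))
      where
      same : ∀ b b′ → Linkage ρ p b (just x) → Linkage ρ (just x) b′ q → b ≡ b′
      same false false _ _ = refl
      same true true _ _ = refl
      same false true e f = ⊥-elim (n (ℕ.suc-injective (trans e f)))
      same true false e f = ⊥-elim (n (trans e f))

    turns⇒steps : ∀ p b x l B → Linkage ρ p b (just x) → let C = (x , l) ∷ B in
      (∀ i → suc i < length C → Unit (height C i) (height C (suc i))) →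
      (∀ i → i < length C → TurnParity (Λ-of C i) (at 0 (levels p C) i) (at 0 (levels p C) (2 + i))) →
      height C (length B) ≡ 0 → Steps ρ p b C
    turns⇒steps p b x l [] e unit turn z =
      e , subst (λ b → Steps ρ (just x) b [])
            (sym (forced-bit p b x l true nothing e (cong suc z) (turn 0 (s≤s z≤n)))) (cong suc z , refl)
    turns⇒steps p b x l ((y , l′) ∷ B) e unit turn z = e , go (unit 0 (s≤s (s≤s z≤n)))
      where
      next′ : ∀ b′ → Linkage ρ (just x) b′ (just y) → Steps ρ (just x) (not (alternate l b)) ((y , l′) ∷ B)
      next′ b′ f = subst (λ b → Steps ρ (just x) b ((y , l′) ∷ B))
        (sym (forced-bit p b x l b′ (just y) e f (turn 0 (s≤s z≤n))))
        (turns⇒steps (just x) b′ y l′ B f (λ i → unit (suc i) ∘ s≤s) (λ i → turn (suc i) ∘ s≤s) z)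
      go : Unit (r x) (r y) → Steps ρ (just x) (not (alternate l b)) ((y , l′) ∷ B)
      go (inj₁ f) = next′ false (cong suc (sym f))
      go (inj₂ f) = next′ true (cong suc f)

-- From alternation to weighted Dyck paths and back

module _ {m : ℕ} where

  two-blocks : 2 ≤ m → (B : Blocks m) → (∀ x → x ∈ map proj₁ B) → 2 ≤ length B
  two-blocks (s≤s (s≤s _)) [] occurs = case occurs zero of λ ()
  two-blocks (s≤s (s≤s _)) (c ∷ []) occurs with occurs zero | occurs (suc zero)
  ... | here refl | here ()
  two-blocks _ (_ ∷ _ ∷ _) _ = s≤s (s≤s z≤n)

  module _ (B : Blocks m) (n : ℕ) (len : length B ≡ suc (2 * n)) (long : 2 ≤ length B) where

    private
      r = rank B
      e = at 0 (levels r nothing B)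

    -- Read with σ one level below the path, the two ends are never turns.
    peak⇒turn : ∀ i → IsPeak n (D-of B) i → e i ≡ e (2 + i)
    peak⇒turn (suc i) (_ , i≤ , p) =
      trans (at-levels r nothing B i (ℕ.≤-trans (ℕ.n≤1+n _) (ℕ.<⇒≤ 2+i<)))
        (trans (cong suc (ℤ.+-injective p)) (sym (at-levels r nothing B (2 + i) 2+i<)))
      where
      2+i< : 2 + i < length B
      2+i< = subst (2 + i <_) (sym len) (s≤s (subst (2 + i ≤_)
          (ℕ.suc-pred (2 * n) ⦃ >-nonZero (ℕ.≤-pred (subst (2 ≤_) len long)) ⦄) (s≤s i≤)))

    turn⇒peak : ∀ i → i ≤ 2 * n → e i ≡ e (2 + i) → IsPeak n (D-of B) i
    turn⇒peak zero _ t = case trans t (at-levels r nothing B 1 long) of λ ()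
    turn⇒peak (suc i) i≤ t with ℕ.m≤n⇒m<n∨m≡n i≤
    ... | inj₁ i< = s≤s z≤n , ℕ.<⇒≤pred i< ,
      cong +_ (ℕ.suc-injective (trans (sym (at-levels r nothing B i (ℕ.≤-trans (ℕ.n≤1+n _) (ℕ.<⇒≤ 2+i<))))
        (trans t (at-levels r nothing B (2 + i) 2+i<))))
      where
      2+i< : 2 + i < length B
      2+i< = subst (2 + i <_) (sym len) (s≤s i<)
    ... | inj₂ i≡ = case trans (sym (at-levels r nothing B i
        (subst (i <_) (sym len) (ℕ.m<n⇒m<1+n (subst (i <_) i≡ ℕ.≤-refl)))))
                      (trans t (trans (cong e (cong suc (trans (cong suc i≡) (sym len))))
                          (at-levels-end r nothing B))) of λ ()

  alternates⇒dyck : 2 ≤ m → (B : Blocks m) → TypeIIBlocks B → Alternates (body B) →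
    IsChain B × FirstIsLeast B ×
    ∃[ n ] (length B ≡ suc (2 * n) × IsEvenlyWeighted n (D-of B) (Λ-of B))
  alternates⇒dyck 2≤m [] (_ , _ , occurs , _) R = case two-blocks 2≤m [] occurs of λ ()
  alternates⇒dyck 2≤m B@((x₁ , l₁) ∷ B′) (pos , _ , occurs , _) R =
    isChain B inj cross occurs′ , first , n , len , (start-point , end-point , (λ i _ → ℤ.+≤+ z≤n) , step) ,
        weight
    where
    occurs′ : ∀ x → lt x ∈ body B
    occurs′ x = TypeII⇒∈body B pos (occurs x)
    rest = code false (body B)
    lap-code : code true (lap (body B)) ≡ (nothing , false) ∷ rest ++ (nothing , true) ∷ []
    lap-code = cong (_ ∷_) (trans (code-++ false (body B) _)
      (cong (λ a → rest ++ code a (σ ∷ [])) (alternate-even (length (body B)) false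
          (alternates⇒even (body B) (σ∉body B) R))))
    chain = alternating⇒crossing _≟M_ nothing rest (σ∉body B ∘ ∈-code⁻ false (body B))
        (subst Alternating lap-code R)
    C = proj₁ chain
    η = index _≟M_ C
    cross : Crossing η 0 (code true (lap (body B))) 0
    cross = subst (λ Z → Crossing η 0 Z 0) (sym lap-code) (proj₁ (proj₂ chain))
    inChain : ∀ p → p ∈ C
    inChain nothing = All.lookup (proj₂ (proj₂ chain)) (here refl)
    inChain (just x) = All.lookup (proj₂ (proj₂ chain))
      (subst (λ Z → just x ∈ letters Z) lap-code (∈-code⁺ true (lap (body B)) (there (∈-++⁺ˡ (occurs′ x)))))
    inj : ∀ {p q} → η p ≡ η q → p ≡ q
    inj {p} = index-injective _≟M_ (inChain p)
    bottom : η nothing ≡ 0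
    bottom = sym (proj₁ cross)
    r = rank B
    steps : Steps (level r) nothing false B
    steps = steps-map transfer refl nothing false B
      (crossing⇒steps nothing false x₁ l₁ B′ pos (proj₂ cross))
      where
      transfer : ∀ p q → η q ≡ suc (η p) → level r q ≡ suc (level r p)
      transfer p nothing f = case trans (sym bottom) f of λ ()
      transfer nothing (just y) f = cong suc (rank-zero B inj cross occurs′ bottom y
          (trans f (cong suc bottom)))
      transfer (just x) (just y) f = cong suc (rank-suc B inj cross occurs′ x y f)
    even-blocks : Even (length B′)
    even-blocks = even-∸2 (steps⇒parity r nothing false B steps)
    n = _∣_.quotient even-blocks
    len : length B ≡ suc (2 * n)
    len = cong suc (trans (_∣_.equality even-blocks) (ℕ.*-comm n 2))
    inside : ∀ {i} → i ≤ 2 * n → i < length B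
    inside {i} i≤ = subst (i <_) (sym len) (s≤s i≤)
    -- The first letter crossed after σ lies directly above it, so every alternating block form
    -- already begins with the least letter.
    first : r x₁ ≡ 0
    first = ℕ.suc-injective (sym (proj₁ steps))
    start-point : D-of B 0 ≡ (+ 0 , + 0)
    start-point = cong (λ h → + 0 , + h) first
    end-point : D-of B (2 * n) ≡ (+ (2 * n) , + 0)
    end-point = cong (λ h → + (2 * n) , + h)
      (trans (cong (height r B) (sym (ℕ.suc-injective len))) (steps⇒last r nothing false (x₁ , l₁) B′ steps))
    step : ∀ i → i < 2 * n →
      D-of B (suc i) ≡ (proj₁ (D-of B i) ℤ.+ + 1 , proj₂ (D-of B i) ℤ.+ + 1) ⊎
      D-of B (suc i) ≡ (proj₁ (D-of B i) ℤ.+ + 1 , proj₂ (D-of B i) ℤ.- + 1)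
    step i i< = Sum.map
      (λ f → cong₂ _,_ (cong +_ (ℕ.+-comm 1 i)) (cong +_ (trans f (ℕ.+-comm 1 _))))
      (λ f → cong₂ _,_ (cong +_ (ℕ.+-comm 1 i)) (cong (λ h → + h ℤ.- + 1) (sym f)))
      (steps⇒unit r nothing false B steps i (inside i<))
    turn = steps⇒turns r nothing false B steps
    positive : ∀ (B : Blocks m) → All (λ c → 1 ≤ proj₂ c) B → ∀ i → i < length B → 1 ≤ Λ-of B i
    positive (c ∷ B) (p ∷ _) zero _ = p
    positive (c ∷ B) (_ ∷ ps) (suc i) (s≤s i<) = positive B ps i i<
    long = two-blocks 2≤m B occurs
    weight : ∀ i → i ≤ 2 * n → 1 ≤ Λ-of B i × (IsPeak n (D-of B) i → Even (Λ-of B i)) ×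
        (¬ IsPeak n (D-of B) i → Odd (Λ-of B i))
    weight i i≤ = positive B pos i (inside i≤) ,
      proj₁ (turn i (inside i≤)) ∘ peak⇒turn B n len long i ,
      λ ¬p → proj₂ (turn i (inside i≤)) (¬p ∘ turn⇒peak B n len long i i≤)

  unit⁻¹ : ∀ h k → + k ≡ + h ℤ.+ + 1 ⊎ + k ≡ + h ℤ.- + 1 → k ≡ suc h ⊎ h ≡ suc k
  unit⁻¹ h k (inj₁ e) = inj₁ (trans (ℤ.+-injective e) (ℕ.+-comm h 1))
  unit⁻¹ (suc h) k (inj₂ e) = inj₂ (cong suc (sym (ℤ.+-injective e)))

  -- Now the rank itself serves as the chain, being injective because the order is a chain. Unit
  -- steps, the parities at turns and the two ends at 0 reconstruct all bits.
  dyck⇒alternates : 2 ≤ m → (B : Blocks m) → TypeIIBlocks B → IsChain B →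
    ∀ n → length B ≡ suc (2 * n) → IsEvenlyWeighted n (D-of B) (Λ-of B) → Alternates (body B)
  dyck⇒alternates 2≤m B@((x₁ , l₁) ∷ B′) (_ , _ , occurs , _) chain n len
      ((start-point , end-point , _ , step) , weight) =
    crossing⇒alternating inj (code true (lap (body B))) cross
    where
    r = rank B
    η = level r
    strict : ∀ {x y} → minDist B x < minDist B y → r x < r y
    strict {x} {y} p = filter-length-< (λ w → minDist B w <? minDist B y) (λ w → minDist B w <? minDist B x)
      (∈-allFin x) p (ℕ.<-irrefl refl) (λ q → ℕ.<-trans q p)
    inj : ∀ {p q} → η p ≡ η q → p ≡ q
    inj {nothing} {nothing} e = refl
    inj {just x} {just y} e with x Fin.≟ y
    ... | yes f = cong just f
    ... | no f with chain x y f
    ... | inj₁ p = ⊥-elim (ℕ.<⇒≢ (strict p) (ℕ.suc-injective e))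
    ... | inj₂ p = ⊥-elim (ℕ.<⇒≢ (strict p) (sym (ℕ.suc-injective e)))
    long = two-blocks 2≤m B occurs
    inside : ∀ {i} → i < length B → i ≤ 2 * n
    inside {i} i< = ℕ.≤-pred (subst (i <_) len i<)
    unit : ∀ i → suc i < length B → Unit r (height r B i) (height r B (suc i))
    unit i i< = unit⁻¹ _ _ (Sum.map (cong proj₂) (cong proj₂) (step i (inside i<)))
    turn : ∀ i → i < length B →
      TurnParity r (Λ-of B i) (at 0 (levels r nothing B) i) (at 0 (levels r nothing B) (2 + i))
    turn i i< = let _ , ev , od = weight i (inside i<) in
      ev ∘ turn⇒peak B n len long i (inside i<) , λ ne → od (ne ∘ peak⇒turn B n len long i)
    steps : Steps η nothing false B
    steps = turns⇒steps r nothing false x₁ l₁ B′ (cong suc (sym (ℤ.+-injective (cong proj₂ start-point))))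
        unit turn
      (trans (cong (height r B) (ℕ.suc-injective len)) (ℤ.+-injective (cong proj₂ end-point)))
    cross : Crossing η 0 (code true (lap (body B))) 0
    cross = refl , steps⇒crossing nothing false x₁ l₁ B′ steps

-- The rim and its inscribed cliques

nextⁿ-next : ∀ {n} k (i : Fin n) → nextⁿ k (next i) ≡ next (nextⁿ k i)
nextⁿ-next zero i = refl
nextⁿ-next (suc k) i = cong next (nextⁿ-next k i)

module _ {k : ℕ} where

  private
    n = suc k

  toℕ-next : ∀ (i : Fin n) → suc (toℕ i) < n → toℕ (next i) ≡ suc (toℕ i)
  toℕ-next i i< = trans (Fin.toℕ-fromℕ< (m%n<n (suc (toℕ i)) n)) (m<n⇒m%n≡m i<)

  next-last : ∀ (i : Fin n) → suc (toℕ i) ≡ n → next i ≡ zero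
  next-last i i≡ = Fin.toℕ-injective
    (trans (Fin.toℕ-fromℕ< (m%n<n (suc (toℕ i)) n)) (trans (cong (_% n) i≡) (n%n≡0 n)))

  toℕ-nextⁿ : ∀ j (i : Fin n) → toℕ i + j < n → toℕ (nextⁿ j i) ≡ toℕ i + j
  toℕ-nextⁿ zero i _ = sym (ℕ.+-identityʳ _)
  toℕ-nextⁿ (suc j) i i< =
    let i<′ = subst (_< n) (ℕ.+-suc (toℕ i) j) i<
        e = toℕ-nextⁿ j i (ℕ.<-trans ℕ.≤-refl i<′)
    in trans (toℕ-next (nextⁿ j i) (subst (λ a → suc a < n) (sym e) i<′))
           (trans (cong suc e) (sym (ℕ.+-suc (toℕ i) j)))

  nextⁿ-last : ∀ j (i : Fin n) → toℕ i + suc j ≡ n → nextⁿ (suc j) i ≡ zero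
  nextⁿ-last j i i≡ =
    let e = trans (sym (ℕ.+-suc (toℕ i) j)) i≡
    in next-last (nextⁿ j i) (trans (cong suc (toℕ-nextⁿ j i (subst (toℕ i + j <_) e ℕ.≤-refl))) e)

  nextⁿ-toℕ : ∀ (i : Fin n) → nextⁿ (toℕ i) zero ≡ i
  nextⁿ-toℕ i = Fin.toℕ-injective (toℕ-nextⁿ (toℕ i) zero (Fin.toℕ<n i))

  fin-complement : ∀ (i : Fin n) → ∃[ j ] toℕ i + suc j ≡ n
  fin-complement i = k ∸ toℕ i , trans (ℕ.+-suc (toℕ i) _) (cong suc (ℕ.m+[n∸m]≡n (ℕ.≤-pred (Fin.toℕ<n i))))

  nextⁿ-+ : ∀ a b (i : Fin n) → nextⁿ (a + b) i ≡ nextⁿ a (nextⁿ b i)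
  nextⁿ-+ zero b i = refl
  nextⁿ-+ (suc a) b i = cong next (nextⁿ-+ a b i)

  nextⁿ-period : ∀ (i : Fin n) → nextⁿ n i ≡ i
  nextⁿ-period i =
    let b , e = fin-complement i in
    trans (cong (λ a → nextⁿ a i) (sym e))
      (trans (nextⁿ-+ (toℕ i) (suc b) i) (trans (cong (nextⁿ (toℕ i)) (nextⁿ-last b i e)) (nextⁿ-toℕ i)))

  -- Since `n` steps lead back to the start, `nextⁿ k` undoes `next`.
  next-injective : ∀ {i j : Fin n} → next i ≡ next j → i ≡ j
  next-injective {i} {j} e =
    trans (sym (nextⁿ-period i)) (trans (sym (nextⁿ-next k i))
        (trans (cong (nextⁿ k) e) (trans (nextⁿ-next k j) (nextⁿ-period j))))

  nextⁿ≢ : ∀ j (i : Fin n) → suc j < n → nextⁿ (suc j) i ≢ i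
  nextⁿ≢ j i j< e with fin-complement i
  ... | b , b≡ with ℕ.<-≤-connex j b
  ... | inj₁ j<b = ℕ.m≢1+m+n (toℕ i) (trans (cong toℕ (sym e))
    (trans (toℕ-nextⁿ (suc j) i (subst (toℕ i + suc j <_) b≡ (ℕ.+-monoʳ-< (toℕ i) (s≤s j<b))))
        (ℕ.+-suc (toℕ i) j)))
  ... | inj₂ b≤j with ℕ.m≤n⇒∃[o]m+o≡n b≤j
  ... | c , refl = ℕ.<⇒≢ c<i (trans (sym (toℕ-nextⁿ c zero (ℕ.<-trans c<i (Fin.toℕ<n i))))
    (cong toℕ (trans (sym (trans (cong (λ a → nextⁿ (suc a) i) (ℕ.+-comm b c))
      (trans (cong (λ a → nextⁿ a i) (sym (ℕ.+-suc c b)))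
          (trans (nextⁿ-+ c (suc b) i) (cong (nextⁿ c) (nextⁿ-last b i b≡)))))) e)))
    where
    c<i : c < toℕ i
    c<i = ℕ.+-cancelˡ-< (suc b) c (toℕ i) (subst (suc (b + c) <_)
        (trans (sym b≡) (ℕ.+-comm (toℕ i) (suc b))) j<)

  next≢ : 2 ≤ n → ∀ (i : Fin n) → next i ≢ i
  next≢ 2≤n i = nextⁿ≢ 0 i 2≤n

  injective⇒surjective : ∀ {r : Fin n → Fin n} → Injective _≡_ _≡_ r → ∀ v → ∃[ i ] r i ≡ v
  injective⇒surjective {r} inj v with Fin.any? (λ i → r i Fin.≟ v)
  ... | yes p = p
  ... | no none = ⊥-elim (ℕ.1+n≰n (Fin.injective⇒≤
      {f = λ i → punchOut {i = v} {j = r i} (λ e → none (i , sym e))}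
                    (λ {i} {j} e → inj (Fin.punchOut-injective (λ e → none (i , sym e))
                        (λ e → none (j , sym e)) e))))

-- Words read along the rim

module _ {A : Set} where

  walk : ∀ {n} → (Fin n → A) → ℕ → Fin n → List A
  walk f zero i = []
  walk f (suc k) i = f i ∷ walk f k (next i)

  walk-+ : ∀ {n} (f : Fin n → A) a b i → walk f (a + b) i ≡ walk f a i ++ walk f b (nextⁿ a i)
  walk-+ f zero b i = refl
  walk-+ f (suc a) b i = cong (f i ∷_) (trans (walk-+ f a b (next i))
      (cong (λ j → walk f a (next i) ++ walk f b j) (nextⁿ-next a i)))

  length-walk : ∀ {n} (f : Fin n → A) a i → length (walk f a i) ≡ a
  length-walk f zero i = refl
  length-walk f (suc a) i = cong suc (length-walk f a (next i))

  ∈-walk : ∀ {n} (f : Fin n → A) a i {c} → c ∈ walk f a i → ∃[ j ] j < a × c ≡ f (nextⁿ j i)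
  ∈-walk f (suc a) i (here e) = 0 , s≤s z≤n , e
  ∈-walk f (suc a) i (there p) = let j , j< , e = ∈-walk f a (next i) p in suc j , s≤s j< , trans e
      (cong f (nextⁿ-next j i))

  walk-∈ : ∀ {n} (f : Fin n → A) a i s {t} → walk f a i ≡ s ++ t → ∀ j → j < length s → f (nextⁿ j i) ∈ s
  walk-∈ f (suc a) i (c ∷ s) e zero _ = here (∷-injectiveˡ e)
  walk-∈ f (suc a) i (c ∷ s) e (suc j) (s≤s j<) =
    there (subst (λ j → f j ∈ s) (nextⁿ-next j i) (walk-∈ f a (next i) s (∷-injectiveʳ e) j j<))

  walk-factor : ∀ {n} (f : Fin n → A) a i s {c t} → walk f a i ≡ s ++ c ∷ t →
    ∃[ b ] (a ≡ length s + suc b × c ≡ f (nextⁿ (length s) i) × t ≡ walk f b (next (nextⁿ (length s) i)))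
  walk-factor f (suc a) i [] e = a , refl , sym (∷-injectiveˡ e) , sym (∷-injectiveʳ e)
  walk-factor f (suc a) i (d ∷ s) e =
    let b , p , q , r = walk-factor f a (next i) s (∷-injectiveʳ e)
        sw = nextⁿ-next (length s) i
    in b , cong suc p , trans q (cong f sw) , trans r (cong (walk f b ∘ next) sw)

  walk-tabulate : ∀ {n} (f : Fin n → A) a i (g : Fin a → A) → (∀ j → f (nextⁿ (toℕ j) i) ≡ g j) → walk f a i
      ≡ tabulate g
  walk-tabulate f zero i g h = refl
  walk-tabulate f (suc a) i g h =
    cong₂ _∷_ (h zero) (walk-tabulate f a (next i) (g ∘ suc)
        (λ j → trans (cong f (nextⁿ-next (toℕ j) i)) (h (suc j))))

  walk-allFin : ∀ {k} (f : Fin (suc k) → A) → walk f (suc k) zero ≡ map f (allFin (suc k))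
  walk-allFin f = trans (walk-tabulate f _ zero f (cong f ∘ nextⁿ-toℕ)) (sym (map-tabulate id f))

  -- One step more than a full round reads the start twice, which is the form of a lap. All entries
  -- strictly between belong to other positions, so a label unique to `i` does not recur there.
  walk-round : ∀ {k} (f : Fin (suc k) → A) i → ∃₂ λ v₁ v₂ →
    map f (allFin (suc k)) ≡ v₁ ++ f i ∷ v₂ × walk f (suc (suc k)) i ≡ f i ∷ (v₂ ++ v₁) ++ f i ∷ [] ×
    (∀ {c} → c ∈ v₂ ++ v₁ → ∃[ j ] j ≢ i × c ≡ f j)
  walk-round {k} f i = walk f (toℕ i) zero , walk f b (next i) , unrolled , round , other
    where
    b = proj₁ (fin-complement i)
    b≡ = proj₂ (fin-complement i)
    open ≡-Reasoning
    unrolled : map f (allFin (suc k)) ≡ walk f (toℕ i) zero ++ f i ∷ walk f b (next i)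
    unrolled = begin
      map f (allFin (suc k))         ≡⟨ walk-allFin f ⟨
      walk f (suc k) zero            ≡⟨ cong (λ a → walk f a zero) b≡ ⟨
      walk f (toℕ i + suc b) zero    ≡⟨ walk-+ f (toℕ i) (suc b) zero ⟩
      walk f (toℕ i) zero ++ walk f (suc b) (nextⁿ (toℕ i) zero)
          ≡⟨ cong (λ j → walk f (toℕ i) zero ++ walk f (suc b) j) (nextⁿ-toℕ i) ⟩
      walk f (toℕ i) zero ++ f i ∷ walk f b (next i) ∎
    round : walk f (suc (suc k)) i ≡ f i ∷ (walk f b (next i) ++ walk f (toℕ i) zero) ++ f i ∷ []
    round = begin
      walk f (suc (suc k)) i
          ≡⟨ cong (λ a → walk f a i) (trans (ℕ.+-comm 1 (suc k))
          (trans (cong (_+ 1) (trans (sym b≡) (ℕ.+-comm (toℕ i) (suc b)))) (ℕ.+-assoc (suc b) (toℕ i) 1))) ⟩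
      walk f (suc b + (toℕ i + 1)) i             ≡⟨ walk-+ f (suc b) (toℕ i + 1) i ⟩
      walk f (suc b) i ++ walk f (toℕ i + 1) (nextⁿ (suc b) i)
        ≡⟨ cong (λ j → walk f (suc b) i ++ walk f (toℕ i + 1) j) (nextⁿ-last b i b≡) ⟩
      walk f (suc b) i ++ walk f (toℕ i + 1) zero
        ≡⟨ cong (walk f (suc b) i ++_) (trans (walk-+ f (toℕ i) 1 zero)
            (cong (λ j → walk f (toℕ i) zero ++ f j ∷ []) (nextⁿ-toℕ i))) ⟩
      walk f (suc b) i ++ walk f (toℕ i) zero ++ f i ∷ []   ≡⟨ ++-assoc (walk f (suc b) i) _ _ ⟨
      f i ∷ (walk f b (next i) ++ walk f (toℕ i) zero) ++ f i ∷ [] ∎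
    other : ∀ {c} → c ∈ walk f b (next i) ++ walk f (toℕ i) zero → ∃[ j ] j ≢ i × c ≡ f j
    other p with ∈-++⁻ (walk f b (next i)) p
    ... | inj₁ q with ∈-walk f b (next i) q
    ... | j , j< , e = nextⁿ (suc j) i ,
      (λ g → ℕ.m≢1+m+n (toℕ i) (trans (cong toℕ (sym g))
          (trans (toℕ-nextⁿ (suc j) i (subst (toℕ i + suc j <_) b≡ (ℕ.+-monoʳ-< (toℕ i) (s≤s j<))))
          (ℕ.+-suc (toℕ i) j)))) ,
      trans e (cong f (nextⁿ-next j i))
    other p | inj₂ q with ∈-walk f (toℕ i) zero q
    ... | j , j< , e = nextⁿ j zero ,
      (λ g → ℕ.<⇒≢ j< (trans (sym (toℕ-nextⁿ j zero (ℕ.<-trans j< (Fin.toℕ<n i)))) (cong toℕ g))) , e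

pair : ∀ {n} → Fin n → Fin n → Subset n
pair u v = ⁅ u ⁆ ∪ ⁅ v ⁆

∈-pair⁻ : ∀ {n} {u v w : Fin n} → w ∈ₛ pair u v → w ≡ u ⊎ w ≡ v
∈-pair⁻ {u = u} {v} i = Sum.map (x∈⁅y⁆⇒x≡y u) (x∈⁅y⁆⇒x≡y v) (x∈p∪q⁻ ⁅ u ⁆ ⁅ v ⁆ i)

∈-pairˡ : ∀ {n} (u v : Fin n) → u ∈ₛ pair u v
∈-pairˡ u v = x∈p∪q⁺ (inj₁ (x∈⁅x⁆ u))

∈-pairʳ : ∀ {n} (u v : Fin n) → v ∈ₛ pair u v
∈-pairʳ u v = x∈p∪q⁺ (inj₂ (x∈⁅x⁆ v))

pair⊆ : ∀ {n} {u v : Fin n} {A} → u ∈ₛ A → v ∈ₛ A → pair u v ⊆ₛ A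
pair⊆ p q i with ∈-pair⁻ i
... | inj₁ refl = p
... | inj₂ refl = q

∣pair∣ : ∀ {n} {u v : Fin n} → u ≢ v → ∣ pair u v ∣ ≡ 2
∣pair∣ {u = zero} {zero} n = ⊥-elim (n refl)
∣pair∣ {u = zero} {suc v} n = cong suc (trans (cong ∣_∣ (∪-identityˡ ⁅ v ⁆)) (∣⁅x⁆∣≡1 v))
∣pair∣ {u = suc u} {zero} n = cong suc (trans (cong ∣_∣ (∪-identityʳ ⁅ u ⁆)) (∣⁅x⁆∣≡1 u))
∣pair∣ {u = suc u} {suc v} n = ∣pair∣ (n ∘ cong suc)

⊆⊎∃ : ∀ {n} (A B : Subset n) → A ⊆ₛ B ⊎ ∃[ v ] (v ∈ₛ A × v ∉ₛ B)
⊆⊎∃ A B with Fin.any? (λ v → (v ∈ₛ? A) ×-dec ¬? (v ∈ₛ? B))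
... | yes p = inj₂ p
... | no none = inj₁ λ {v} v∈A → decidable-stable (v ∈ₛ? B) (λ v∉B → none (v , v∈A , v∉B))

_≟ₛ_ : ∀ {n} (A B : Subset n) → Dec (A ≡ B)
_≟ₛ_ = Vecₚ.≡-dec Bool._≟_

⊈⇒∣<∣ : ∀ {n} {A B : Subset n} → A ⊆ₛ B → ¬ (B ⊆ₛ A) → ∣ A ∣ < ∣ B ∣
⊈⇒∣<∣ {A = A} {B} A⊆B B⊈A with ⊆⊎∃ B A
... | inj₁ B⊆A = ⊥-elim (B⊈A B⊆A)
... | inj₂ w = p⊂q⇒∣p∣<∣q∣ ((λ {v} → A⊆B {v}) , w)

-- Adjacency is not assumed decidable, so maximal extensions exist only up to double negation.
maximal-extension : ∀ {n} {Adj : Rel n} d A → n ≤ d + ∣ A ∣ → IsClique Adj A →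
  (∀ M → IsMaxClique Adj M → A ⊆ₛ M → ⊥) → ⊥
maximal-extension {n} {Adj} d A n≤ clique none = none A (clique , maximal d n≤) id
  where
  maximal : ∀ d → n ≤ d + ∣ A ∣ → ∀ B → IsClique Adj B → A ⊆ₛ B → B ⊆ₛ A
  maximal d n≤ B cl A⊆B {v} with B ⊆? A
  ... | yes p = p
  maximal zero n≤ B cl A⊆B {v} | no p = ⊥-elim (ℕ.<⇒≱ (⊈⇒∣<∣ A⊆B p) (ℕ.≤-trans (∣p∣≤n B) n≤))
  maximal (suc d) n≤ B cl A⊆B {v} | no p =
    ⊥-elim (maximal-extension d B (ℕ.≤-trans (subst (n ≤_) (sym (ℕ.+-suc d ∣ A ∣)) n≤)
        (ℕ.+-monoʳ-≤ d (⊈⇒∣<∣ A⊆B p))) cl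
      (λ M max B⊆M → none M max (B⊆M ∘ A⊆B)))

Distinct₃ : ∀ {n} → Subset n → Fin n → Fin n → Fin n → Set
Distinct₃ A u v w = (u ∈ₛ A × v ∈ₛ A × w ∈ₛ A) × (v ≢ u × w ≢ u × w ≢ v)

-- Every vertex lies on an edge to its mate, so cliques with at most one vertex are not maximal;
-- size two is excluded by definition.
three-vertices : ∀ {n} {Adj : Rel n} {A} (mate : Fin n → Fin n) → (∀ u → mate u ≢ u) → Fin n →
  (∀ u → IsClique Adj (pair u (mate u))) → IsInscribed Adj A →
  ∃[ u ] ∃[ v ] ∃[ w ] Distinct₃ A u v w
three-vertices {A = A} mate mate≢ o edge ((_ , max) , size) =
  u , v , w , (u∈ , v∈ , w∈) , (v≢u ,
    (λ e → w∉ (subst (_∈ₛ pair u v) (sym e) (∈-pairˡ u v))) ,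
        (λ e → w∉ (subst (_∈ₛ pair u v) (sym e) (∈-pairʳ u v))))
  where
  nonempty : ∃[ u ] u ∈ₛ A
  nonempty with ⊆⊎∃ A ∅
  ... | inj₂ (u , u∈ , _) = u , u∈
  ... | inj₁ A⊆∅ = o , max _ (edge o) (λ i → ⊥-elim (∉⊥ (A⊆∅ i))) (∈-pairˡ o (mate o))
  u = proj₁ nonempty
  u∈ = proj₂ nonempty
  second : ∃[ v ] (v ∈ₛ A × v ≢ u)
  second with ⊆⊎∃ A ⁅ u ⁆
  ... | inj₂ (v , v∈ , v∉) = v , v∈ , λ { refl → v∉ (x∈⁅x⁆ v) }
  ... | inj₁ A⊆u = mate u ,
    max _ (edge u) (λ i → subst (_∈ₛ pair u (mate u)) (sym (x∈⁅y⁆⇒x≡y u (A⊆u i))) (∈-pairˡ u (mate u)))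
        (∈-pairʳ u (mate u)) ,
    mate≢ u
  v = proj₁ second
  v∈ = proj₁ (proj₂ second)
  v≢u = proj₂ (proj₂ second)
  third : ∃[ w ] (w ∈ₛ A × w ∉ₛ pair u v)
  third with ⊆⊎∃ A (pair u v)
  ... | inj₂ p = p
  ... | inj₁ A⊆ = ⊥-elim (size (trans (cong ∣_∣ (⊆-antisym A⊆ (pair⊆ u∈ v∈))) (∣pair∣ (v≢u ∘ sym))))
  w = proj₁ third
  w∈ = proj₁ (proj₂ third)
  w∉ = proj₂ (proj₂ third)

pigeon₃ : ∀ {n} {A} {u v w : Fin n} a b → A ≡ pair a b → ¬ Distinct₃ A u v w
pigeon₃ a b refl ((p , q , r) , (x , y , z)) with ∈-pair⁻ p | ∈-pair⁻ q | ∈-pair⁻ r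
... | inj₁ refl | inj₁ refl | _ = x refl
... | inj₁ refl | inj₂ refl | inj₁ refl = y refl
... | inj₁ refl | inj₂ refl | inj₂ refl = z refl
... | inj₂ refl | inj₂ refl | _ = x refl
... | inj₂ refl | inj₁ refl | inj₂ refl = y refl
... | inj₂ refl | inj₁ refl | inj₁ refl = z refl

-- The inscribed cliques that survive a deletion

module Deletion {m k : ℕ} {Adj : Rel (suc k)} {r : Fin (suc k) → Fin (suc k)} {K : Fin m → Subset (suc k)}
  (multisun : IsMultisun (suc k) Adj r) (labelling : IsCliqueLabelling Adj K)
  (linear : ∀ {x y u v} → u ≢ v → u ∈ₛ K x → v ∈ₛ K x → u ∈ₛ K y → v ∈ₛ K y → x ≡ y)
  (S : Subset (suc k) → Set) where

  private
    Del = deleteCliques Adj S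
    3≤n = proj₁ (proj₂ (proj₂ (proj₂ multisun)))
    r-injective = proj₁ (proj₂ (proj₂ (proj₂ (proj₂ multisun))))
    two⇒rim = proj₁ (proj₂ (proj₂ (proj₂ (proj₂ (proj₂ multisun)))))
    rim⇒max = proj₁ (proj₂ (proj₂ (proj₂ (proj₂ (proj₂ (proj₂ multisun))))))
    nonconsecutive = proj₂ (proj₂ (proj₂ (proj₂ (proj₂ (proj₂ (proj₂ multisun))))))
    position = injective⇒surjective r-injective
    mate : Fin (suc k) → Fin (suc k)
    mate u = r (next (proj₁ (position u)))

  -- Two cliques share at most one vertex, so no edge of a kept clique is deleted with another one.
  -- Maximality persists because deletion adds no edges.
  kept⇒inscribed : ∀ x → ¬ S (K x) → IsInscribed Del (K x)
  kept⇒inscribed x ¬S = (clique , λ A cl → max A (λ u v p q n → proj₁ (cl u v p q n))) , size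
    where
    inscribed = proj₁ labelling x
    max = proj₂ (proj₁ inscribed)
    size = proj₂ inscribed
    same : ∀ {u v A y} → K y ≡ A → u ≢ v → S A → u ∈ₛ A → v ∈ₛ A → u ∈ₛ K x → v ∈ₛ K x → ⊥
    same refl n SA p q p′ q′ = ¬S (subst (S ∘ K) (linear n p q p′ q′) SA)
    clique : IsClique Del (K x)
    clique u v p q n = proj₁ (proj₁ inscribed) u v p q n ,
      λ (A , SA , ins , p′ , q′) → same (proj₂ (proj₂ (proj₂ labelling) A ins)) n SA p′ q′ p q

  mate≢ : ∀ u → mate u ≢ u
  mate≢ u e = next≢ (ℕ.<⇒≤ 3≤n) _ (r-injective (trans e (sym (proj₂ (position u)))))

  not-both : ∀ i {v w B} → IsInscribed Adj B → v ≡ r i ⊎ v ≡ r (next i) → w ≡ r i ⊎ w ≡ r (next i) →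
    v ≢ w → v ∈ₛ B → w ∈ₛ B → ⊥
  not-both i ins (inj₁ refl) (inj₁ refl) n _ _ = n refl
  not-both i ins (inj₁ refl) (inj₂ refl) n p q = nonconsecutive _ ins i (p , q)
  not-both i ins (inj₂ refl) (inj₁ refl) n p q = nonconsecutive _ ins i (q , p)
  not-both i ins (inj₂ refl) (inj₂ refl) n _ _ = n refl

  rim-clique : ∀ i → IsClique Del (pair (r i) (r (next i)))
  rim-clique i v w p q v≢w = proj₁ (proj₁ (rim⇒max _ (i , refl))) v w p q v≢w ,
    λ (B , _ , ins , p′ , q′) → not-both i ins (∈-pair⁻ p) (∈-pair⁻ q) v≢w p′ q′

  mate-clique : ∀ u → IsClique Del (pair u (mate u))
  mate-clique u = subst (λ v → IsClique Del (pair v (mate u))) (proj₂ (position u))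
      (rim-clique (proj₁ (position u)))

  -- A maximal clique containing `A` in the original graph has three vertices, hence is some `K z`.
  -- An edge of `A` survives in it, so `K z` was kept and is itself a clique after deletion, whence
  -- equality. The extension exists only up to double negation, but being one of finitely many `K z`
  -- is decidable.
  distinct⇒kept : ∀ {A u v w} → IsMaxClique Del A → Distinct₃ A u v w → ∃[ z ] (A ≡ K z × ¬ S (K z))
  distinct⇒kept {A} {u} {v} {w} (cl , max) ((u∈ , v∈ , w∈) , (v≢u , distinct)) =
    let z , A≡ = found in z , A≡ , ¬S z (λ {a} → subst (a ∈ₛ_) A≡)
    where
    ¬S : ∀ z → A ⊆ₛ K z → ¬ S (K z)
    ¬S z A⊆ SK = proj₂ (cl u v u∈ v∈ (v≢u ∘ sym)) (K z , SK , proj₁ labelling z , A⊆ u∈ , A⊆ v∈)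
    inscribed : ∀ M → IsMaxClique Adj M → A ⊆ₛ M → IsInscribed Adj M
    inscribed M maxM A⊆M = maxM , λ two →
      let i , e = two⇒rim M (maxM , two) in
      pigeon₃ (r i) (r (next i)) e ((A⊆M u∈ , A⊆M v∈ , A⊆M w∈) , (v≢u , distinct))
    equal : ∀ z → A ⊆ₛ K z → A ≡ K z
    equal z A⊆ = ⊆-antisym A⊆ (max (K z) (proj₁ (proj₁ (kept⇒inscribed z (¬S z A⊆)))) A⊆)
    found : ∃[ z ] A ≡ K z
    found = decidable-stable (Fin.any? (λ z → A ≟ₛ K z)) λ none →
      maximal-extension {Adj = Adj} (suc k) A (ℕ.m≤m+n (suc k) ∣ A ∣) (λ a b p q n → proj₁ (cl a b p q n))
        λ M maxM A⊆M →
          let z , Kz≡M = proj₂ (proj₂ labelling) M (inscribed M maxM A⊆M)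
          in none (z , equal z (λ {a} i → subst (a ∈ₛ_) (sym Kz≡M) (A⊆M i)))

  inscribed⇒kept : ∀ {A} → IsInscribed Del A → ∃[ z ] (A ≡ K z × ¬ S (K z))
  inscribed⇒kept ins =
    let _ , _ , _ , distinct = three-vertices mate mate≢ zero mate-clique ins
    in distinct⇒kept (proj₁ ins) distinct

module _ {m n : ℕ} {K : Fin m → Subset n} where

  private
    ∈-members : ∀ {v x} → v ∈ₛ K x → x ∈ filter (λ x → v ∈ₛ? K x) (allFin m)
    ∈-members {v} {x} p = ∈-filter⁺ (λ x → v ∈ₛ? K x) (∈-allFin x) p

    members-∈ : ∀ {v x} → x ∈ filter (λ x → v ∈ₛ? K x) (allFin m) → v ∈ₛ K x
    members-∈ {v} i = proj₂ (∈-filter⁻ (λ x → v ∈ₛ? K x) {xs = allFin m} i)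

    members-unique : ∀ v → Unique (filter (λ x → v ∈ₛ? K x) (allFin m))
    members-unique v = Uniqueₚ.filter⁺ (λ x → v ∈ₛ? K x) (Uniqueₚ.allFin⁺ m)

  label-σ : ∀ {v x y} → x ≢ y → v ∈ₛ K x → v ∈ₛ K y → label K v ≡ σ
  label-σ {v} n p q with filter (λ x → v ∈ₛ? K x) (allFin m) | ∈-members p | ∈-members q
  ... | _ ∷ [] | here refl | here refl = ⊥-elim (n refl)
  ... | _ ∷ _ ∷ _ | _ | _ = refl

  label-lt : ∀ {v x} → v ∈ₛ K x → (∀ {y} → v ∈ₛ K y → y ≡ x) → label K v ≡ lt x
  label-lt {v} {x} p only with filter (λ x → v ∈ₛ? K x) (allFin m) in eq | ∈-members p | members-unique v
  ... | y ∷ [] | here refl | _ = refl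
  ... | y ∷ z ∷ _ | _ | (n ∷ _) ∷ _ =
    ⊥-elim (n (trans (only (members-∈ (subst (y ∈_) (sym eq) (here refl))))
               (sym (only (members-∈ (subst (z ∈_) (sym eq) (there (here refl))))))))

  label-ε : ∀ {v} → (∀ x → v ∉ₛ K x) → label K v ≡ ε
  label-ε {v} none with filter (λ x → v ∈ₛ? K x) (allFin m) in eq
  ... | [] = refl
  ... | y ∷ [] = ⊥-elim (none y (members-∈ (subst (y ∈_) (sym eq) (here refl))))
  ... | y ∷ _ ∷ _ = ⊥-elim (none y (members-∈ (subst (y ∈_) (sym eq) (here refl))))

-- The code of a sunoid

two-letters : ∀ {m} → 2 ≤ m → ∃₂ λ (x y : Fin m) → x ≢ y
two-letters (s≤s (s≤s _)) = zero , suc zero , λ ()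

module _ {m : ℕ} where

  lap-σ : ∀ {u : Word m} → σ ∉ u → ∀ s t → lap u ≡ s ++ σ ∷ t → s ≡ [] ⊎ t ≡ []
  lap-σ n [] t e = inj₁ refl
  lap-σ {u} n (c ∷ s) t e = inj₂ (ends u s n (∷-injectiveʳ e))
    where
    ends : ∀ u s → σ ∉ u → u ++ σ ∷ [] ≡ s ++ σ ∷ t → t ≡ []
    ends [] [] n e = sym (∷-injectiveʳ e)
    ends [] (d ∷ []) n e = case ∷-injectiveʳ e of λ ()
    ends [] (d ∷ _ ∷ _) n e = case ∷-injectiveʳ e of λ ()
    ends (d ∷ u) [] n e = ⊥-elim (n (here (sym (∷-injectiveˡ e))))
    ends (d ∷ u) (d′ ∷ s) n e = ends u s (n ∘ there) (∷-injectiveʳ e)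

  lap-interior : ∀ {u : Word m} → σ ∉ u → ∀ s c g d t → lap u ≡ s ++ c ∷ g ++ d ∷ t → σ ∉ g
  lap-interior n s c g d t e i with ∈-∃++ i
  ... | g₁ , g₂ , refl with lap-σ n (s ++ c ∷ g₁) (g₂ ++ d ∷ t)
         (trans e (trans (cong (λ w → s ++ c ∷ w) (++-assoc g₁ _ _)) (sym (++-assoc s (c ∷ g₁) _))))
  ... | inj₁ f = case ++-conicalʳ s (c ∷ g₁) f of λ ()
  ... | inj₂ f = case ++-conicalʳ g₂ (d ∷ t) f of λ ()

module _ {m k : ℕ} {Adj : Rel (suc k)} {r : Fin (suc k) → Fin (suc k)} {K : Fin m → Subset (suc k)}
  (2≤m : 2 ≤ m) (sunoid : IsSunoid (suc k) Adj r) (labelling : IsCliqueLabelling Adj K) where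

  private
    n = suc k
    multisun = proj₁ sunoid
    common = proj₁ (proj₂ (proj₂ (proj₁ (proj₂ sunoid))))
    ξ = proj₁ common
    ξ∈ : ∀ x → ξ ∈ₛ K x
    ξ∈ x = proj₁ (proj₂ common) (K x) (proj₁ labelling x)
    r-injective = proj₁ (proj₂ (proj₂ (proj₂ (proj₂ multisun))))
    odd-n = proj₁ (proj₂ (proj₂ multisun))

    share-ξ : ∀ {x y v} → x ≢ y → v ∈ₛ K x → v ∈ₛ K y → v ≡ ξ
    share-ξ {x} {y} x≢y p q = proj₁ (proj₂ (proj₂ common)) (K x) (K y) (proj₁ labelling x) (proj₁ labelling y)
      (x≢y ∘ proj₁ (proj₂ labelling)) _ p q

    linear : ∀ {x y u v} → u ≢ v → u ∈ₛ K x → v ∈ₛ K x → u ∈ₛ K y → v ∈ₛ K y → x ≡ y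
    linear {x} {y} u≢v p q p′ q′ with x Fin.≟ y
    ... | yes e = e
    ... | no x≢y = ⊥-elim (u≢v (trans (share-ξ x≢y p p′) (sym (share-ξ x≢y q q′))))

    label-ξ : label K ξ ≡ σ
    label-ξ = let x , y , x≢y = two-letters 2≤m in label-σ {K = K} x≢y (ξ∈ x) (ξ∈ y)

    label-member : ∀ {v x} → v ≢ ξ → v ∈ₛ K x → label K v ≡ lt x
    label-member {v} {x} v≢ξ p = label-lt {K = K} p λ {y} q → decidable-stable (y Fin.≟ x)
        (λ y≢x → v≢ξ (share-ξ y≢x q p))

    data Role (v : Fin n) : Set where
      centre : v ≡ ξ → Role v
      member : ∀ x → v ≢ ξ → v ∈ₛ K x → Role v
      outer  : (∀ x → v ∉ₛ K x) → Role v

    role : ∀ v → Role v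
    role v with v Fin.≟ ξ | Fin.any? (λ x → v ∈ₛ? K x)
    ... | yes e | _ = centre e
    ... | no v≢ξ | yes (x , p) = member x v≢ξ p
    ... | no _ | no none = outer λ x p → none (x , p)

    σ⇒ξ : ∀ {v} → label K v ≡ σ → v ≡ ξ
    σ⇒ξ {v} e with role v
    ... | centre f = f
    ... | member x v≢ξ p = case trans (sym e) (label-member v≢ξ p) of λ ()
    ... | outer none = case trans (sym e) (label-ε {K = K} none) of λ ()

    lt⇒∈ : ∀ {v x} → label K v ≡ lt x → v ∈ₛ K x × v ≢ ξ
    lt⇒∈ {v} e with role v
    ... | centre refl = case trans (sym e) label-ξ of λ ()
    ... | outer none = case trans (sym e) (label-ε {K = K} none) of λ ()
    ... | member y v≢ξ p with trans (sym e) (label-member v≢ξ p)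
    ... | refl = p , v≢ξ

    ∈⇒label : ∀ {v x} → v ∈ₛ K x → label K v ≡ σ ⊎ label K v ≡ lt x
    ∈⇒label {v} p with v Fin.≟ ξ
    ... | yes refl = inj₁ label-ξ
    ... | no v≢ξ = inj₂ (label-member v≢ξ p)

    f : Fin n → Letter m
    f = label K ∘ r

    -- The deletion that leaves just the cliques of `x` and `y`, and a single clique when `x` and
    -- `y` coincide.
    Others : Fin m → Fin m → Subset n → Set
    Others x y A = A ≢ K x × A ≢ K y

    module _ (x y : Fin m) where
      module D = Deletion {K = K} multisun labelling (λ {x} {y} → linear {x} {y}) (Others x y)
      Del = deleteCliques Adj (Others x y)
      keepˡ : IsInscribed Del (K x)
      keepˡ = D.kept⇒inscribed x (λ (n , _) → n refl)
      keepʳ : IsInscribed Del (K y)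
      keepʳ = D.kept⇒inscribed y (λ (_ , n) → n refl)
      conditions : NConditions Del r
      conditions = proj₂ (proj₂ sunoid) (Others x y) (K x , proj₁ labelling x , λ (n , _) → n refl)
      avoid : ∀ {v A} → IsInscribed Del A → label K v ≢ σ → label K v ≢ lt x → label K v ≢ lt y → v ∉ₛ A
      avoid {v} {A} ins nσ nx ny i =
        let z , A≡ , kept = D.inscribed⇒kept ins in
        Sum.[ nσ , (λ e → kept ((λ K≡ → nx (trans e (cong lt (proj₁ (proj₂ labelling) K≡)))) ,
                                (λ K≡ → ny (trans e (cong lt (proj₁ (proj₂ labelling) K≡)))))) ]′
          (∈⇒label (subst (v ∈ₛ_) A≡ i))

    -- With `K x` as the only clique left, the common vertex is one of its ordinary vertices. N1
    -- then covers the gaps between two x as well as those between x and σ.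
    same-gap : ∀ x i g → suc (length g) < n → r i ∈ₛ K x → r (nextⁿ (suc (length g)) i) ∈ₛ K x →
      (∀ j → j < length g → f (nextⁿ (suc j) i) ∈ g) → σ ∉ g → lt x ∉ g → Even (length g)
    same-gap x i g L< p q inside σ∉ x∉ =
      even-∸2 (proj₁ (proj₁ (conditions x x) (K x) (keepˡ x x) (suc (length g))
          (s≤s z≤n , L< , i , p , q , interior)))
      where
      interior : ∀ j → 1 ≤ j → j < suc (length g) → ∀ A → IsInscribed (Del x x) A → r (nextⁿ j i) ∉ₛ A
      interior (suc j) _ (s≤s j<) A ins =
        let c∈ = inside j j<
            nx = λ e → x∉ (subst (_∈ g) e c∈)
        in avoid x x ins (λ e → σ∉ (subst (_∈ g) e c∈)) nx nx

    different-gap : ∀ {x y} i g → x ≢ y → suc (length g) < n → f i ≡ lt x → f (nextⁿ (suc (length g)) i) ≡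
        lt y →
      (∀ j → j < length g → f (nextⁿ (suc j) i) ∈ g) → σ ∉ g → lt x ∉ g → lt y ∉ g → Odd (length g)
    different-gap {x} {y} i g x≢y L< p q inside σ∉ x∉ y∉ ev =
      proj₂ (proj₂ (proj₂ (conditions x y))) (K x) (K y) (keepˡ x y) (keepʳ x y)
          (x≢y ∘ proj₁ (proj₂ labelling)) (suc (length g))
        -- N5 wants each end outside the other clique: a vertex of both would be the common one,
        -- whose label is σ.
        (s≤s z≤n , L< , i , (proj₁ px , λ i → proj₂ px (share-ξ x≢y (proj₁ px) i)) ,
          (proj₁ qy , λ i → proj₂ qy (share-ξ x≢y i (proj₁ qy))) , interior)
        (even-+2 ev)
      where
      px = lt⇒∈ p
      qy = lt⇒∈ q
      interior : ∀ j → 1 ≤ j → j < suc (length g) → ∀ A → IsInscribed (Del x y) A → r (nextⁿ j i) ∉ₛ A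
      interior (suc j) _ (s≤s j<) A ins =
        let c∈ = inside j j< in
        avoid x y ins (λ e → σ∉ (subst (_∈ g) e c∈)) (λ e → x∉ (subst (_∈ g) e c∈))
            (λ e → y∉ (subst (_∈ g) e c∈))

    module Round (i₀ : Fin n) (u : Word m) (round : walk f (suc n) i₀ ≡ lap u)
        (σ∉u : σ ∉ u) where

      length-u : suc (length u) ≡ n
      length-u = ℕ.suc-injective (trans (cong suc (trans (ℕ.+-comm 1 (length u)) (sym (length-++ u))))
        (trans (cong length (sym round)) (length-walk f (suc n) i₀)))

      -- A rim path must not close up. Only the gap from σ to σ uses both ends of the lap; any other
      -- misses at least one of them.
      short : ∀ s (p : Mark {m}) g q t → lap u ≡ s ++ ⌜ p ⌝ ∷ g ++ ⌜ q ⌝ ∷ t → p ≢ nothing ⊎ q ≢ nothing →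
          suc (length g) < n
      short s p g q t e neither = ℕ.≤-pred (subst (suc (suc (suc (length g))) ≤_) len (go s t e neither))
        where
        total = length s + suc (length g + suc (length t))
        len : total ≡ suc n
        len = trans (sym (trans (length-++ s) (cong (λ a → length s + suc a) (length-++ g))))
            (trans (cong length (sym e)) (trans (cong length (sym round)) (length-walk f (suc n) i₀)))
        opening : ∀ {p : Mark {m}} {w} → lap u ≡ ⌜ p ⌝ ∷ w → p ≡ nothing
        opening {nothing} e = refl
        opening {just x} e = case ∷-injectiveˡ e of λ ()
        closing : ∀ u p g q → u ++ σ ∷ [] ≡ g ++ ⌜ q ⌝ ∷ [] → q ≡ nothing {A = Fin m}
        closing u p g q e = ⌜⌝-injective (sym (∷ʳ-injectiveʳ u g e))
        go : ∀ s t → lap u ≡ s ++ ⌜ p ⌝ ∷ g ++ ⌜ q ⌝ ∷ t → p ≢ nothing ⊎ q ≢ nothing →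
          suc (suc (suc (length g))) ≤ length s + suc (length g + suc (length t))
        go [] [] e (inj₁ n) = ⊥-elim (n (opening e))
        go [] [] e (inj₂ n) = ⊥-elim (n (closing u p g q (∷-injectiveʳ e)))
        go [] (c ∷ t) e _ = s≤s (subst (suc (suc (length g)) ≤_)
            (trans (cong suc (sym (ℕ.+-suc (length g) _))) (sym (ℕ.+-suc (length g) _)))
            (s≤s (s≤s (ℕ.m≤m+n (length g) (length t)))))
        go (c ∷ s) t e _ = s≤s (ℕ.≤-trans (s≤s
            (subst (suc (length g) ≤_) (sym (ℕ.+-suc (length g) (length t)))
            (s≤s (ℕ.m≤m+n (length g) (length t))))) (ℕ.m≤n+m _ (length s)))

      gap : Gap (lap u)
      gap s p g q t e p∉ q∉ = conclude p q refl refl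
        where
        walked = walk-factor f (suc n) i₀ s (trans round e)
        i = nextⁿ (length s) i₀
        p≡ : ⌜ p ⌝ ≡ f i
        p≡ = proj₁ (proj₂ (proj₂ walked))
        b = proj₁ walked
        rest = sym (proj₂ (proj₂ (proj₂ walked)))
        q≡ : ⌜ q ⌝ ≡ f (nextⁿ (suc (length g)) i)
        q≡ = trans (proj₁ (proj₂ (proj₂ (walk-factor f b (next i) g rest)))) (cong f (nextⁿ-next (length g) i))
        inside : ∀ j → j < length g → f (nextⁿ (suc j) i) ∈ g
        inside j j< = subst (λ i → f i ∈ g) (nextⁿ-next j i) (walk-∈ f b (next i) g rest j j<)
        σ∉g = lap-interior σ∉u s ⌜ p ⌝ g ⌜ q ⌝ t e
        on-σ : ∀ x {i} → σ ≡ f i → r i ∈ₛ K x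
        on-σ x eq = subst (_∈ₛ K x) (sym (σ⇒ξ (sym eq))) (ξ∈ x)
        conclude : ∀ p′ q′ → p ≡ p′ → q ≡ q′ → GapParity p′ q′ (length g)
        conclude (just x) (just y) refl refl =
          (λ { refl → same-gap x i g L< (proj₁ (lt⇒∈ (sym p≡))) (proj₁ (lt⇒∈ (sym q≡))) inside σ∉g p∉ }) ,
          (λ x≢y → different-gap i g x≢y L< (sym p≡) (sym q≡) inside σ∉g p∉ q∉)
          where L< = short s p g q t e (inj₁ λ ())
        conclude (just x) nothing refl refl =
          same-gap x i g (short s p g q t e (inj₁ λ ())) (proj₁ (lt⇒∈ (sym p≡))) (on-σ x q≡) inside σ∉g p∉
        conclude nothing (just y) refl refl =
          same-gap y i g (short s p g q t e (inj₂ λ ())) (on-σ y p≡) (proj₁ (lt⇒∈ (sym q≡))) inside σ∉g q∉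
        conclude nothing nothing refl refl with lap-σ σ∉u s (g ++ σ ∷ t) e
        ... | inj₂ g≡ = case ++-conicalʳ g (σ ∷ t) g≡ of λ ()
        ... | inj₁ refl with lap-σ σ∉u (σ ∷ g) t e
        ... | inj₁ ()
        -- Between the two ends of the lap no path is available; the parity is that of the odd order
        -- minus one.
        ... | inj₂ refl = subst Even (cong length (∷ʳ-injectiveˡ u g (∷-injectiveʳ e)))
            (suc-odd (length u) (subst Odd (sym length-u) odd-n))

  sunoid⇒alternates : ∃[ u ] ∃[ v ] (wG K r ≡ u ++ σ ∷ v × σ ∉ v ++ u × Alternates (v ++ u))
  sunoid⇒alternates =
    let i₀ , r-i₀ = injective⇒surjective r-injective ξ
        σ≡ : f i₀ ≡ σ
        σ≡ = trans (cong (label K) r-i₀) label-ξ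
        u , v , unrolled , round , other = walk-round f i₀
        σ∉ : σ ∉ v ++ u
        σ∉ = λ i → let j , j≢ , e = other i in j≢ (r-injective (trans (σ⇒ξ (sym e)) (sym r-i₀)))
        module R = Round i₀ (v ++ u) (trans round (cong (λ c → c ∷ (v ++ u) ++ c ∷ []) σ≡)) σ∉
    in u , v , trans unrolled (cong (λ c → u ++ c ∷ v) σ≡) , σ∉ , gap⇒alternating true (lap (v ++ u)) R.gap

-- The sunoid of an alternating word

module _ {m : ℕ} where

  spread′-head : ∀ (c : Letter m) w → ∃[ t ] spread′ c w ≡ c ∷ t
  spread′-head c [] = [] , refl
  spread′-head ε (d ∷ w) = _ , refl
  spread′-head σ (d ∷ w) = _ , refl
  spread′-head (lt x) (d ∷ w) with lt x ≟L d
  ... | yes _ = _ , refl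
  ... | no _ = _ , refl

  π-spread′ : ∀ (c : Letter m) w v → π (spread′ c w ++ v) ≡ π (c ∷ w ++ v)
  π-spread′ c [] v = refl
  π-spread′ ε (ε ∷ []) v = refl
  π-spread′ ε (ε ∷ d ∷ w) v = π-spread′ d w v
  -- After an ε, `π` inspects the following symbol, so the head of the spread word has to be exposed
  -- before it reduces.
  π-spread′ ε (σ ∷ w) v with spread′ σ w | spread′-head σ w | π-spread′ σ w v
  ... | _ | t , refl | e = cong (ε ∷_) e
  π-spread′ ε (lt x ∷ w) v with spread′ (lt x) w | spread′-head (lt x) w | π-spread′ (lt x) w v
  ... | _ | t , refl | e = cong (ε ∷_) e
  π-spread′ σ (d ∷ w) v = cong (σ ∷_) (π-spread′ d w v)
  π-spread′ (lt x) (d ∷ w) v with lt x ≟L d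
  ... | yes _ = cong (lt x ∷_) (π-spread′ d w v)
  ... | no _ = cong (lt x ∷_) (π-spread′ d w v)

  π-spread : ∀ (w v : Word m) → π (spread w ++ v) ≡ π (w ++ v)
  π-spread [] v = refl
  π-spread (c ∷ w) v = π-spread′ c w v

  π-εε : ∀ (w : Word m) → π (w ++ ε ∷ ε ∷ []) ≡ π w
  π-εε [] = refl
  π-εε (ε ∷ []) = refl
  π-εε (ε ∷ ε ∷ w) = π-εε w
  π-εε (ε ∷ σ ∷ w) = cong (λ w → ε ∷ σ ∷ w) (π-εε w)
  π-εε (ε ∷ lt x ∷ w) = cong (λ w → ε ∷ lt x ∷ w) (π-εε w)
  π-εε (σ ∷ w) = cong (σ ∷_) (π-εε w)
  π-εε (lt x ∷ w) = cong (lt x ∷_) (π-εε w)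

  π-vWord : ∀ B → π (vWord {m} B) ≡ π (blockWord B)
  π-vWord B = cong (σ ∷_) (trans (π-spread (body B) _) (π-εε (body B)))

  -- Nonconsecutive clique vertices require an ε in every adjacent pair of labels. In the body of a
  -- block word the only adjacent marks are equal letters, exactly the pairs that `spread`
  -- separates.
  Sparse Repetitive : Letter m → Letter m → Set
  Sparse c d = c ≡ ε ⊎ d ≡ ε
  Repetitive c d = Sparse c d ⊎ ∃[ x ] (c ≡ lt x × d ≡ lt x)

  repetitive-pow : ∀ x l {w : Word m} → Linked Repetitive w → w ≡ [] ⊎ ∃[ t ] w ≡ ε ∷ t →
    Linked Repetitive (pow (x , l) ++ w)
  repetitive-pow x zero r h = r
  repetitive-pow x (suc zero) r (inj₁ refl) = [-]
  repetitive-pow x (suc zero) r (inj₂ (t , refl)) = inj₁ (inj₂ refl) ∷ r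
  repetitive-pow x (suc (suc l)) r h = inj₂ (x , refl , refl) ∷ repetitive-pow x (suc l) r h

  repetitive-ε : ∀ {w : Word m} → Linked Repetitive w → Linked Repetitive (ε ∷ w)
  repetitive-ε {[]} r = [-]
  repetitive-ε {c ∷ w} r = inj₁ (inj₁ refl) ∷ r

  repetitive-body : ∀ (B : Blocks m) → Linked Repetitive (body B)
  repetitive-body [] = []
  repetitive-body ((x , l) ∷ []) = subst (Linked Repetitive) (++-identityʳ _)
      (repetitive-pow x l [] (inj₁ refl))
  repetitive-body ((x , l) ∷ c ∷ B) = repetitive-pow x l (repetitive-ε (repetitive-body (c ∷ B)))
      (inj₂ (_ , refl))

  sparse-spread′ : ∀ b (c : Letter m) w {t} → Sparse b c → Linked Repetitive (c ∷ w) → Linked Sparse (ε ∷ t) →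
    Linked Sparse (b ∷ spread′ c w ++ ε ∷ t)
  sparse-spread′ b c [] s r q = s ∷ inj₂ refl ∷ q
  sparse-spread′ b ε (d ∷ w) s (_ ∷ r) q = s ∷ sparse-spread′ ε d w (inj₁ refl) r q
  sparse-spread′ b σ (d ∷ w) s (inj₁ (inj₂ refl) ∷ r) q = s ∷ sparse-spread′ σ ε w (inj₂ refl) r q
  sparse-spread′ b (lt x) (d ∷ w) s (p ∷ r) q with lt x ≟L d
  ... | yes _ = s ∷ inj₂ refl ∷ inj₁ refl ∷ sparse-spread′ ε d w (inj₁ refl) r q
  ... | no n with p
  ... | inj₁ s′ = s ∷ sparse-spread′ (lt x) d w s′ r q
  ... | inj₂ (_ , refl , refl) = ⊥-elim (n refl)

  sparse-lap : ∀ B → Linked Sparse (lap (vTail {m} B))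
  sparse-lap B = inj₂ refl ∷ inj₁ refl ∷
    subst (Linked Sparse) (cong (ε ∷_) (sym (++-assoc (spread (body B)) _ _))) (go (body B) (repetitive-body B))
    where
    closing : Linked Sparse (ε ∷ ε ∷ σ ∷ [])
    closing = inj₁ refl ∷ inj₁ refl ∷ [-]
    go : ∀ w → Linked Repetitive w → Linked Sparse (ε ∷ spread w ++ ε ∷ ε ∷ σ ∷ [])
    go [] r = inj₁ refl ∷ closing
    go (c ∷ w) r = sparse-spread′ ε c w (inj₁ refl) r closing

  linked-walk : ∀ {R : Letter m → Letter m → Set} {n} (f : Fin n → Letter m) a i → Linked R (walk f (suc a) i) →
    ∀ j → j < a → R (f (nextⁿ j i)) (f (nextⁿ (suc j) i))
  linked-walk f (suc a) i (p ∷ l) zero _ = p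
  linked-walk {R} f (suc a) i (p ∷ l) (suc j) (s≤s j<) =
    subst₂ (λ u v → R (f u) (f v)) (nextⁿ-next j i) (nextⁿ-next (suc j) i) (linked-walk f a (next i) l j j<)

  inK : Fin m → Letter m → Bool
  inK x ε = false
  inK x σ = true
  inK x (lt y) = does (y Fin.≟ x)

  inK⁻ : ∀ x c → inK x c ≡ true → c ≡ σ ⊎ c ≡ lt x
  inK⁻ x σ _ = inj₁ refl
  inK⁻ x (lt y) e with y Fin.≟ x
  ... | yes refl = inj₂ refl

  inK-lt : ∀ x → inK x (lt x) ≡ true
  inK-lt x = dec-true (x Fin.≟ x) refl

  count-in : Fin m → Word m → ℕ
  count-in x [] = 0
  count-in x (c ∷ w) = (if inK x c then 1 else 0) + count-in x w

  count-in-++ : ∀ x u v → count-in x (u ++ v) ≡ count-in x u + count-in x v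
  count-in-++ x [] v = refl
  count-in-++ x (c ∷ u) v = trans (cong (λ a → _ + a) (count-in-++ x u v))
      (sym (ℕ.+-assoc (if inK x c then 1 else 0) _ _))

  count-in-spread′ : ∀ x c w → count-in x (spread′ c w) ≡ count-in x (c ∷ w)
  count-in-spread′ x c [] = refl
  count-in-spread′ x ε (d ∷ w) = count-in-spread′ x d w
  count-in-spread′ x σ (d ∷ w) = cong suc (count-in-spread′ x d w)
  count-in-spread′ x (lt y) (d ∷ w) with lt y ≟L d
  ... | yes _ = cong (λ a → _ + a) (count-in-spread′ x d w)
  ... | no _ = cong (λ a → _ + a) (count-in-spread′ x d w)

  count-in-spread : ∀ x w → count-in x (spread w) ≡ count-in x w
  count-in-spread x [] = refl
  count-in-spread x (c ∷ w) = count-in-spread′ x c w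

  count-in-body : ∀ x B → count-in x (body B) ≡ expSum x B
  count-in-body x B = go B
    where
    power : ∀ y l → count-in x (pow (y , l)) ≡ (if does (y Fin.≟ x) then l else 0)
    power y zero with y Fin.≟ x
    ... | yes _ = refl
    ... | no _ = refl
    power y (suc l) with y Fin.≟ x | power y l
    ... | yes _ | e = cong suc e
    ... | no _ | e = e
    expSum-∷ : ∀ y l B → expSum x ((y , l) ∷ B) ≡ (if does (y Fin.≟ x) then l else 0) + expSum x B
    expSum-∷ y l B with y Fin.≟ x
    ... | yes _ = refl
    ... | no _ = refl
    go : ∀ B → count-in x (body B) ≡ expSum x B
    go [] = refl
    go ((y , l) ∷ []) = trans (power y l) (sym (trans (expSum-∷ y l []) (ℕ.+-identityʳ _)))
    go ((y , l) ∷ c ∷ B) = trans (count-in-++ x (pow (y , l)) (ε ∷ body (c ∷ B)))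
      (trans (cong₂ _+_ (power y l) (go (c ∷ B))) (sym (expSum-∷ y l (c ∷ B))))

  ∣tabulate∣ : ∀ x w → ∣ Vec.tabulate (inK x ∘ lookup w) ∣ ≡ count-in x w
  ∣tabulate∣ x [] = refl
  ∣tabulate∣ x (c ∷ w) with inK x c
  ... | true = cong suc (∣tabulate∣ x w)
  ... | false = ∣tabulate∣ x w

-- The graph on the positions of a cyclic word, with one clique per letter

module Construction {m k : ℕ} (2≤m : 2 ≤ m) (f : Fin (suc k) → Letter m) (u₀ : Word m)
  (tour : walk f (suc (suc k)) zero ≡ lap u₀) (5≤n : 5 ≤ suc k) (odd-n : Odd (suc k))
  (σ⇒zero : ∀ {i} → f i ≡ σ → i ≡ zero) (gap : Gap (lap u₀)) (sparse-tour : Linked Sparse (lap u₀))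
  (odd-size : ∀ x → Odd ∣ Vec.tabulate (inK x ∘ f) ∣) (another : ∀ x → ∃[ i ] f i ≡ lt x) where

  private
    n = suc k

  inscribed : Fin m → Subset n
  inscribed x = Vec.tabulate (inK x ∘ f)

  private
    K = inscribed

  f-zero : f zero ≡ σ
  f-zero = ∷-injectiveˡ tour

  ∈K⁺ : ∀ {i x} → inK x (f i) ≡ true → i ∈ₛ K x
  ∈K⁺ {i} {x} e = Vecₚ.lookup⇒[]= i (K x) (trans (Vecₚ.lookup∘tabulate (inK x ∘ f) i) e)

  ∈K⁻ : ∀ {i x} → i ∈ₛ K x → f i ≡ σ ⊎ f i ≡ lt x
  ∈K⁻ {i} {x} p = inK⁻ x (f i) (trans (sym (Vecₚ.lookup∘tabulate (inK x ∘ f) i)) (Vecₚ.[]=⇒lookup p))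

  lt⇒∈K : ∀ {i x} → f i ≡ lt x → i ∈ₛ K x
  lt⇒∈K {x = x} e = ∈K⁺ (trans (cong (inK x) e) (inK-lt x))

  σ⇒∈K : ∀ {i} x → f i ≡ σ → i ∈ₛ K x
  σ⇒∈K x e = ∈K⁺ (cong (inK x) e)

  ∈K-lt : ∀ {i x y} → f i ≡ lt x → i ∈ₛ K y → x ≡ y
  ∈K-lt e p with ∈K⁻ p
  ... | inj₁ g = case trans (sym e) g of λ ()
  ... | inj₂ g with trans (sym e) g
  ... | refl = refl

  ε∉K : ∀ {i x} → f i ≡ ε → i ∉ₛ K x
  ε∉K e p with ∈K⁻ p
  ... | inj₁ g = case trans (sym e) g of λ ()
  ... | inj₂ g = case trans (sym e) g of λ ()

  linear : ∀ {x y u w} → u ≢ w → u ∈ₛ K x → w ∈ₛ K x → u ∈ₛ K y → w ∈ₛ K y → x ≡ y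
  linear u≢w p q p′ q′ with ∈K⁻ p | ∈K⁻ q
  ... | inj₁ e | inj₁ g = ⊥-elim (u≢w (trans (σ⇒zero e) (sym (σ⇒zero g))))
  ... | inj₂ e | _ = ∈K-lt e p′
  ... | inj₁ _ | inj₂ g = ∈K-lt g q′

  sparse : ∀ i → f i ≡ ε ⊎ f (next i) ≡ ε
  sparse i = subst (λ i → Sparse (f i) (f (next i))) (nextⁿ-toℕ i)
    (linked-walk f n zero (subst (Linked Sparse) (sym tour) sparse-tour) (toℕ i) (Fin.toℕ<n i))

  -- A rim path avoiding σ inside does not pass vertex zero, hence occurs in the word lap.
  path-gap : ∀ p q i l → suc l < n → f i ≡ ⌜ p ⌝ → f (nextⁿ (suc l) i) ≡ ⌜ q ⌝ →
    (∀ j → 1 ≤ j → j < suc l → f (nextⁿ j i) ≢ σ × f (nextⁿ j i) ≢ ⌜ p ⌝ × f (nextⁿ j i) ≢ ⌜ q ⌝) →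
    GapParity p q l
  path-gap p q i l l< p≡ q≡ inside =
    subst (GapParity p q) (length-walk f l (next i))
      (gap (walk f (toℕ i) zero) p (walk f l (next i)) q (walk f b (next (nextⁿ (suc l) i))) eq
        (λ i∈ → avoid (proj₁ ∘ proj₂) i∈) (λ i∈ → avoid (proj₂ ∘ proj₂) i∈))
    where
    avoid : ∀ {c} → (∀ {j} → f (nextⁿ j i) ≢ σ × f (nextⁿ j i) ≢ ⌜ p ⌝ × f (nextⁿ j i) ≢ ⌜ q ⌝ → f
        (nextⁿ j i) ≢ c) →
      c ∉ walk f l (next i)
    avoid choose i∈ =
      let j , j< , e = ∈-walk f l (next i) i∈
      in choose {suc j} (inside (suc j) (s≤s z≤n) (s≤s j<)) (trans (cong f (sym (nextⁿ-next j i))) (sym e))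
    fits : toℕ i + suc l ≤ n
    fits with toℕ i + suc l ℕ.≤? n
    ... | yes p = p
    ... | no ≰ =
      let c , c≡ = fin-complement i
          c<l = ℕ.+-cancelˡ-< (toℕ i) (suc c) (suc l) (subst (_< toℕ i + suc l) (sym c≡) (ℕ.≰⇒> ≰))
      in ⊥-elim (proj₁ (inside (suc c) (s≤s z≤n) c<l) (trans (cong f (nextⁿ-last c i c≡)) f-zero))
    b = n ∸ (toℕ i + suc l)
    open ≡-Reasoning
    steps : suc n ≡ toℕ i + (suc l + suc b)
    steps = begin
      suc n                          ≡⟨ cong suc (ℕ.m+[n∸m]≡n fits) ⟨
      suc (toℕ i + suc l + b)        ≡⟨ ℕ.+-suc (toℕ i + suc l) b ⟨
      toℕ i + suc l + suc b          ≡⟨ ℕ.+-assoc (toℕ i) (suc l) (suc b) ⟩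
      toℕ i + (suc l + suc b)        ∎
    eq : lap u₀ ≡ walk f (toℕ i) zero ++ ⌜ p ⌝ ∷ walk f l (next i) ++ ⌜ q ⌝ ∷ walk f b (next (nextⁿ (suc l) i))
    eq = begin
      lap u₀                                   ≡⟨ tour ⟨
      walk f (suc n) zero                             ≡⟨ cong (λ a → walk f a zero) steps ⟩
      walk f (toℕ i + (suc l + suc b)) zero           ≡⟨ walk-+ f (toℕ i) _ zero ⟩
      walk f (toℕ i) zero ++ walk f (suc l + suc b) (nextⁿ (toℕ i) zero)
        ≡⟨ cong (λ j → walk f (toℕ i) zero ++ walk f (suc l + suc b) j) (nextⁿ-toℕ i) ⟩
      walk f (toℕ i) zero ++ walk f (suc l + suc b) i
        ≡⟨ cong (walk f (toℕ i) zero ++_) (walk-+ f (suc l) (suc b) i) ⟩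
      walk f (toℕ i) zero ++ f i ∷ walk f l (next i) ++ f (nextⁿ (suc l) i) ∷ walk f b (next (nextⁿ (suc l) i))
        ≡⟨ cong₂ (λ c d → walk f (toℕ i) zero ++ c ∷ walk f l (next i) ++ d ∷ walk f b
            (next (nextⁿ (suc l) i))) p≡ q≡ ⟩
      walk f (toℕ i) zero ++ ⌜ p ⌝ ∷ walk f l (next i) ++ ⌜ q ⌝ ∷ walk f b (next (nextⁿ (suc l) i)) ∎

  mark-of : ∀ {i x} → i ∈ₛ K x → ∃[ p ] (f i ≡ ⌜ p ⌝ × (p ≡ nothing ⊎ p ≡ just x))
  mark-of p with ∈K⁻ p
  ... | inj₁ e = nothing , e , inj₁ refl
  ... | inj₂ e = just _ , e , inj₂ refl

  outside : ∀ {i x p} → i ∉ₛ K x → p ≡ nothing ⊎ p ≡ just x → f i ≢ ⌜ p ⌝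
  outside n (inj₁ refl) e = n (σ⇒∈K _ e)
  outside n (inj₂ refl) e = n (lt⇒∈K e)

  same-path : ∀ x i l → suc l < n → i ∈ₛ K x → nextⁿ (suc l) i ∈ₛ K x →
    (∀ j → 1 ≤ j → j < suc l → nextⁿ j i ∉ₛ K x) → Even l
  same-path x i l l< p q inside =
    let a , a≡ , a∈ = mark-of p
        b , b≡ , b∈ = mark-of q
    in conclude a∈ b∈ (path-gap a b i l l< a≡ b≡
         (λ j 1≤ j< → outside (inside j 1≤ j<) (inj₁ refl) , outside (inside j 1≤ j<) a∈ , outside
             (inside j 1≤ j<) b∈))
    where
    conclude : ∀ {a b} → a ≡ nothing ⊎ a ≡ just x → b ≡ nothing ⊎ b ≡ just x → GapParity a b l → Even l
    conclude (inj₁ refl) (inj₁ refl) g = g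
    conclude (inj₁ refl) (inj₂ refl) g = g
    conclude (inj₂ refl) (inj₁ refl) g = g
    conclude (inj₂ refl) (inj₂ refl) g = proj₁ g refl

  nonconsecutive : ∀ {x y i} → i ∈ₛ K x → next i ∉ₛ K y
  nonconsecutive {i = i} p q with sparse i
  ... | inj₁ e = ε∉K e p
  ... | inj₂ e = ε∉K e q

  -- Such a gap would have length one, which is odd. This rules out triangles made of two rim edges
  -- and a chord.
  no-skip : ∀ {x i} → f (next i) ≡ ε → i ∈ₛ K x → next (next i) ∉ₛ K x
  no-skip {x} {i} e p q = odd-1 (same-path x i 1 (ℕ.≤-trans (s≤s (s≤s (s≤s z≤n))) 5≤n) p q middle)
    where
    middle : ∀ j → 1 ≤ j → j < 2 → nextⁿ j i ∉ₛ K x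
    middle 1 _ _ = ε∉K e
    middle (suc (suc j)) _ (s≤s (s≤s ()))

  next≢′ : ∀ (i : Fin n) → next i ≢ i
  next≢′ = next≢ (ℕ.≤-trans (s≤s (s≤s z≤n)) 5≤n)

  RimPair : Fin n → Fin n → Set
  RimPair u w = w ≡ next u ⊎ u ≡ next w

  Graph : Rel n
  Graph u w = RimPair u w ⊎ (u ≢ w × ∃[ x ] (u ∈ₛ K x × w ∈ₛ K x))

  symmetric : ∀ {u w} → Graph u w → Graph w u
  symmetric (inj₁ e) = inj₁ (Sum.swap e)
  symmetric (inj₂ (n , x , p , q)) = inj₂ (n ∘ sym , x , q , p)

  irreflexive : ∀ u → ¬ Graph u u
  irreflexive u (inj₁ (inj₁ e)) = next≢′ u (sym e)
  irreflexive u (inj₁ (inj₂ e)) = next≢′ u (sym e)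
  irreflexive u (inj₂ (n , _)) = n refl

  -- One end of a rim edge is labelled ε and has no neighbours off the rim.
  no-rim-triangle : ∀ u {w} → Graph u w → Graph (next u) w → w ≢ u → w ≢ next u → ⊥
  no-rim-triangle u a b w≢u w≢nu with sparse u
  no-rim-triangle u (inj₂ (_ , _ , p , _)) b w≢u w≢nu | inj₁ e = ε∉K e p
  no-rim-triangle u (inj₁ (inj₁ g)) b w≢u w≢nu | inj₁ e = w≢nu g
  no-rim-triangle u {w} (inj₁ (inj₂ refl)) (inj₁ (inj₁ g)) w≢u w≢nu | inj₁ e = nextⁿ≢ 2 w
      (ℕ.≤-trans (s≤s (s≤s (s≤s (s≤s z≤n)))) 5≤n) (sym g)
  no-rim-triangle u {w} (inj₁ (inj₂ refl)) (inj₁ (inj₂ g)) w≢u w≢nu | inj₁ e = next≢′ w (next-injective g)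
  no-rim-triangle u {w} (inj₁ (inj₂ refl)) (inj₂ (_ , _ , p , q)) w≢u w≢nu | inj₁ e = no-skip e q p
  no-rim-triangle u a (inj₂ (_ , _ , p , _)) w≢u w≢nu | inj₂ e = ε∉K e p
  no-rim-triangle u a (inj₁ (inj₂ g)) w≢u w≢nu | inj₂ e = w≢u (sym (next-injective g))
  no-rim-triangle u (inj₁ (inj₁ g)) (inj₁ (inj₁ refl)) w≢u w≢nu | inj₂ e = w≢nu g
  no-rim-triangle u (inj₁ (inj₂ g)) (inj₁ (inj₁ refl)) w≢u w≢nu | inj₂ e = nextⁿ≢ 2 u
      (ℕ.≤-trans (s≤s (s≤s (s≤s (s≤s z≤n)))) 5≤n) (sym g)
  no-rim-triangle u (inj₂ (_ , _ , p , q)) (inj₁ (inj₁ refl)) w≢u w≢nu | inj₂ e = no-skip e p q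

  triangle-edge : ∀ {u w t} → Graph u w → Graph u t → Graph w t → ∃[ x ] (u ∈ₛ K x × w ∈ₛ K x)
  triangle-edge (inj₂ (_ , c)) _ _ = c
  triangle-edge {u} (inj₁ (inj₁ refl)) b c = ⊥-elim
      (no-rim-triangle u b c (λ { refl → irreflexive _ b }) (λ { refl → irreflexive _ c }))
  triangle-edge {w = w} (inj₁ (inj₂ refl)) b c = ⊥-elim
      (no-rim-triangle w c b (λ { refl → irreflexive _ c }) (λ { refl → irreflexive _ b }))

  -- Each of the three edges lies in some clique. If `u` carries a letter, the two cliques at `u`
  -- coincide; otherwise `u` is σ, lies in all cliques, and the clique of the opposite edge serves.
  triangle : ∀ {u w t} → Graph u w → Graph u t → Graph w t → ∃[ x ] (u ∈ₛ K x × w ∈ₛ K x × t ∈ₛ K x)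
  triangle {u} a b c =
    let x , u∈ , w∈ = triangle-edge a b c
        y , u∈′ , t∈ = triangle-edge b a (symmetric c)
        z , w∈′ , t∈′ = triangle-edge c (symmetric a) (symmetric b)
    in Sum.[ (λ e → z , σ⇒∈K z e , w∈′ , t∈′) ,
             (λ e → x , u∈ , w∈ , subst (λ x → _ ∈ₛ K x) (sym (∈K-lt e u∈′)) t∈) ]′ (∈K⁻ u∈)

  distinct : ∀ {u w} → Graph u w → u ≢ w
  distinct a refl = irreflexive _ a

  diamondFree : DiamondFree Graph
  diamondFree u w s t s≢t uw us ut ws wt =
    let x , u∈ , w∈ , s∈ = triangle uw us ws
        y , u∈′ , w∈′ , t∈ = triangle uw ut wt
    in inj₂ (s≢t , x , s∈ , subst (λ x → t ∈ₛ K x) (sym (linear (distinct uw) u∈ w∈ u∈′ w∈′)) t∈)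

  K-clique : ∀ x → IsClique Graph (K x)
  K-clique x u w p q n = inj₂ (n , x , p , q)

  absorb : ∀ {x A u w} → IsClique Graph A → u ≢ w → u ∈ₛ A → w ∈ₛ A → u ∈ₛ K x → w ∈ₛ K x → A ⊆ₛ K x
  absorb {x} {A} {u} {w} cl u≢w u∈ w∈ u∈K w∈K {t} t∈ with t Fin.≟ u | t Fin.≟ w
  ... | yes refl | _ = u∈K
  ... | no _ | yes refl = w∈K
  ... | no t≢u | no t≢w =
    let y , p , q , s = triangle (cl u w u∈ w∈ u≢w) (cl u t u∈ t∈ (t≢u ∘ sym)) (cl w t w∈ t∈ (t≢w ∘ sym))
    in subst (λ x → t ∈ₛ K x) (linear u≢w p q u∈K w∈K) s

  K-inscribed : ∀ x → IsInscribed Graph (K x)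
  K-inscribed x = (K-clique x , max) , λ two → odd-size x (subst Even (sym two) (even-+2 (2 ∣0)))
    where
    max : ∀ A → IsClique Graph A → K x ⊆ₛ A → A ⊆ₛ K x
    max A cl K⊆A =
      let i , e = another x
          z∈ = σ⇒∈K {zero} x f-zero
          i∈ = lt⇒∈K e
      in absorb cl (λ z≡i → case trans (sym f-zero) (trans (cong f z≡i) e) of λ ()) (K⊆A z∈) (K⊆A i∈) z∈ i∈

  rim-clique : ∀ i → IsClique Graph (pair i (next i))
  rim-clique i u w p q n with ∈-pair⁻ {u = i} {v = next i} p | ∈-pair⁻ {u = i} {v = next i} q
  ... | inj₁ refl | inj₁ refl = ⊥-elim (n refl)
  ... | inj₁ refl | inj₂ refl = inj₁ (inj₁ refl)
  ... | inj₂ refl | inj₁ refl = inj₁ (inj₂ refl)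
  ... | inj₂ refl | inj₂ refl = ⊥-elim (n refl)

  inscribed⇒K : ∀ A → IsInscribed Graph A → ∃[ x ] K x ≡ A
  inscribed⇒K A ins@((cl , max) , _) =
    let u , w , t , (u∈ , w∈ , t∈) , (w≢u , t≢u , t≢w) = three-vertices next next≢′ zero rim-clique ins
        x , p , q , _ = triangle (cl u w u∈ w∈ (w≢u ∘ sym)) (cl u t u∈ t∈ (t≢u ∘ sym))
            (cl w t w∈ t∈ (t≢w ∘ sym))
        A⊆ = λ {a} → absorb cl (w≢u ∘ sym) u∈ w∈ p q {a}
    in x , ⊆-antisym (max (K x) (K-clique x) A⊆) A⊆

  K-injective : Injective _≡_ _≡_ K
  K-injective {x} {y} e = let i , g = another x in ∈K-lt g (subst (i ∈ₛ_) e (lt⇒∈K g))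

  labelling : IsCliqueLabelling Graph K
  labelling = K-inscribed , K-injective , inscribed⇒K

  two-elements : ∀ {A : Subset n} → ∣ A ∣ ≡ 2 → ∃₂ λ u w → u ≢ w × A ≡ pair u w
  two-elements {A} two =
    let u , u∈ , _ = first
        w , w∈ , w∉ = second u
        u≢w = λ e → w∉ (subst (_∈ₛ ⁅ u ⁆) e (x∈⁅x⁆ u))
    in u , w , u≢w , ⊆-antisym (λ {a} → whole u w u≢w (pair⊆ u∈ w∈) {a}) (pair⊆ u∈ w∈)
    where
    first : ∃[ u ] (u ∈ₛ A × u ∉ₛ ∅)
    first with ⊆⊎∃ A ∅
    ... | inj₂ p = p
    ... | inj₁ A⊆ = case subst₂ _≤_ two (∣⊥∣≡0 n) (p⊆q⇒∣p∣≤∣q∣ A⊆) of λ ()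
    second : ∀ u → ∃[ w ] (w ∈ₛ A × w ∉ₛ ⁅ u ⁆)
    second u with ⊆⊎∃ A ⁅ u ⁆
    ... | inj₂ p = p
    ... | inj₁ A⊆ = case subst₂ _≤_ two (∣⁅x⁆∣≡1 u) (p⊆q⇒∣p∣≤∣q∣ A⊆) of λ { (s≤s ()) }
    whole : ∀ u w → u ≢ w → pair u w ⊆ₛ A → A ⊆ₛ pair u w
    whole u w u≢w ⊆A = decidable-stable (A ⊆? pair u w) (λ A⊈ →
      ℕ.<-irrefl refl (subst₂ _<_ (∣pair∣ u≢w) two (⊈⇒∣<∣ ⊆A A⊈)))

  two⇒rim : ∀ A → IsMaxClique Graph A × ∣ A ∣ ≡ 2 → RimEdge id A
  two⇒rim A ((cl , max) , two) with two-elements {A} two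
  ... | u , w , u≢w , refl with cl u w (∈-pairˡ u w) (∈-pairʳ u w) u≢w
  ... | inj₁ (inj₁ refl) = u , refl
  ... | inj₁ (inj₂ refl) = w , ∪-comm ⁅ u ⁆ ⁅ w ⁆
  -- By maximality the pair would be all of `K x`, whose size is odd.
  ... | inj₂ (_ , x , p , q) = ⊥-elim (odd-size x (subst (Even ∘ ∣_∣) equal (subst Even (sym two) ∣-refl)))
    where
    equal : pair u w ≡ K x
    equal = ⊆-antisym (pair⊆ p q) (max (K x) (K-clique x) (pair⊆ p q))

  rim⇒two : ∀ A → RimEdge id A → IsMaxClique Graph A × ∣ A ∣ ≡ 2
  rim⇒two A (i , refl) = (rim-clique i , max) , ∣pair∣ (next≢′ i ∘ sym)
    where
    max : ∀ A → IsClique Graph A → pair i (next i) ⊆ₛ A → A ⊆ₛ pair i (next i)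
    max A cl ⊆A {w} w∈ with w Fin.≟ i | w Fin.≟ next i
    ... | yes refl | _ = ∈-pairˡ i (next i)
    ... | no _ | yes refl = ∈-pairʳ i (next i)
    ... | no w≢i | no w≢ni =
      ⊥-elim (no-rim-triangle i (cl i w (⊆A (∈-pairˡ i (next i))) w∈ (w≢i ∘ sym))
        (cl (next i) w (⊆A (∈-pairʳ i (next i))) w∈ (w≢ni ∘ sym)) w≢i w≢ni)

  multisun : IsMultisun n Graph id
  multisun = ((λ u w → symmetric) , irreflexive) , diamondFree , odd-n , ℕ.≤-trans (s≤s (s≤s (s≤s z≤n))) 5≤n ,
    id , two⇒rim , rim⇒two , λ A ins i (p , q) → consecutive A ins i p q
    where
    consecutive : ∀ A → IsInscribed Graph A → ∀ i → i ∈ₛ A → next i ∈ₛ A → ⊥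
    consecutive A ins i p q =
      let x , e = inscribed⇒K A ins in nonconsecutive {x} {x} (subst (i ∈ₛ_) (sym e) p)
              (subst (next i ∈ₛ_) (sym e) q)

  module _ {Adj : Rel n} (known : ∀ {A} → IsInscribed Adj A → ∃[ x ] A ≡ K x) where

    even-path : ∀ A → IsInscribed Adj A → ∀ l → suc l < n → ∀ i → i ∈ₛ A → nextⁿ (suc l) i ∈ₛ A →
      (∀ j → 1 ≤ j → j < suc l → ∀ C → IsInscribed Adj C → nextⁿ j i ∉ₛ C) → Even l
    even-path A ins l l< i p q inside =
      let x , e = known ins in
      same-path x i l l< (subst (i ∈ₛ_) e p) (subst (nextⁿ (suc l) i ∈ₛ_) e q)
        (λ j 1≤ j< r → inside j 1≤ j< A ins (subst (nextⁿ j i ∈ₛ_) (sym e) r))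

    N1-holds : N1 Adj id
    -- The number `l` of interior vertices is even, and it is not zero because clique vertices are
    -- nonconsecutive; so there are at least four vertices.
    N1-holds A ins (suc l) (_ , l< , i , p , q , inside) = even-+2 ev , s≤s (s≤s (2≤ l ev p q))
      where
      ev = even-path A ins l l< i p q inside
      2≤ : ∀ l → Even l → i ∈ₛ A → nextⁿ (suc l) i ∈ₛ A → 2 ≤ l
      2≤ zero _ p q = let x , e = known ins in ⊥-elim
          (nonconsecutive {x} {x} (subst (i ∈ₛ_) e p) (subst (next i ∈ₛ_) e q))
      2≤ (suc zero) ev _ _ = ⊥-elim (odd-1 ev)
      2≤ (suc (suc l)) _ _ _ = s≤s (s≤s z≤n)

    N2-holds : N2 Adj
    N2-holds A ins = let x , e = known ins in subst (Odd ∘ ∣_∣) (sym e) (odd-size x)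

    zero∈ : ∀ A → IsInscribed Adj A → zero ∈ₛ A
    zero∈ A ins = let x , e = known ins in subst (zero ∈ₛ_) (sym e) (σ⇒∈K x f-zero)

    N3N4-holds : N3N4 Adj id
    N3N4-holds = zero , zero∈ , meet , λ { A ins (suc l) (inj₁ (_ , l< , i , p , q , inside)) →
        even-+2 (even-path A ins l l< i p (subst (_∈ₛ A) (sym q) (zero∈ A ins)) inside)
      ; A ins (suc l) (inj₂ (_ , l< , i , p , q , inside)) →
        even-+2 (even-path A ins l l< i (subst (_∈ₛ A) (sym p) (zero∈ A ins)) q inside) }
      where
      meet : ∀ A C → IsInscribed Adj A → IsInscribed Adj C → A ≢ C → ∀ u → u ∈ₛ A → u ∈ₛ C → u ≡ zero
      meet A C insA insC A≢C u p q =
        let x , e = known insA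
            y , g = known insC
        in Sum.[ σ⇒zero , (λ u≡ → ⊥-elim (A≢C (trans e
               (trans (cong K (∈K-lt u≡ (subst (u ∈ₛ_) g q))) (sym g))))) ]′
             (∈K⁻ (subst (u ∈ₛ_) e p))

    N5-holds : N5 Adj id
    N5-holds A C insA insC A≢C (suc l) (_ , l< , i , (p , p∉) , (q , q∉) , inside) ev =
      different-path (known insA) (known insC) (even-∸2 ev)
      where
      different-path : ∃[ x ] A ≡ K x → ∃[ y ] C ≡ K y → Odd l
      different-path (x , refl) (y , refl) with ∈K⁻ p | ∈K⁻ q
      ... | inj₁ e | _ = ⊥-elim (p∉ (σ⇒∈K y e))
      ... | inj₂ _ | inj₁ e = ⊥-elim (q∉ (σ⇒∈K x e))
      ... | inj₂ e | inj₂ g = proj₂ (path-gap (just x) (just y) i l l< e g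
        (λ j 1≤ j< → inside j 1≤ j< A insA ∘ σ⇒∈K x , inside j 1≤ j< A insA ∘ lt⇒∈K , inside j 1≤ j< C insC
            ∘ lt⇒∈K))
        (A≢C ∘ cong K)

    -- All that is asked of `Adj` is that its inscribed cliques are among the `K x`. One argument
    -- thus serves the graph and, through `inscribed⇒kept`, all its sub-multisuns.
    conditions : NConditions Adj id
    conditions = N1-holds , N2-holds , N3N4-holds , N5-holds

  sunoid : IsSunoid n Graph id
  sunoid = multisun ,
    conditions {Graph} (λ {A} ins → let x , e = inscribed⇒K A ins in x , sym e) ,
    λ S _ → conditions {deleteCliques Graph S} (λ ins →
      let x , e , _ = Deletion.inscribed⇒kept {K = K} multisun labelling linear S ins in x , e)

  label-K : ∀ i → label K i ≡ f i
  label-K i = go (f i) refl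
    where
    go : ∀ c → f i ≡ c → label K i ≡ c
    go ε e = label-ε {K = K} (λ x → ε∉K e)
    go σ e = let x , y , x≢y = two-letters 2≤m in label-σ {K = K} x≢y (σ⇒∈K x e) (σ⇒∈K y e)
    go (lt x) e = label-lt {K = K} (lt⇒∈K e) (λ q → sym (∈K-lt e q))


-- Block forms meet the requirements of the construction

module FromBlocks {m : ℕ} (B : Blocks m) (form : TypeIIBlocks B) (alternates : Alternates (body B)) where

  private
    v = vWord B
    u = vTail B
    k = length u
    f : Fin (suc k) → Letter m
    f = lookup v

  gap : Gap (lap u)
  gap = alternating⇒gap true (lap u) (subst Alternating (sym (code-vTail B)) alternates)

  tour : walk f (suc (suc k)) zero ≡ lap u
  tour = begin
    walk f (suc (suc k)) zero             ≡⟨ cong (λ a → walk f a zero) (ℕ.+-comm 1 (suc k)) ⟩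
    walk f (suc k + 1) zero             ≡⟨ walk-+ f (suc k) 1 zero ⟩
    walk f (suc k) zero ++ f (nextⁿ (suc k) zero) ∷ []
      ≡⟨ cong (_++ f (nextⁿ (suc k) zero) ∷ [])
          (trans (walk-allFin f) (trans (map-tabulate id f) (tabulate-lookup v))) ⟩
    v ++ f (nextⁿ (suc k) zero) ∷ []      ≡⟨ cong (λ i → v ++ f i ∷ []) (nextⁿ-last k zero refl) ⟩
    v ++ σ ∷ []                     ∎
    where open ≡-Reasoning

  5≤n : 5 ≤ suc k
  5≤n = s≤s (s≤s (s≤s (subst (2 ≤_) (sym (length-++ (spread (body B)) {ε ∷ ε ∷ []}))
      (ℕ.m≤n+m 2 (length (spread (body B)))))))

  σ∉u : σ ∉ u
  σ∉u i = σ∉body B (∈-snoc⁻ {d = ε} (body B) (λ ())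
      (∈-code⁻ true (body B ++ ε ∷ []) (subst (λ Z → nothing ∈ letters Z) (code-spread true (body B) (ε ∷ []))
        (∈-code⁺ true (spread (body B) ++ ε ∷ []) (inner i)))))
    where
    inner : σ ∈ u → σ ∈ spread (body B) ++ ε ∷ []
    inner (there (there j)) = ∈-snoc⁻ {d = ε} (spread (body B) ++ ε ∷ []) (λ ())
      (subst (σ ∈_) (sym (++-assoc (spread (body B)) (ε ∷ []) (ε ∷ []))) j)

  σ⇒zero : ∀ {i} → f i ≡ σ → i ≡ zero
  σ⇒zero {zero} _ = refl
  σ⇒zero {suc i} e = ⊥-elim (σ∉u (subst (_∈ u) e (∈-lookup {xs = u} i)))

  odd-n : Odd (suc k)
  odd-n = even⇒odd k (gap [] nothing u nothing [] refl σ∉u σ∉u)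

  odd-size : ∀ x → Odd ∣ Vec.tabulate (inK x ∘ f) ∣
  -- The clique of `x` consists of σ and the occurrences of `x`, whose number is the even exponent
  -- sum.
  odd-size x = subst Odd (sym size) (even⇒odd (expSum x B) (proj₂ (proj₂ (proj₂ form)) x))
    where
    size : ∣ Vec.tabulate (inK x ∘ f) ∣ ≡ suc (expSum x B)
    size = trans (∣tabulate∣ x v) (cong suc (trans (count-in-++ x (spread (body B)) (ε ∷ ε ∷ []))
      (trans (ℕ.+-identityʳ _) (trans (count-in-spread x (body B)) (count-in-body x B)))))

  another : ∀ x → ∃[ i ] f i ≡ lt x
  another x = Any.index occurs , sym (Anyₚ.lookup-index occurs)
    where
    occurs : lt x ∈ v
    occurs = ∈-snoc⁻ {d = σ} v (λ ()) (∈-code⁻ true (lap u)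
        (subst (λ Z → just x ∈ letters Z) (sym (code-vTail B))
      (∈-code⁺ true (lap (body B)) (there (∈-++⁺ˡ
          (TypeII⇒∈body B (proj₁ form) (proj₁ (proj₂ (proj₂ form)) x)))))))

theorem8 : ∀ {m : ℕ} (w : Word m) → SWordII w →
    (IsSunword w ⇔ DWIsEvenlyWeightedDyck w)
theorem8 {m} w (2≤m , B , form , B≈w) = mk⇔ to from
  where
  to : IsSunword w → DWIsEvenlyWeightedDyck w
  to (zero , _ , _ , _ , ((_ , _ , _ , () , _) , _) , _)
  to (suc k , Adj , r , K , sunoid , labelling , wG≈w) =
    B , (form , B≈w) , alternates⇒dyck 2≤m B form (transfer (sunoid⇒alternates 2≤m sunoid labelling))
    where
    transfer : ∃[ u ] ∃[ v ] (wG K r ≡ u ++ σ ∷ v × σ ∉ v ++ u × Alternates (v ++ u)) → Alternates (body B)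
    transfer (u , v , e , σ∉ , alt) = alternates-π⁻ (body B)
        (choose (unrolls-∼ wG≈w unrolled) (unrolls-∼ B≈w ([] , π (body B) , refl , sym (++-identityʳ _))))
      where
      x = π v ++ π u
      altx : Alternates x
      altx = alternates-π v u alt
      unrolled : Unrolls (π (wG K r)) x
      unrolled = π u , π v , trans (cong π e) (π-mark u nothing v) , refl
      σ∉x : σ ∉ x
      σ∉x i with ∈-++⁻ (π v) i
      ... | inj₁ j = σ∉ (∈-++⁺ˡ (π-∈⁻ v j))
      ... | inj₂ j = σ∉ (∈-++⁺ʳ v (π-∈⁻ u j))
      σ∉rev : σ ∉ reverse x
      σ∉rev = σ∉x ∘ Anyₚ.reverse⁻
      altr : Alternates (reverse x)
      altr = alternates-reverse x σ∉x altx
      y = π (body B)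
      -- The rim word and the block word both unroll from `π w`, each up to reversal. The position
      -- of σ being unique, they agree up to reversal, which preserves alternation.
      choose : Unrolls (π w) x ⊎ Unrolls (π w) (reverse x) → Unrolls (π w) y ⊎ Unrolls (π w) (reverse y) →
          Alternates y
      choose (inj₁ a) (inj₁ b) = subst Alternates (unrolls-unique σ∉x a b) altx
      choose (inj₂ a) (inj₁ b) = subst Alternates (unrolls-unique σ∉rev a b) altr
      choose (inj₁ a) (inj₂ b) = subst Alternates
          (trans (cong reverse (unrolls-unique σ∉x a b)) (reverse-involutive y)) altr
      choose (inj₂ a) (inj₂ b) = subst Alternates
          (reverse-injective {x = x} {y = y} (unrolls-unique σ∉rev a b)) altx

  from : DWIsEvenlyWeightedDyck w → IsSunword w
  from (C , (formC , C≈w) , chain , _ , n , len , dyck) =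
    length (vWord C) , Graph , id , inscribed , sunoid , labelling ,
    -- The rim word is `vWord C`; it has the same reduction as the block word, so it represents the
    -- same cyclic word.
    subst (_∼ π w) (sym (trans (cong π wG≡v) (π-vWord C))) C≈w
    where
    open FromBlocks C formC (dyck⇒alternates 2≤m C formC chain n len dyck)
    open Construction 2≤m (lookup (vWord C)) (vTail C) tour 5≤n odd-n σ⇒zero gap (sparse-lap C) odd-size another
    wG≡v : wG inscribed id ≡ vWord C
    wG≡v = trans (map-cong label-K (allFin _))
        (trans (map-tabulate id (lookup (vWord C))) (tabulate-lookup (vWord C)))
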